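{- (a) Let $G_1$ and $G_2$ be $Q$-cospectral regular graphs and let $H$ be any regular graph. Then $H\odot G_1$ and $H\odot G_2$ are $Q$-cospectral. (b) Let $G_1$ and $G_2$ be $Q$-cospectral regular graphs and let $H$ be any regular graph. Then $G_1\odot H$ and $G_2\odot H$ are $Q$-cospectral. (c) Let $G_1$ and $G_2$ be $Q$-cospectral regular graphs, and let $H_1$ and $H_2$ be another pair of $Q$-cospectral regular graphs. Then $G_1\odot H_1$ and $G_2\odot H_2$ are $Q$-cospectral.
   Context: All graphs are finite, simple and connected. $Q(G)=D(G)+A(G)$ is the signless Laplacian matrix of $G$, where $A(G)$ is the adjacency matrix and $D(G)$ the diagonal matrix of vertex degrees. Two non-isomorphic graphs are called $Q$-cospectral if their signless Laplacian matrices have the same eigenvalues with the same multiplicities. The central graph $C(G)$ of $G$ is obtained from $G$ by subdividing each edge of $G$ exactly once and joining all pairs of distinct vertices of $G$ that are nonadjacent in $G$. For graphs $G,G'$, the central vertex corona $G\odot G'$ is obtained by taking one copy of $C(G)$ and $|V(G)|$ copies of $G'$, and joining the $i$-th vertex $v_i$ of $G$ (viewed in $C(G)$) to every vertex in the $i$-th copy of $G'$, for each $i$. -}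

module Defs where

open import Algebra.Apartness.Bundles using (HeytingField; HeytingCommutativeRing)
open import Algebra.Bundles using (CommutativeRing; Semiring)
import Algebra.Definitions.RawSemiring as RawSemiringDefs
open import Data.Bool.Base using (Bool; true; false; _∧_; _∨_; not; if_then_else_; T)
open import Data.Bool.Properties using (∧-zeroʳ)
open import Data.Fin.Base using (Fin; zero; suc; toℕ; _↑ˡ_; splitAt; remQuot; punchIn)
open import Data.Fin.Permutation using (Permutation; _⟨$⟩ʳ_)
open import Data.Fin.Properties using (_≟_)
open import Data.Fin.Subset using (Subset; ∣_∣)
open import Data.List.Base using (List; foldr; length; lookup; filterᵇ; allFin; cartesianProduct)
open import Data.Nat.Base as ℕ using (ℕ; zero; suc; _<ᵇ_; NonZero)
open import Data.Product.Base using (Σ-syntax; ∃-syntax; _×_; _,_; proj₁; proj₂)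
open import Data.Sum.Base using (_⊎_; inj₁; inj₂; map₂)
open import Data.Vec.Base using (tabulate)
open import Data.Vec.Functional using (Vector)
open import Function.Base using (_∘_)
open import Function.Bundles using (_⇔_; mk⇔)
open import Level using (_⊔_)
open import Relation.Binary.Construct.Closure.ReflexiveTransitive using (Star)
open import Relation.Binary.PropositionalEquality using (_≡_; refl; sym; trans; cong; cong₂)
open import Relation.Nullary using (¬_; does)
open import Relation.Nullary.Decidable using (does-⇔; dec-true)

------------------------------------------------------------------------
-- Finite simple graphs

record Graph : Set where
  field
    order      : ℕ
    adj        : Fin order → Fin order → Bool
    adj-sym    : ∀ u v → adj u v ≡ adj v u
    adj-irrefl : ∀ v → adj v v ≡ false

  Vertex : Set
  Vertex = Fin order

  degree : Vertex → ℕ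
  degree v = ∣ tabulate (adj v) ∣

  -- Every edge is listed exactly once, with its smaller endpoint first.
  edges : List (Vertex × Vertex)
  edges = filterᵇ (λ (u , v) → (toℕ u <ᵇ toℕ v) ∧ adj u v)
                  (cartesianProduct (allFin order) (allFin order))

  size : ℕ
  size = length edges

  Edge : Set
  Edge = Fin size

  incident : Vertex → Edge → Bool
  incident v e = does (v ≟ proj₁ (lookup edges e)) ∨ does (v ≟ proj₂ (lookup edges e))

open Graph

Connected : Graph → Set
Connected G = NonZero (order G) × (∀ u v → Star (λ x y → T (adj G x y)) u v)

Regular : Graph → Set
Regular G = ∃[ r ] ∀ v → degree G v ≡ r

Isomorphic : Graph → Graph → Set
Isomorphic G H =
  Σ[ π ∈ Permutation (order G) (order H) ]
    ∀ u v → adj G u v ≡ adj H (π ⟨$⟩ʳ u) (π ⟨$⟩ʳ v)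

pullback : ∀ {A : Set} {n} → (Fin n → A) → (_~_ : A → A → Bool) →
           (∀ a b → (a ~ b) ≡ (b ~ a)) → (∀ a → (a ~ a) ≡ false) → Graph
pullback {n = n} f _~_ ~-sym ~-irrefl = record
  { order      = n
  ; adj        = λ u v → f u ~ f v
  ; adj-sym    = λ u v → ~-sym (f u) (f v)
  ; adj-irrefl = λ v → ~-irrefl (f v)
  }

≟-sym : ∀ {n} (u v : Fin n) → does (u ≟ v) ≡ does (v ≟ u)
≟-sym u v = does-⇔ (mk⇔ sym sym) (u ≟ v) (v ≟ u)

------------------------------------------------------------------------
-- The central graph

-- The vertex inj₂ e is the one subdividing the edge e.
centralAdj : (G : Graph) → (a b : Vertex G ⊎ Edge G) → Bool
centralAdj G (inj₁ u) (inj₁ v) = not (does (u ≟ v)) ∧ not (adj G u v)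
centralAdj G (inj₁ u) (inj₂ e) = incident G u e
centralAdj G (inj₂ e) (inj₁ u) = incident G u e
centralAdj G (inj₂ _) (inj₂ _) = false

centralAdj-sym : ∀ G a b → centralAdj G a b ≡ centralAdj G b a
centralAdj-sym G (inj₁ u) (inj₁ v) =
  cong₂ (λ x y → not x ∧ not y) (≟-sym u v) (adj-sym G u v)
centralAdj-sym G (inj₁ _) (inj₂ _) = refl
centralAdj-sym G (inj₂ _) (inj₁ _) = refl
centralAdj-sym G (inj₂ _) (inj₂ _) = refl

centralAdj-irrefl : ∀ G a → centralAdj G a a ≡ false
centralAdj-irrefl G (inj₁ u) =
  cong (λ x → not x ∧ not (adj G u u)) (dec-true (u ≟ u) refl)
centralAdj-irrefl G (inj₂ _) = refl

central : Graph → Graph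
central G = pullback {n = order G ℕ.+ size G} (splitAt (order G))
                     (centralAdj G) (centralAdj-sym G) (centralAdj-irrefl G)

------------------------------------------------------------------------
-- The central vertex corona

-- inj₂ (i , w) is the vertex w of the i-th copy of G′, and i ↑ˡ size G is
-- the i-th vertex of G viewed in the central graph.
coronaAdj : (G G′ : Graph) → (a b : Vertex (central G) ⊎ (Vertex G × Vertex G′)) → Bool
coronaAdj G G′ (inj₁ c)       (inj₁ d)       = adj (central G) c d
coronaAdj G G′ (inj₁ c)       (inj₂ (i , _)) = does (c ≟ i ↑ˡ size G)
coronaAdj G G′ (inj₂ (i , _)) (inj₁ c)       = does (c ≟ i ↑ˡ size G)
coronaAdj G G′ (inj₂ (i , w)) (inj₂ (j , z)) = does (i ≟ j) ∧ adj G′ w z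

coronaAdj-sym : ∀ G G′ a b → coronaAdj G G′ a b ≡ coronaAdj G G′ b a
coronaAdj-sym G G′ (inj₁ c)       (inj₁ d)       = adj-sym (central G) c d
coronaAdj-sym G G′ (inj₁ _)       (inj₂ _)       = refl
coronaAdj-sym G G′ (inj₂ _)       (inj₁ _)       = refl
coronaAdj-sym G G′ (inj₂ (i , w)) (inj₂ (j , z)) = cong₂ _∧_ (≟-sym i j) (adj-sym G′ w z)

coronaAdj-irrefl : ∀ G G′ a → coronaAdj G G′ a a ≡ false
coronaAdj-irrefl G G′ (inj₁ c)       = adj-irrefl (central G) c
coronaAdj-irrefl G G′ (inj₂ (i , w)) =
  trans (cong (does (i ≟ i) ∧_) (adj-irrefl G′ w)) (∧-zeroʳ (does (i ≟ i)))

infixl 7 _⊙_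
_⊙_ : Graph → Graph → Graph
G ⊙ G′ = pullback {n = order (central G) ℕ.+ order G ℕ.* order G′}
                  (map₂ (remQuot (order G′)) ∘ splitAt (order (central G)))
                  (coronaAdj G G′) (coronaAdj-sym G G′) (coronaAdj-irrefl G G′)

------------------------------------------------------------------------
-- Eigenvalues and Q-cospectrality

-- Spectra are taken in a field K.  A Heyting field is used so that the
-- complex numbers of constructive analysis qualify, as well as discrete
-- fields such as the algebraic numbers.
module _ {c ℓ₁ ℓ₂} (K : HeytingField c ℓ₁ ℓ₂) where

  open HeytingField K using (Carrier; _≈_; _#_; _+_; _*_; -_; _-_; 0#; 1#; heytingCommutativeRing)
  private
    rawSemiring = Semiring.rawSemiring (CommutativeRing.semiring
      (HeytingCommutativeRing.commutativeRing heytingCommutativeRing))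

  open RawSemiringDefs rawSemiring using (_^_; sum) renaming (_×_ to _·_)

  CharacteristicZero : Set ℓ₂
  CharacteristicZero = ∀ n → (suc n · 1#) # 0#

  -- Every monic polynomial of positive degree has a root.
  AlgebraicallyClosed : Set (c ⊔ ℓ₁)
  AlgebraicallyClosed = ∀ n (a : Vector Carrier (suc n)) →
    ∃[ x ] (x ^ suc n + sum (λ i → a i * x ^ toℕ i)) ≈ 0#

  Matrix : ℕ → Set c
  Matrix n = Fin n → Fin n → Carrier

  -- Laplace expansion along the first row.
  det : ∀ {n} → Matrix n → Carrier
  det {zero}  M = 1#
  det {suc n} M =
    sum (λ j → (- 1#) ^ toℕ j * M zero j * det (λ i k → M (suc i) (punchIn j k)))

  scalar : ∀ {n} → Carrier → Matrix n
  scalar x i j = if does (i ≟ j) then x else 0#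

  -- x ↦ det (x I − M), as a polynomial function.
  charPoly : ∀ {n} → Matrix n → Carrier → Carrier
  charPoly M x = det (λ i j → scalar x i j - M i j)

  -- Coefficients are listed from the constant term upwards.
  eval : List Carrier → Carrier → Carrier
  eval p x = foldr (λ a y → a + x * y) 0# p

  -- The multiplicity of an eigenvalue is its multiplicity as a root of the
  -- characteristic polynomial; multiplicity 0 means "not an eigenvalue".
  -- Over an infinite field (in particular in characteristic zero), an
  -- identity of polynomials is the same as an identity of their values.
  HasMultiplicity : ∀ {n} → Matrix n → Carrier → ℕ → Set (c ⊔ ℓ₁ ⊔ ℓ₂)
  HasMultiplicity M t m =
    ∃[ q ] (∀ x → charPoly M x ≈ (x - t) ^ m * eval q x) × (eval q t # 0#)

  adjacencyMatrix : (G : Graph) → Matrix (order G)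
  adjacencyMatrix G i j = if adj G i j then 1# else 0#

  degreeMatrix : (G : Graph) → Matrix (order G)
  degreeMatrix G i j = if does (i ≟ j) then degree G i · 1# else 0#

  signlessLaplacian : (G : Graph) → Matrix (order G)
  signlessLaplacian G i j = degreeMatrix G i j + adjacencyMatrix G i j

  QCospectral : Graph → Graph → Set (c ⊔ ℓ₁ ⊔ ℓ₂)
  QCospectral G H =
    ¬ Isomorphic G H ×
    (∀ t m → HasMultiplicity (signlessLaplacian G) t m ⇔
             HasMultiplicity (signlessLaplacian H) t m)

module Submission where

-- Let G be r-regular on n vertices with m edges, and G′ be r′-regular on n′
-- vertices.  Order the vertices of G ⊙ G′ as vertices of G, subdivided edges,
-- vertices of the copies.  In x I − Q(G ⊙ G′) the last two diagonal blocks
-- are (x − 2) I and a block diagonal matrix with n blocks (x − 1) I − Q(G′),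
-- and two Schur complements (det-schur) split them off.  Since the columns of
-- Q(G′) all sum to 2 r′, and since the incidence matrix B of G satisfies
-- B Bᵀ = Q(G) (incidence-gram), the remaining block is α I + β Q(G) − J, with J
-- the all-ones matrix and α, β depending on x, n, n′, r, r′ only.  All columns
-- of Q(G) sum to 2 r, so J can be removed as well (det-minus-ones), which
-- leaves a polynomial that is determined by r and the characteristic polynomial
-- of Q(G).  This proves corona-charPoly for all x other than 2, 3 and 1 + 2 r′.
-- Hence the characteristic polynomial of Q(G ⊙ G′) depends on n, m, r, n′, r′
-- and the characteristic polynomials of Q(G) and Q(G′) only (corona-alike), the
-- excluded values of x being irrelevant in characteristic zero (agree-off).
--
-- Q-cospectral regular graphs agree in all these data.  The multiplicities
-- determine the characteristic polynomial, because it splits into linear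
-- factors (sameSpectrum⇒sameCharPoly).  Equality in K need not be decidable, so
-- one cannot decide which roots coincide; but equality is stable under double
-- negation by tightness of the apartness relation, and under a double negation
-- finitely many such decisions are harmless.  The characteristic polynomial
-- determines the order (its degree) and the trace n r of Q, hence the degree
-- r, and then m by the handshake lemma.
--
-- It remains to see that the coronas are not isomorphic, that is, that an
-- isomorphism of coronas yields one of the given graphs.  In G ⊙ G′ the vertices
-- of G have degree n − 1 + n′, the subdividing vertices degree 2, and the vertices
-- of the copies degree r′ + 1, where r′ + 1 ≤ n′.  If one of the connected graphs
-- G and G′ is not complete, it has positive degree and at least three vertices,
-- and the first of these degrees exceeds the other two; so an isomorphism maps
-- the vertices of the first factor to each other.  They induce the complement of
-- G, whence bases-isomorphic.  If G′ has positive degree, a vertex of a copy has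
-- a neighbour in that copy, whereas all neighbours of a subdividing vertex belong
-- to G; so the copy attached to a vertex is mapped to the copy attached to its
-- image, whence copies-isomorphic.  If the factor in question is complete, it is
-- determined by its order anyway (complete-isomorphic).

open import Defs
open import Algebra.Apartness.Bundles using (HeytingField; HeytingCommutativeRing)
import Algebra.Apartness.Properties.HeytingCommutativeRing as HeytingProperties
open import Algebra.Bundles using (CommutativeRing; Semiring; RawRing)
import Algebra.Definitions.RawSemiring as RawSemiringDefs
import Algebra.Properties.Ring as RingProperties
import Algebra.Properties.Semiring.Mult as MultProperties
import Algebra.Properties.Semiring.Mult.TCOptimised as OptimisedMult
import Algebra.Properties.Semiring.Sum as SumProperties
import Algebra.Solver.Ring as RingSolver
open import Algebra.Solver.Ring.AlmostCommutativeRing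
  using (fromCommutativeRing; _-Raw-AlmostCommutative⟶_)
open import Data.Bool.Base using (Bool; true; false; _∧_; not; if_then_else_; T)
open import Data.Bool.Properties using (T-∧)
open import Data.Empty using (⊥; ⊥-elim)
open import Data.Fin.Base
  using (Fin; zero; suc; toℕ; _↑ˡ_; _↑ʳ_; splitAt; remQuot; combine; punchIn)
open import Data.Fin.Permutation
  using (Permutation; permutation; _⟨$⟩ʳ_; _⟨$⟩ˡ_; inverseˡ; inverseʳ; flip; cast-id)
open import Data.Fin.Properties
  using (_≟_; suc-injective; toℕ-injective; punchInᵢ≢i; toℕ-↑ˡ; ↑ˡ-injective; ↑ʳ-injective;
         splitAt-↑ˡ; splitAt-↑ʳ; join-splitAt; combine-remQuot; remQuot-combine; combine-injective)
open import Data.Fin.Subset using (∣_∣)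
open import Data.List.Base
  using (List; []; _∷_; _++_; length; foldr; map; lookup; filterᵇ; cartesianProduct; allFin)
  renaming (tabulate to tabulateᴸ)
open import Data.List.Relation.Unary.All using (All; []; _∷_)
open import Data.Maybe.Base using (Maybe; just; nothing)
open import Data.Nat.Base as ℕ using (ℕ; zero; suc; _≤_; z≤n; s≤s; _<ᵇ_; NonZero)
import Data.Nat.Properties as ℕₚ
open import Data.Product.Base using (Σ-syntax; ∃-syntax; _×_; _,_; proj₁; proj₂)
open import Data.Sum.Base as Sum using (inj₁; inj₂)
open import Data.Vec.Base using (tabulate)
import Data.Vec.Functional as Vector
open import Function.Base using (_∘_; const)
open import Function.Bundles using (_⇔_; mk⇔; Equivalence)
open import Level using (Level; _⊔_)
open import Relation.Binary.Construct.Closure.ReflexiveTransitive using (Star; ε; _◅_)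
open import Relation.Binary.Definitions using (tri<; tri≈; tri>)
open import Relation.Binary.PropositionalEquality as ≡ using (_≡_; _≢_)
import Relation.Binary.Reasoning.Setoid as SetoidReasoning
open import Relation.Nullary using (¬_; does; yes; no)
open import Relation.Nullary.Decidable using (dec-true; dec-false; does-⇔)

-- Arithmetic of Heyting fields: ring solver, apartness, finite sums

module Field {c ℓ₁ ℓ₂ : Level} (K : HeytingField c ℓ₁ ℓ₂) where

  open HeytingField K public
    using (Carrier; _≈_; _#_; _+_; _*_; -_; _-_; 0#; 1#; heytingCommutativeRing;
           tight; #⇒invertible; #-irrefl)
  commutativeRing : CommutativeRing c ℓ₁
  commutativeRing = HeytingCommutativeRing.commutativeRing heytingCommutativeRing

  open CommutativeRing commutativeRing public
    using (semiring; ring; setoid; refl; sym; trans; reflexive;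
           +-cong; +-congˡ; +-congʳ; *-cong; *-congˡ; *-congʳ; -‿cong;
           +-assoc; +-comm; *-assoc; *-comm; +-identityˡ; +-identityʳ;
           *-identityˡ; *-identityʳ; zeroˡ; zeroʳ; distribˡ; distribʳ;
           -‿inverseʳ)
  open RawSemiringDefs (Semiring.rawSemiring semiring) public
    using (_^_; sum) renaming (_×_ to _·_)
  open HeytingProperties heytingCommutativeRing public
    using (1#0; x#0y#0→xy#0; #-congʳ)
  open RingProperties ring using (-‿distribˡ-*; -‿distribʳ-*; -‿+-comm; -‿involutive)
  open MultProperties semiring public using (×-homo-+; ×1-homo-*)
  open OptimisedMult semiring using (×ᵤ≈×) renaming (_×_ to _·′_)
  open SumProperties semiring public
    using (sum-cong-≋; ∑-distrib-+; ∑-comm; sum-permute; sum-replicate-zero;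
           *-distribˡ-sum; *-distribʳ-sum)
  open SetoidReasoning setoid public

  -- The image of a natural number in K.
  ι : ℕ → Carrier
  ι n = n · 1#

  -- The ring solver, with formal differences of natural numbers as
  -- coefficients: (a , b) stands for a − b.  Sums and products are brought to
  -- the form where a or b is zero, to make coefficients unique.
  private
    normal : ℕ × ℕ → ℕ × ℕ
    normal (a , b) = a ℕ.∸ b , b ℕ.∸ a

    Differences : RawRing _ _
    Differences = record
      { Carrier = ℕ × ℕ
      ; _≈_     = _≡_
      ; _+_     = λ (a , b) (a′ , b′) → normal (a ℕ.+ a′ , b ℕ.+ b′)
      ; _*_     = λ (a , b) (a′ , b′) → normal (a ℕ.* a′ ℕ.+ b ℕ.* b′ , a ℕ.* b′ ℕ.+ b ℕ.* a′)
      ; -_      = λ (a , b) → b , a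
      ; 0#      = 0 , 0
      ; 1#      = 1 , 0
      }

    interchange : ∀ a b d e → (a + b) + (d + e) ≈ (a + d) + (b + e)
    interchange a b d e = begin
      (a + b) + (d + e)  ≈⟨ +-assoc a b (d + e) ⟩
      a + (b + (d + e))  ≈⟨ +-congˡ (+-assoc b d e) ⟨
      a + ((b + d) + e)  ≈⟨ +-congˡ (+-congʳ (+-comm b d)) ⟩
      a + ((d + b) + e)  ≈⟨ +-congˡ (+-assoc d b e) ⟩
      a + (d + (b + e))  ≈⟨ +-assoc a d (b + e) ⟨
      (a + d) + (b + e)  ∎

    neg-* : ∀ a b → (- a) * (- b) ≈ a * b
    neg-* a b = begin
      (- a) * (- b)  ≈⟨ -‿distribˡ-* a (- b) ⟨
      - (a * - b)    ≈⟨ -‿cong (-‿distribʳ-* a b) ⟨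
      - - (a * b)    ≈⟨ -‿involutive (a * b) ⟩
      a * b          ∎

    -- The case distinction and the optimised multiples make the coefficients 0
    -- and 1 denote 0# and 1# by definition, as the solver needs.
    value : ℕ × ℕ → Carrier
    value (a , zero)  = a ·′ 1#
    value (a , suc b) = ι a - ι (suc b)

    value≈ : ∀ a b → value (a , b) ≈ ι a - ι b
    value≈ a zero    = begin
      a ·′ 1#    ≈⟨ ×ᵤ≈× a 1# ⟨
      ι a        ≈⟨ +-identityʳ (ι a) ⟨
      ι a + 0#   ≈⟨ +-congˡ (trans (sym (+-identityˡ _)) (-‿inverseʳ 0#)) ⟨
      ι a - 0#   ∎
    value≈ a (suc b) = refl

    ι-+-* : ∀ a a′ b b′ → ι (a ℕ.* a′ ℕ.+ b ℕ.* b′) ≈ ι a * ι a′ + ι b * ι b′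
    ι-+-* a a′ b b′ =
      trans (×-homo-+ 1# (a ℕ.* a′) (b ℕ.* b′)) (+-cong (×1-homo-* a a′) (×1-homo-* b b′))

    value-+ : ∀ a b a′ b′ → value (a ℕ.+ a′ , b ℕ.+ b′) ≈ value (a , b) + value (a′ , b′)
    value-+ a b a′ b′ = begin
      value (a ℕ.+ a′ , b ℕ.+ b′)      ≈⟨ value≈ (a ℕ.+ a′) (b ℕ.+ b′) ⟩
      ι (a ℕ.+ a′) - ι (b ℕ.+ b′)      ≈⟨ +-cong (×-homo-+ 1# a a′) (-‿cong (×-homo-+ 1# b b′)) ⟩
      (ι a + ι a′) - (ι b + ι b′)      ≈⟨ +-congˡ (-‿+-comm (ι b) (ι b′)) ⟨
      (ι a + ι a′) + (- ι b + - ι b′)  ≈⟨ interchange _ _ _ _ ⟩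
      (ι a - ι b) + (ι a′ - ι b′)      ≈⟨ +-cong (value≈ a b) (value≈ a′ b′) ⟨
      value (a , b) + value (a′ , b′)  ∎

    value-* : ∀ a b a′ b′ →
      value (a ℕ.* a′ ℕ.+ b ℕ.* b′ , a ℕ.* b′ ℕ.+ b ℕ.* a′) ≈ value (a , b) * value (a′ , b′)
    value-* a b a′ b′ = begin
      value (a ℕ.* a′ ℕ.+ b ℕ.* b′ , a ℕ.* b′ ℕ.+ b ℕ.* a′)
        ≈⟨ value≈ (a ℕ.* a′ ℕ.+ b ℕ.* b′) (a ℕ.* b′ ℕ.+ b ℕ.* a′) ⟩
      ι (a ℕ.* a′ ℕ.+ b ℕ.* b′) - ι (a ℕ.* b′ ℕ.+ b ℕ.* a′)
        ≈⟨ +-cong (ι-+-* a a′ b b′) (-‿cong (ι-+-* a b′ b a′)) ⟩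
      (ι a * ι a′ + ι b * ι b′) - (ι a * ι b′ + ι b * ι a′)
        ≈⟨ +-congˡ (-‿+-comm _ _) ⟨
      (ι a * ι a′ + ι b * ι b′) + (- (ι a * ι b′) + - (ι b * ι a′))
        ≈⟨ interchange _ _ _ _ ⟩
      (ι a * ι a′ + - (ι a * ι b′)) + (ι b * ι b′ + - (ι b * ι a′))
        ≈⟨ +-congˡ (+-comm _ _) ⟩
      (ι a * ι a′ + - (ι a * ι b′)) + (- (ι b * ι a′) + ι b * ι b′)
        ≈⟨ +-cong (+-congˡ (-‿distribʳ-* _ _))
                  (+-cong (-‿distribˡ-* _ _) (sym (neg-* _ _))) ⟩
      (ι a * ι a′ + ι a * - ι b′) + (- ι b * ι a′ + - ι b * - ι b′)
        ≈⟨ +-cong (distribˡ _ _ _) (distribˡ _ _ _) ⟨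
      ι a * (ι a′ - ι b′) + - ι b * (ι a′ - ι b′)
        ≈⟨ distribʳ _ _ _ ⟨
      (ι a - ι b) * (ι a′ - ι b′)
        ≈⟨ *-cong (value≈ a b) (value≈ a′ b′) ⟨
      value (a , b) * value (a′ , b′)
        ∎

    value-neg : ∀ a b → value (b , a) ≈ - value (a , b)
    value-neg a b = begin
      value (b , a)      ≈⟨ value≈ b a ⟩
      ι b - ι a          ≈⟨ +-comm _ _ ⟩
      - ι a + ι b        ≈⟨ +-congˡ (-‿involutive (ι b)) ⟨
      - ι a + - - ι b    ≈⟨ -‿+-comm (ι a) (- ι b) ⟩
      - (ι a - ι b)      ≈⟨ -‿cong (value≈ a b) ⟨
      - value (a , b)    ∎

    shift : ∀ i j → ι i ≈ ι (i ℕ.+ j) - ι j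
    shift i j = begin
      ι i                  ≈⟨ +-identityʳ _ ⟨
      ι i + 0#             ≈⟨ +-congˡ (-‿inverseʳ (ι j)) ⟨
      ι i + (ι j - ι j)    ≈⟨ +-assoc _ _ _ ⟨
      ι i + ι j - ι j      ≈⟨ +-congʳ (×-homo-+ 1# i j) ⟨
      ι (i ℕ.+ j) - ι j    ∎

    value-cong : ∀ a b a′ b′ → a ℕ.+ b′ ≡ a′ ℕ.+ b → value (a , b) ≈ value (a′ , b′)
    value-cong a b a′ b′ eq = begin
      value (a , b)                  ≈⟨ value≈ a b ⟩
      ι a - ι b                      ≈⟨ +-congʳ (shift a b′) ⟩
      (ι (a ℕ.+ b′) - ι b′) - ι b    ≡⟨ ≡.cong (λ k → (ι k - ι b′) - ι b) eq ⟩
      (ι (a′ ℕ.+ b) - ι b′) - ι b    ≈⟨ +-assoc _ _ _ ⟩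
      ι (a′ ℕ.+ b) + (- ι b′ - ι b)  ≈⟨ +-congˡ (+-comm _ _) ⟩
      ι (a′ ℕ.+ b) + (- ι b - ι b′)  ≈⟨ +-assoc _ _ _ ⟨
      (ι (a′ ℕ.+ b) - ι b) - ι b′    ≈⟨ +-congʳ (shift a′ b) ⟨
      ι a′ - ι b′                    ≈⟨ value≈ a′ b′ ⟨
      value (a′ , b′)                ∎

    value-normal : ∀ a b → value (normal (a , b)) ≈ value (a , b)
    value-normal a b = value-cong (a ℕ.∸ b) (b ℕ.∸ a) a b (balance a b)
      where
      balance : ∀ a b → (a ℕ.∸ b) ℕ.+ b ≡ a ℕ.+ (b ℕ.∸ a)
      balance zero    zero    = ≡.refl
      balance zero    (suc b) = ≡.refl
      balance (suc a) zero    = ≡.refl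
      balance (suc a) (suc b) = ≡.trans (ℕₚ.+-suc (a ℕ.∸ b) b) (≡.cong suc (balance a b))

    differences-equal? : ∀ p q → Maybe (value p ≈ value q)
    differences-equal? (a , b) (a′ , b′) with a ℕ.+ b′ ℕₚ.≟ a′ ℕ.+ b
    ... | no _   = nothing
    ... | yes eq = just (value-cong a b a′ b′ eq)

    difference : Differences -Raw-AlmostCommutative⟶ fromCommutativeRing commutativeRing
    difference = record
      { ⟦_⟧    = value
      ; +-homo = λ (a , b) (a′ , b′) → trans (value-normal (a ℕ.+ a′) (b ℕ.+ b′)) (value-+ a b a′ b′)
      ; *-homo = λ (a , b) (a′ , b′) →
          trans (value-normal (a ℕ.* a′ ℕ.+ b ℕ.* b′) (a ℕ.* b′ ℕ.+ b ℕ.* a′)) (value-* a b a′ b′)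
      ; -‿homo = λ (a , b) → value-neg a b
      ; 0-homo = refl
      ; 1-homo = refl
      }

  module Solver = RingSolver Differences (fromCommutativeRing commutativeRing) difference differences-equal?
  open Solver public using (solve; _:=_; _:+_; _:*_; :-_; _:-_; con; Polynomial)

  :0 :1 : ∀ {n} → Polynomial n
  :0 = con (0 , 0)
  :1 = con (1 , 0)

  -- Tightness makes equality stable under double negation.
  ≈-stable : ∀ {x y} → ¬ ¬ (x ≈ y) → x ≈ y
  ≈-stable {x} {y} ¬¬x≈y = proj₁ (tight x y) λ x#y → ¬¬x≈y λ x≈y → #-irrefl x≈y x#y

  ¬#⇒≈ : ∀ {x y} → ¬ (x # y) → x ≈ y
  ¬#⇒≈ {x} {y} = proj₁ (tight x y)

  #⇒≉ : ∀ {x y} → x # y → ¬ (x ≈ y)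
  #⇒≉ x#y x≈y = #-irrefl x≈y x#y

  -- In the proof of an equality, any two elements may be taken to be apart or equal.
  ≈-by-cases : ∀ {x y} {a b} → (a # b → x ≈ y) → (a ≈ b → x ≈ y) → x ≈ y
  ≈-by-cases apart equal =
    ≈-stable λ x≉y → x≉y (equal (¬#⇒≈ λ a#b → x≉y (apart a#b)))

  x-y≈0⇒x≈y : ∀ {x y} → x - y ≈ 0# → x ≈ y
  x-y≈0⇒x≈y {x} {y} x-y≈0 = begin
    x            ≈⟨ solve 2 (λ x y → x := (x :- y) :+ y) refl x y ⟩
    (x - y) + y  ≈⟨ +-congʳ x-y≈0 ⟩
    0# + y       ≈⟨ +-identityˡ y ⟩
    y            ∎

  x≈y⇒x-y≈0 : ∀ {x y} → x ≈ y → x - y ≈ 0#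
  x≈y⇒x-y≈0 {x} {y} x≈y = trans (+-congʳ x≈y) (-‿inverseʳ y)

  inverse : ∀ {x y} → x # y → Σ[ i ∈ Carrier ] i * (x - y) ≈ 1#
  inverse x#y with #⇒invertible x#y
  ... | i , i*[x-y]≈1 , _ = i , i*[x-y]≈1

  #⇒-#0 : ∀ {x y} → x # y → x - y # 0#
  #⇒-#0 {x} {y} x#y with inverse x#y
  ... | i , i*[x-y]≈1 = HeytingProperties.invertibleˡ⇒# heytingCommutativeRing
    (i , trans (*-congˡ (solve 2 (λ x y → (x :- y) :- :0 := x :- y) refl x y)) i*[x-y]≈1)

  *-cancel-# : ∀ {a b} → a # 0# → a * b ≈ 0# → b ≈ 0#
  *-cancel-# {a} {b} a#0 ab≈0 with inverse a#0
  ... | i , i*[a-0]≈1 = begin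
    b                  ≈⟨ *-identityˡ b ⟨
    1# * b             ≈⟨ *-congʳ i*[a-0]≈1 ⟨
    i * (a - 0#) * b   ≈⟨ solve 3 (λ i a b → i :* (a :- :0) :* b := i :* (a :* b)) refl i a b ⟩
    i * (a * b)        ≈⟨ *-congˡ ab≈0 ⟩
    i * 0#             ≈⟨ zeroʳ i ⟩
    0#                 ∎

  ^-#0 : ∀ {x} n → x # 0# → x ^ n # 0#
  ^-#0 zero    x#0 = 1#0
  ^-#0 (suc n) x#0 = x#0y#0→xy#0 x#0 (^-#0 n x#0)

  ^-cong : ∀ {x y} n → x ≈ y → x ^ n ≈ y ^ n
  ^-cong zero    x≈y = refl
  ^-cong (suc n) x≈y = *-cong x≈y (^-cong n x≈y)

  sum-cong : ∀ {n} {f g : Fin n → Carrier} → (∀ i → f i ≈ g i) → sum f ≈ sum g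
  sum-cong = sum-cong-≋

  sum-zero : ∀ {n} {f : Fin n → Carrier} → (∀ i → f i ≈ 0#) → sum f ≈ 0#
  sum-zero {n} f≈0 = trans (sum-cong f≈0) (sum-replicate-zero n)

  sum-neg : ∀ {n} (f : Fin n → Carrier) → sum (λ i → - f i) ≈ - sum f
  sum-neg {zero}  f = solve 0 (:0 := :- :0) refl
  sum-neg {suc n} f = begin
    - f zero + sum (λ i → - f (suc i))  ≈⟨ +-congˡ (sum-neg (f ∘ suc)) ⟩
    - f zero + - sum (f ∘ suc)          ≈⟨ -‿+-comm _ _ ⟩
    - (f zero + sum (f ∘ suc))          ∎

  sum-+-split : ∀ a {b} (f : Fin (a ℕ.+ b) → Carrier) →
                sum f ≈ sum (λ i → f (i ↑ˡ b)) + sum (λ j → f (a ↑ʳ j))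
  sum-+-split zero    f = sym (+-identityˡ _)
  sum-+-split (suc a) f = trans (+-congˡ (sum-+-split a (f ∘ suc))) (sym (+-assoc _ _ _))

  sum-*-split : ∀ a {b} (f : Fin (a ℕ.* b) → Carrier) →
                sum f ≈ sum (λ i → sum (λ w → f (combine {a} {b} i w)))
  sum-*-split zero        f = refl
  sum-*-split (suc a) {b} f =
    trans (sum-+-split b f) (+-congˡ (sum-*-split a (λ j → f (b ↑ʳ j))))

  -- The truth value of a boolean as an element of K.
  [_] : Bool → Carrier
  [ b ] = if b then 1# else 0#

  -- The Kronecker delta, on the test that occurs in the matrices of a graph.
  δ : ∀ {n} → Fin n → Fin n → Carrier
  δ i j = [ does (i ≟ j) ]

  sum-δ : ∀ {n} (i : Fin n) (f : Fin n → Carrier) → sum (λ j → δ i j * f j) ≈ f i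
  sum-δ zero f = begin
    1# * f zero + sum (λ j → 0# * f (suc j))  ≈⟨ +-cong (*-identityˡ _) (sum-zero λ j → zeroˡ (f (suc j))) ⟩
    f zero + 0#                               ≈⟨ +-identityʳ _ ⟩
    f zero                                    ∎
  sum-δ (suc i) f = begin
    0# * f zero + sum (λ j → δ i j * f (suc j))  ≈⟨ +-cong (zeroˡ _) (sum-δ i (f ∘ suc)) ⟩
    0# + f (suc i)                               ≈⟨ +-identityˡ _ ⟩
    f (suc i)                                    ∎

  δ-sym : ∀ {n} (i j : Fin n) → δ i j ≡ δ j i
  δ-sym i j = ≡.cong [_] (≟-sym i j)

  sum-const : ∀ n a → sum {n} (λ _ → a) ≈ ι n * a
  sum-const zero    a = sym (zeroˡ a)
  sum-const (suc n) a = begin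
    a + sum {n} (λ _ → a)  ≈⟨ +-congˡ (sum-const n a) ⟩
    a + ι n * a            ≈⟨ solve 2 (λ a k → a :+ k :* a := (:1 :+ k) :* a) refl a (ι n) ⟩
    (1# + ι n) * a         ∎

-- Determinants: row operations, Schur complements, the all-ones matrix

module Determinants {c ℓ₁ ℓ₂ : Level} (K : HeytingField c ℓ₁ ℓ₂) where

  open Field K

  -- The sign of column j in an expansion along the first row.
  sign : ∀ {n} → Fin n → Carrier
  sign j = (- 1#) ^ toℕ j

  -- M without its first row and its column j.
  minor : ∀ {n} → Matrix K (suc n) → Fin (suc n) → Matrix K n
  minor M j i k = M (suc i) (punchIn j k)

  -- The terms of the expansion of det M along the first row.
  laplace : ∀ {n} → Matrix K (suc n) → Fin (suc n) → Carrier
  laplace M j = sign j * M zero j * det K (minor M j)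

  det-cong : ∀ {n} {M N : Matrix K n} → (∀ i j → M i j ≈ N i j) → det K M ≈ det K N
  det-cong {zero}  M≈N = refl
  det-cong {suc n} {M} {N} M≈N = sum-cong {f = laplace M} {laplace N} λ j →
    *-cong (*-congˡ (M≈N zero j)) (det-cong λ i k → M≈N (suc i) (punchIn j k))

  det-minors-cong : ∀ {n} {M N : Matrix K (suc n)} → (∀ j → M zero j ≈ N zero j) →
    (∀ j → det K (minor M j) ≈ det K (minor N j)) → det K M ≈ det K N
  det-minors-cong {n} {M} {N} row minors =
    sum-cong {f = laplace M} {laplace N} λ j → *-cong (*-congˡ (row j)) (minors j)

  det-row-linear : ∀ {n} (p : Fin n) (x : Carrier) {L M N : Matrix K n} →
    (∀ i j → i ≢ p → L i j ≈ M i j) → (∀ i j → i ≢ p → L i j ≈ N i j) →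
    (∀ j → L p j ≈ M p j + x * N p j) →
    det K L ≈ det K M + x * det K N
  det-row-linear {suc n} zero x {L} {M} {N} L≈M L≈N row = begin
    det K L
      ≈⟨ sum-cong {f = laplace L} {λ j → tM j + x * (sign j * N zero j * det K (minor M j))} (λ j → trans
           (*-cong (*-congˡ (row j)) (dM j))
           (solve 5 (λ s m x n d → s :* (m :+ x :* n) :* d := s :* m :* d :+ x :* (s :* n :* d))
              refl (sign j) (M zero j) x (N zero j) (det K (minor M j)))) ⟩
    sum (λ j → tM j + x * (sign j * N zero j * det K (minor M j)))
      ≈⟨ ∑-distrib-+ tM (λ j → x * (sign j * N zero j * det K (minor M j))) ⟩
    sum tM + sum (λ j → x * (sign j * N zero j * det K (minor M j)))
      ≈⟨ +-congˡ (sum-cong {f = λ j → x * (sign j * N zero j * det K (minor M j))} {λ j → x * tN j}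
           λ j → *-congˡ (*-congˡ (trans (sym (dM j)) (dN j)))) ⟩
    sum tM + sum (λ j → x * tN j)
      ≈⟨ +-congˡ (*-distribˡ-sum x tN) ⟨
    det K M + x * det K N
      ∎
    where
    tM tN : Fin (suc n) → Carrier
    tM = laplace M
    tN = laplace N
    dM : ∀ j → det K (minor L j) ≈ det K (minor M j)
    dM j = det-cong λ i k → L≈M (suc i) (punchIn j k) λ ()
    dN : ∀ j → det K (minor L j) ≈ det K (minor N j)
    dN j = det-cong λ i k → L≈N (suc i) (punchIn j k) λ ()
  det-row-linear {suc n} (suc p) x {L} {M} {N} L≈M L≈N row = begin
    det K L
      ≈⟨ sum-cong {f = laplace L} {λ j → tM j + x * tN j} (λ j → begin
           sign j * L zero j * det K (minor L j)
             ≈⟨ *-congˡ (det-row-linear p x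
                  (λ i k i≢p → L≈M (suc i) (punchIn j k) (i≢p ∘ suc-injective))
                  (λ i k i≢p → L≈N (suc i) (punchIn j k) (i≢p ∘ suc-injective))
                  (λ k → row (punchIn j k))) ⟩
           sign j * L zero j * (det K (minor M j) + x * det K (minor N j))
             ≈⟨ solve 5 (λ s l m x n → s :* l :* (m :+ x :* n) := s :* l :* m :+ x :* (s :* l :* n))
                  refl (sign j) (L zero j) (det K (minor M j)) x (det K (minor N j)) ⟩
           sign j * L zero j * det K (minor M j) + x * (sign j * L zero j * det K (minor N j))
             ≈⟨ +-cong (*-congʳ (*-congˡ (L≈M zero j λ ())))
                       (*-congˡ (*-congʳ (*-congˡ (L≈N zero j λ ())))) ⟩
           tM j + x * tN j ∎) ⟩
    sum (λ j → tM j + x * tN j)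
      ≈⟨ ∑-distrib-+ tM (λ j → x * tN j) ⟩
    sum tM + sum (λ j → x * tN j)
      ≈⟨ +-congˡ (*-distribˡ-sum x tN) ⟨
    det K M + x * det K N
      ∎
    where
    tM tN : Fin (suc n) → Carrier
    tM = laplace M
    tN = laplace N

  -- Expanding a determinant along its first two rows gives a sum over pairs
  -- (j , k), standing for the pair of distinct columns j and punchIn j k.
  pairSum : ∀ {n} (a b : Fin (suc n) → Carrier) (D : Fin (suc n) → Fin n → Carrier) → Carrier
  pairSum a b D = sum λ j → sign j * a j * sum λ k → sign k * b (punchIn j k) * D j k

  -- If (j , k) stands for the columns (x , y), then
  -- (punchIn j k , opposite j k) stands for (y , x).
  opposite : ∀ {n} → Fin (suc n) → Fin n → Fin n
  opposite zero    zero    = zero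
  opposite zero    (suc k) = zero
  opposite (suc j) zero    = j
  opposite (suc j) (suc k) = suc (opposite j k)

  punchIn-opposite : ∀ {n} (j : Fin (suc (suc n))) k (x : Fin n) →
    punchIn j (punchIn k x) ≡ punchIn (punchIn j k) (punchIn (opposite j k) x)
  punchIn-opposite zero    zero    x       = ≡.refl
  punchIn-opposite zero    (suc k) x       = ≡.refl
  punchIn-opposite (suc j) zero    x       = ≡.refl
  punchIn-opposite (suc j) (suc k) zero    = ≡.refl
  punchIn-opposite (suc j) (suc k) (suc x) = ≡.cong suc (punchIn-opposite j k x)

  -- The pairs involving column 0 cancel directly; the remaining ones form a
  -- sum of the same kind over one column fewer.
  pairSum-antisym : ∀ {n} (a b : Fin (suc n) → Carrier) D →
    (∀ j k → D j k ≈ D (punchIn j k) (opposite j k)) →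
    pairSum a b D + pairSum b a D ≈ 0#
  pairSum-antisym {zero} a b D D-sym =
    solve 2 (λ a b → (:1 :* a :* :0 :+ :0) :+ (:1 :* b :* :0 :+ :0) := :0) refl (a zero) (b zero)
  pairSum-antisym {suc n} a b D D-sym = begin
    pairSum a b D + pairSum b a D
      ≈⟨ +-cong (split a b) (split b a) ⟩
    (first a b - first b a + rest a b) + (first b a - first a b + rest b a)
      ≈⟨ solve 4 (λ x y u v → (x :- y :+ u) :+ (y :- x :+ v) := u :+ v) refl
           (first a b) (first b a) (rest a b) (rest b a) ⟩
    rest a b + rest b a
      ≈⟨ pairSum-antisym (a ∘ suc) (b ∘ suc) (λ j k → D (suc j) (suc k))
           (λ j k → D-sym (suc j) (suc k)) ⟩
    0#
      ∎
    where
    first rest : (a b : Fin (suc (suc n)) → Carrier) → Carrier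
    first a b = a zero * sum λ k → sign k * b (suc k) * D zero k
    rest a b = pairSum (a ∘ suc) (b ∘ suc) λ j k → D (suc j) (suc k)

    D-zero : ∀ j → D (suc j) zero ≈ D zero j
    D-zero zero    = sym (D-sym zero zero)
    D-zero (suc j) = sym (D-sym zero (suc j))

    module _ (a b : Fin (suc (suc n)) → Carrier) where
      t u v w : Fin (suc n) → Carrier
      t j = sign j * a (suc j) * D zero j
      u j = sum λ k → sign (suc k) * b (suc (punchIn j k)) * D (suc j) (suc k)
      v j = sum λ k → sign k * b (suc (punchIn j k)) * D (suc j) (suc k)
      w j = sign j * a (suc j) * v j

      u≈-v : ∀ j → u j ≈ - v j
      u≈-v j = trans
        (sum-cong λ k → solve 3 (λ s b d → (:- :1 :* s) :* b :* d := :- (s :* b :* d)) refl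
                          (sign k) (b (suc (punchIn j k))) (D (suc j) (suc k)))
        (sum-neg λ k → sign k * b (suc (punchIn j k)) * D (suc j) (suc k))

      term : ∀ j → sign (suc j) * a (suc j) * (1# * b zero * D (suc j) zero + u j)
                   ≈ - b zero * t j + w j
      term j = begin
        sign (suc j) * a (suc j) * (1# * b zero * D (suc j) zero + u j)
          ≈⟨ *-congˡ (+-cong (*-congˡ (D-zero j)) (u≈-v j)) ⟩
        sign (suc j) * a (suc j) * (1# * b zero * D zero j + - v j)
          ≈⟨ solve 5 (λ s a b d v → (:- :1 :* s) :* a :* (:1 :* b :* d :+ :- v)
                                    := :- b :* (s :* a :* d) :+ s :* a :* v) refl
               (sign j) (a (suc j)) (b zero) (D zero j) (v j) ⟩
        - b zero * t j + w j
          ∎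

      split : pairSum a b D ≈ first a b - first b a + rest a b
      split = begin
        pairSum a b D
          ≈⟨ +-congˡ (sum-cong term) ⟩
        1# * a zero * sum (λ k → sign k * b (suc k) * D zero k) + sum (λ j → - b zero * t j + w j)
          ≈⟨ +-congˡ (∑-distrib-+ (λ j → - b zero * t j) w) ⟩
        1# * a zero * sum (λ k → sign k * b (suc k) * D zero k) + (sum (λ j → - b zero * t j) + sum w)
          ≈⟨ +-congˡ (+-congʳ (sym (*-distribˡ-sum (- b zero) t))) ⟩
        1# * a zero * sum (λ k → sign k * b (suc k) * D zero k) + (- b zero * sum t + sum w)
          ≈⟨ solve 5 (λ a s b t w → :1 :* a :* s :+ (:- b :* t :+ w) := a :* s :- b :* t :+ w) refl
               (a zero) (sum λ k → sign k * b (suc k) * D zero k) (b zero) (sum t) (sum w) ⟩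
        first a b - first b a + rest a b
          ∎

  -- M with its first two rows exchanged.
  swap₀₁ : ∀ {n} → Matrix K (suc (suc n)) → Matrix K (suc (suc n))
  swap₀₁ M zero          = M (suc zero)
  swap₀₁ M (suc zero)    = M zero
  swap₀₁ M (suc (suc i)) = M (suc (suc i))

  det-swap₀₁ : ∀ {n} (M : Matrix K (suc (suc n))) → det K M + det K (swap₀₁ M) ≈ 0#
  det-swap₀₁ M = pairSum-antisym (M zero) (M (suc zero))
    (λ j k → det K (λ i x → M (suc (suc i)) (punchIn j (punchIn k x))))
    (λ j k → det-cong λ i x → reflexive (≡.cong (M (suc (suc i))) (punchIn-opposite j k x)))

  sum-term-zero : ∀ {n} (s m d : Fin n → Carrier) → (∀ j → d j ≈ 0#) →
                  sum (λ j → s j * m j * d j) ≈ 0#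
  sum-term-zero s m d d≈0 = sum-zero λ j → trans (*-congˡ (d≈0 j)) (zeroʳ (s j * m j))

  -- M with its first row replaced by a row of ones.
  onesFirst : ∀ {n} → Matrix K n → Matrix K n
  onesFirst M zero    j = 1#
  onesFirst M (suc i) j = M (suc i) j

  module Alternating (char0 : CharacteristicZero K) where

    -- If the equal rows are the first two, exchanging them shows 2 det M = 0.
    -- Otherwise, exchanging the first two rows moves the equal rows into all minors.
    det-equal-rows : ∀ {n} (M : Matrix K (suc n)) k → (∀ j → M zero j ≈ M (suc k) j) → det K M ≈ 0#
    det-equal-rows {suc n} M zero row = *-cancel-# (char0 1) (begin
      ι 2 * det K M              ≈⟨ solve 1 (λ d → (:1 :+ (:1 :+ :0)) :* d := d :+ d) refl (det K M) ⟩
      det K M + det K M          ≈⟨ +-congˡ (det-cong {M = M} {swap₀₁ M} swapped) ⟩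
      det K M + det K (swap₀₁ M) ≈⟨ det-swap₀₁ M ⟩
      0#                         ∎)
      where
      swapped : ∀ i j → M i j ≈ swap₀₁ M i j
      swapped zero          j = row j
      swapped (suc zero)    j = sym (row j)
      swapped (suc (suc i)) j = refl
    det-equal-rows {suc n} M (suc k) row = begin
      det K M                     ≈⟨ +-identityʳ _ ⟨
      det K M + 0#                ≈⟨ +-congˡ (sum-term-zero sign (M (suc zero)) (λ j → det K (minor (swap₀₁ M) j)) λ j →
                                       det-equal-rows (minor (swap₀₁ M) j) k λ x → row (punchIn j x)) ⟨
      det K M + det K (swap₀₁ M)  ≈⟨ det-swap₀₁ M ⟩
      0#                          ∎

    -- The determinant is unchanged when multiples of other rows are added to
    -- the first row.
    det-add-to-first : ∀ {n} b (x : Fin b → Carrier) (f : Fin b → Fin n) {L M : Matrix K (suc n)} →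
      (∀ j → L zero j ≈ M zero j + sum (λ k → x k * M (suc (f k)) j)) →
      (∀ i j → L (suc i) j ≈ M (suc i) j) →
      det K L ≈ det K M
    det-add-to-first zero x f {L} {M} row rows =
      det-cong {M = L} {M} λ { zero j → trans (row j) (+-identityʳ _) ; (suc i) j → rows i j }
    det-add-to-first {n} (suc b) x f {L} {M} row rows = begin
      det K L
        ≈⟨ det-row-linear zero (x zero) {L} {M₁} {M₂}
             (λ { zero j 0≢0 → ⊥-elim (0≢0 ≡.refl) ; (suc i) j _ → rows i j })
             (λ { zero j 0≢0 → ⊥-elim (0≢0 ≡.refl) ; (suc i) j _ → rows i j })
             (λ j → trans (row j)
                (solve 3 (λ m y s → m :+ (y :+ s) := (m :+ s) :+ y) refl
                   (M zero j) (x zero * M (suc (f zero)) j)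
                   (sum λ k → x (suc k) * M (suc (f (suc k))) j))) ⟩
      det K M₁ + x zero * det K M₂
        ≈⟨ +-cong (det-add-to-first b (x ∘ suc) (f ∘ suc) {M₁} {M} (λ j → refl) (λ i j → refl))
                  (*-congˡ (det-equal-rows M₂ (f zero) λ j → refl)) ⟩
      det K M + x zero * 0#
        ≈⟨ solve 2 (λ d x → d :+ x :* :0 := d) refl (det K M) (x zero) ⟩
      det K M
        ∎
      where
      M₁ M₂ : Matrix K (suc n)
      M₁ zero    j = M zero j + sum λ k → x (suc k) * M (suc (f (suc k))) j
      M₁ (suc i) j = M (suc i) j
      M₂ zero    j = M (suc (f zero)) j
      M₂ (suc i) j = M (suc i) j

    -- The determinant is unchanged when multiples of the last b rows are added
    -- to the first a rows.
    det-add-lower-rows : ∀ a {b} (x : Fin a → Fin b → Carrier) {L M : Matrix K (a ℕ.+ b)} →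
      (∀ i j → L (i ↑ˡ b) j ≈ M (i ↑ˡ b) j + sum (λ k → x i k * M (a ↑ʳ k) j)) →
      (∀ k j → L (a ↑ʳ k) j ≈ M (a ↑ʳ k) j) →
      det K L ≈ det K M
    det-add-lower-rows zero    x top bottom = det-cong bottom
    det-add-lower-rows (suc a) {b} x {L} {M} top bottom = begin
      det K L
        ≈⟨ det-minors-cong {M = L} {N} (λ j → refl) (λ j →
             det-add-lower-rows a (x ∘ suc)
               (λ i k → top (suc i) (punchIn j k)) (λ i k → bottom i (punchIn j k))) ⟩
      det K N
        ≈⟨ det-add-to-first b (x zero) (a ↑ʳ_) {N} {M} (top zero) (λ i j → refl) ⟩
      det K M
        ∎
      where
      N : Matrix K (suc a ℕ.+ b)
      N zero    = L zero
      N (suc i) = M (suc i)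

    -- A function of finitely many variables that never depends on any one of
    -- them is constant.
    coordinatewise-constant : ∀ n (F : (Fin n → Carrier) → Carrier) →
      (∀ x y → (∀ i → x i ≈ y i) → F x ≈ F y) →
      (∀ k x y → (∀ i → i ≢ k → x i ≈ y i) → F x ≈ F y) →
      ∀ x y → F x ≈ F y
    coordinatewise-constant zero    F F-cong F-const x y = F-cong x y λ ()
    coordinatewise-constant (suc n) F F-cong F-const x y = begin
      F x                     ≈⟨ F-const zero x (y zero Vector.∷ (x ∘ suc))
                                   (λ { zero 0≢0 → ⊥-elim (0≢0 ≡.refl) ; (suc i) _ → refl }) ⟩
      F (y zero Vector.∷ (x ∘ suc))  ≈⟨ coordinatewise-constant n (λ z → F (y zero Vector.∷ z))
                                   (λ z z′ z≈z′ → F-cong _ _ λ { zero → refl ; (suc i) → z≈z′ i })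
                                   (λ k z z′ z≈z′ → F-const (suc k) _ _
                                      λ { zero _ → refl ; (suc i) i≢k → z≈z′ i (i≢k ∘ ≡.cong suc) })
                                   (x ∘ suc) (y ∘ suc) ⟩
      F (y zero Vector.∷ (y ∘ suc))  ≈⟨ F-cong _ _ (λ { zero → refl ; (suc i) → refl }) ⟩
      F y                     ∎

    -- The determinant is unchanged when multiples of the first row are added
    -- to the other rows.
    det-add-first : ∀ {n} (x : Fin n → Carrier) {L M : Matrix K (suc n)} →
      (∀ j → L zero j ≈ M zero j) →
      (∀ i j → L (suc i) j ≈ M (suc i) j + x i * M zero j) →
      det K L ≈ det K M
    det-add-first {n} x {L} {M} row rows = begin
      det K L            ≈⟨ det-cong {M = L} {A x} (λ { zero j → row j ; (suc i) j → rows i j }) ⟩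
      F x                ≈⟨ coordinatewise-constant n F
                              (λ y z y≈z → det-cong {M = A y} {A z} λ { zero j → refl ; (suc i) j → +-congˡ (*-congʳ (y≈z i)) })
                              F-const x (const 0#) ⟩
      F (const 0#)       ≈⟨ det-cong {M = A (const 0#)} {M} (λ { zero j → refl
                                        ; (suc i) j → trans (+-congˡ (zeroˡ (M zero j))) (+-identityʳ (M (suc i) j)) }) ⟩
      det K M            ∎
      where
      A : (Fin n → Carrier) → Matrix K (suc n)
      A y zero    j = M zero j
      A y (suc i) j = M (suc i) j + y i * M zero j
      F : (Fin n → Carrier) → Carrier
      F y = det K (A y)

      F-const : ∀ k y z → (∀ i → i ≢ k → y i ≈ z i) → F y ≈ F z
      F-const k y z y≈z = begin
        F y
          ≈⟨ det-row-linear (suc k) (y k - z k) {A y} {A z} {N} off₁ off₂ on ⟩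
        F z + (y k - z k) * det K N
          ≈⟨ +-congˡ (*-congˡ (det-equal-rows N k (λ j → sym (reflexive (N-on j))))) ⟩
        F z + (y k - z k) * 0#
          ≈⟨ solve 2 (λ f x → f :+ x :* :0 := f) refl (F z) (y k - z k) ⟩
        F z
          ∎
        where
        N : Matrix K (suc n)
        N zero    j = M zero j
        N (suc i) j = if does (i ≟ k) then M zero j else A z (suc i) j
        N-on : ∀ j → N (suc k) j ≡ M zero j
        N-on j rewrite dec-true (k ≟ k) ≡.refl = ≡.refl
        off₁ : ∀ i j → i ≢ suc k → A y i j ≈ A z i j
        off₁ zero    j _     = refl
        off₁ (suc i) j i≢k = +-congˡ (*-congʳ (y≈z i (i≢k ∘ ≡.cong suc)))
        off₂ : ∀ i j → i ≢ suc k → A y i j ≈ N i j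
        off₂ zero    j _     = refl
        off₂ (suc i) j i≢k rewrite dec-false (i ≟ k) (i≢k ∘ ≡.cong suc) = off₁ (suc i) j i≢k
        on : ∀ j → A y (suc k) j ≈ A z (suc k) j + (y k - z k) * N (suc k) j
        on j rewrite N-on j =
          solve 4 (λ m y z r → m :+ y :* r := (m :+ z :* r) :+ (y :- z) :* r) refl
            (M (suc k) j) (y k) (z k) (M zero j)

    det-lower-block : ∀ a {b} (M : Matrix K (a ℕ.+ b)) → (∀ i j → M (i ↑ˡ b) (a ↑ʳ j) ≈ 0#) →
      det K M ≈ det K (λ i j → M (i ↑ˡ b) (j ↑ˡ b)) * det K (λ i j → M (a ↑ʳ i) (a ↑ʳ j))
    det-lower-block zero        M upper = sym (*-identityˡ _)
    det-lower-block (suc a) {b} M upper = begin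
      det K M
        ≈⟨ sum-+-split (suc a) (λ j → sign j * M zero j * det K (minor M j)) ⟩
      sum (λ j → sign (j ↑ˡ b) * M zero (j ↑ˡ b) * det K (minor M (j ↑ˡ b)))
        + sum (λ j → sign (suc a ↑ʳ j) * M zero (suc a ↑ʳ j) * det K (minor M (suc a ↑ʳ j)))
        ≈⟨ +-cong (sum-cong term) (sum-zero λ j →
             trans (*-congʳ (trans (*-congˡ (upper zero j)) (zeroʳ _))) (zeroˡ (det K (minor M (suc a ↑ʳ j))))) ⟩
      sum (λ j → sign j * M zero (j ↑ˡ b) * det K (minor TL j) * det K BR) + 0#
        ≈⟨ +-identityʳ _ ⟩
      sum (λ j → sign j * M zero (j ↑ˡ b) * det K (minor TL j) * det K BR)
        ≈⟨ *-distribʳ-sum (det K BR) (λ j → sign j * M zero (j ↑ˡ b) * det K (minor TL j)) ⟨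
      det K TL * det K BR
        ∎
      where
      TL : Matrix K (suc a)
      TL i j = M (i ↑ˡ b) (j ↑ˡ b)
      BR : Matrix K b
      BR i j = M (suc a ↑ʳ i) (suc a ↑ʳ j)

      punchIn-↑ˡ : ∀ {a} (j : Fin (suc a)) (k : Fin a) → punchIn (j ↑ˡ b) (k ↑ˡ b) ≡ punchIn j k ↑ˡ b
      punchIn-↑ˡ zero    k       = ≡.refl
      punchIn-↑ˡ (suc j) zero    = ≡.refl
      punchIn-↑ˡ (suc j) (suc k) = ≡.cong suc (punchIn-↑ˡ j k)

      punchIn-↑ʳ : ∀ {a} (j : Fin (suc a)) (k : Fin b) → punchIn (j ↑ˡ b) (a ↑ʳ k) ≡ suc a ↑ʳ k
      punchIn-↑ʳ         zero    k = ≡.refl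
      punchIn-↑ʳ {suc a} (suc j) k = ≡.cong suc (punchIn-↑ʳ j k)

      term : ∀ j → sign (j ↑ˡ b) * M zero (j ↑ˡ b) * det K (minor M (j ↑ˡ b))
                   ≈ sign j * M zero (j ↑ˡ b) * det K (minor TL j) * det K BR
      term j = trans
        (*-cong (*-congʳ (reflexive (≡.cong ((- 1#) ^_) (toℕ-↑ˡ j b))))
          (trans (det-lower-block a (minor M (j ↑ˡ b))
                   (λ i k → trans (reflexive (≡.cong (M (suc (i ↑ˡ b))) (punchIn-↑ʳ j k))) (upper (suc i) k)))
            (*-cong (det-cong λ i k → reflexive (≡.cong (M (suc (i ↑ˡ b))) (punchIn-↑ˡ j k)))
                    (det-cong λ i k → reflexive (≡.cong (M (suc (a ↑ʳ i))) (punchIn-↑ʳ j k))))))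
        (sym (*-assoc _ _ _))

    -- If adding multiples of the last b rows clears the upper right block of M,
    -- then det M is the product of the determinants of the diagonal blocks.
    det-schur : ∀ a {b} (M : Matrix K (a ℕ.+ b)) (x : Fin a → Fin b → Carrier) →
      (∀ i j → M (i ↑ˡ b) (a ↑ʳ j) + sum (λ k → x i k * M (a ↑ʳ k) (a ↑ʳ j)) ≈ 0#) →
      det K M ≈ det K (λ i j → M (i ↑ˡ b) (j ↑ˡ b) + sum (λ k → x i k * M (a ↑ʳ k) (j ↑ˡ b)))
                * det K (λ i j → M (a ↑ʳ i) (a ↑ʳ j))
    det-schur a {b} M x clear = begin
      det K M  ≈⟨ det-add-lower-rows a x {L} {M} (λ i j → reflexive (L-top i j)) L-bottom ⟨
      det K L  ≈⟨ det-lower-block a L (λ i j → trans (reflexive (L-top i (a ↑ʳ j))) (clear i j)) ⟩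
      det K (λ i j → L (i ↑ˡ b) (j ↑ˡ b)) * det K (λ i j → L (a ↑ʳ i) (a ↑ʳ j))
               ≈⟨ *-cong (det-cong λ i j → reflexive (L-top i (j ↑ˡ b)))
                         (det-cong λ i j → L-bottom i (a ↑ʳ j)) ⟩
      _        ∎
      where
      L : Matrix K (a ℕ.+ b)
      L p j = M p j + Sum.[ (λ i → sum (λ k → x i k * M (a ↑ʳ k) j)) , (λ _ → 0#) ]′ (splitAt a p)
      L-top : ∀ i j → L (i ↑ˡ b) j ≡ M (i ↑ˡ b) j + sum (λ k → x i k * M (a ↑ʳ k) j)
      L-top i j rewrite splitAt-↑ˡ a i b = ≡.refl
      L-bottom : ∀ k j → L (a ↑ʳ k) j ≈ M (a ↑ʳ k) j
      L-bottom k j rewrite splitAt-↑ʳ a b k = +-identityʳ _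

    -- Adding all other rows to the first row makes it constant.
    det-onesFirst : ∀ {n} (P : Matrix K (suc n)) γ → (∀ j → sum (λ i → P i j) ≈ γ) →
      det K P ≈ γ * det K (onesFirst P)
    det-onesFirst {n} P γ columns = begin
      det K P
        ≈⟨ det-add-to-first n (const 1#) (λ i → i) {L} {P}
             (λ j → trans (sym (columns j)) (+-congˡ (sum-cong λ k → sym (*-identityˡ (P (suc k) j)))))
             (λ i j → refl) ⟨
      det K L
        ≈⟨ sum-cong (λ j → solve 3 (λ s g d → s :* g :* d := g :* (s :* :1 :* d)) refl
                             (sign j) γ (det K (minor P j))) ⟩
      sum (λ j → γ * (sign j * 1# * det K (minor P j)))
        ≈⟨ *-distribˡ-sum γ (λ j → sign j * 1# * det K (minor P j)) ⟨
      γ * det K (onesFirst P)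
        ∎
      where
      L : Matrix K (suc n)
      L zero    j = γ
      L (suc i) j = P (suc i) j

    -- If all columns of P sum to γ, subtracting the all-ones matrix from P
    -- amounts to replacing the factor γ of det P by γ − (n + 1).
    det-minus-ones : ∀ {n} (P : Matrix K (suc n)) γ → (∀ j → sum (λ i → P i j) ≈ γ) →
      det K (λ i j → P i j - 1#) ≈ (γ - ι (suc n)) * det K (onesFirst P)
    det-minus-ones {n} P γ columns = begin
      det K (λ i j → P i j - 1#)
        ≈⟨ det-onesFirst (λ i j → P i j - 1#) (γ - ι (suc n)) columns′ ⟩
      (γ - ι (suc n)) * det K (onesFirst (λ i j → P i j - 1#))
        ≈⟨ *-congˡ (det-add-first (const (- 1#)) {onesFirst (λ i j → P i j - 1#)} {onesFirst P}
             (λ j → refl)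
             (λ i j → solve 1 (λ p → p :- :1 := p :+ (:- :1) :* :1) refl (P (suc i) j))) ⟩
      (γ - ι (suc n)) * det K (onesFirst P)
        ∎
      where
      columns′ : ∀ j → sum (λ i → P i j - 1#) ≈ γ - ι (suc n)
      columns′ j = begin
        sum (λ i → P i j - 1#)
          ≈⟨ ∑-distrib-+ (λ i → P i j) (λ _ → - 1#) ⟩
        sum (λ i → P i j) + sum {suc n} (λ _ → - 1#)
          ≈⟨ +-cong (columns j) (sum-const (suc n) (- 1#)) ⟩
        γ + ι (suc n) * - 1#
          ≈⟨ solve 2 (λ g k → g :+ k :* (:- :1) := g :- k) refl γ (ι (suc n)) ⟩
        γ - ι (suc n)
          ∎

    det-* : ∀ {n} x (M : Matrix K n) → det K (λ i j → x * M i j) ≈ x ^ n * det K M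
    det-* {zero}  x M = sym (*-identityˡ 1#)
    det-* {suc n} x M = begin
      sum (λ j → sign j * (x * M zero j) * det K (λ i k → x * minor M j i k))
        ≈⟨ sum-cong (λ j → trans (*-congˡ (det-* x (minor M j)))
             (solve 5 (λ s x m p d → s :* (x :* m) :* (p :* d) := (x :* p) :* (s :* m :* d)) refl
                (sign j) x (M zero j) (x ^ n) (det K (minor M j)))) ⟩
      sum (λ j → x ^ suc n * (sign j * M zero j * det K (minor M j)))
        ≈⟨ *-distribˡ-sum (x ^ suc n) (λ j → sign j * M zero j * det K (minor M j)) ⟨
      x ^ suc n * det K M
        ∎

    det-onesFirst-* : ∀ {n} x (M : Matrix K (suc n)) →
      det K (onesFirst (λ i j → x * M i j)) ≈ x ^ n * det K (onesFirst M)
    det-onesFirst-* {n} x M = begin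
      sum (λ j → sign j * 1# * det K (λ i k → x * minor M j i k))
        ≈⟨ sum-cong (λ j → trans (*-congˡ (det-* x (minor M j)))
             (solve 3 (λ s p d → s :* :1 :* (p :* d) := p :* (s :* :1 :* d)) refl
                (sign j) (x ^ n) (det K (minor M j)))) ⟩
      sum (λ j → x ^ n * (sign j * 1# * det K (minor M j)))
        ≈⟨ *-distribˡ-sum (x ^ n) (λ j → sign j * 1# * det K (minor M j)) ⟨
      x ^ n * det K (onesFirst M)
        ∎

    det-scalar : ∀ n x → det K {n} (scalar K x) ≈ x ^ n
    det-scalar zero    x = refl
    det-scalar (suc n) x = begin
      1# * x * det K (minor (scalar K {suc n} x) zero)
        + sum (λ j → sign (suc j) * 0# * det K (minor (scalar K {suc n} x) (suc j)))
        ≈⟨ +-cong (*-cong (*-identityˡ x) (det-scalar n x))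
                  (sum-zero {f = λ j → sign (suc j) * 0# * det K (minor (scalar K {suc n} x) (suc j))}
                     λ j → trans (*-congʳ (zeroʳ (sign (suc j))))
                                 (zeroˡ (det K (minor (scalar K {suc n} x) (suc j))))) ⟩
      x * x ^ n + 0#
        ≈⟨ +-identityʳ _ ⟩
      x ^ suc n
        ∎

    -- A block diagonal matrix with n equal blocks.
    det-repeat-block : ∀ n {m} (B : Matrix K m) (M : Matrix K (n ℕ.* m)) →
      (∀ i w j z → M (combine {n} i w) (combine {n} j z) ≈ δ i j * B w z) →
      det K M ≈ det K B ^ n
    det-repeat-block zero        B M blocks = refl
    det-repeat-block (suc n) {m} B M blocks = begin
      det K M
        ≈⟨ det-lower-block m M (λ w q → upper w q) ⟩
      det K (λ w z → M (w ↑ˡ (n ℕ.* m)) (z ↑ˡ (n ℕ.* m))) * det K (λ p q → M (m ↑ʳ p) (m ↑ʳ q))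
        ≈⟨ *-cong (det-cong λ w z → trans (blocks zero w zero z) (*-identityˡ _))
                  (det-repeat-block n B (λ p q → M (m ↑ʳ p) (m ↑ʳ q))
                     (λ i w j z → blocks (suc i) w (suc j) z)) ⟩
      det K B * det K B ^ n
        ∎
      where
      upper : ∀ w (q : Fin (n ℕ.* m)) → M (w ↑ˡ (n ℕ.* m)) (m ↑ʳ q) ≈ 0#
      upper w q = ≡.subst (λ q → M (w ↑ˡ (n ℕ.* m)) (m ↑ʳ q) ≈ 0#) (combine-remQuot {n} m q)
        (trans (blocks zero w (suc (proj₁ (remQuot {n} m q))) (proj₂ (remQuot {n} m q))) (zeroˡ _))

-- Polynomial functions and the characteristic polynomial

module Polynomials {c ℓ₁ ℓ₂ : Level} (K : HeytingField c ℓ₁ ℓ₂) (char0 : CharacteristicZero K) where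

  open Field K
  open Determinants K

  ι-injective : ∀ {a b} → ι a ≈ ι b → a ≡ b
  ι-injective {zero}  {zero}  _  = ≡.refl
  ι-injective {zero}  {suc b} eq = ⊥-elim (#⇒≉ (char0 b) (sym eq))
  ι-injective {suc a} {zero}  eq = ⊥-elim (#⇒≉ (char0 a) eq)
  ι-injective {suc a} {suc b} eq = ≡.cong suc (ι-injective (begin
    ι a             ≈⟨ solve 1 (λ a → a := (:1 :+ a) :- :1) refl (ι a) ⟩
    1# + ι a - 1#   ≈⟨ +-congʳ eq ⟩
    1# + ι b - 1#   ≈⟨ solve 1 (λ a → (:1 :+ a) :- :1 := a) refl (ι b) ⟩
    ι b             ∎))

  -- Poly n a f: the function f is given by a polynomial of degree at most n
  -- whose coefficient of x ^ n is a.
  data Poly : ℕ → Carrier → (Carrier → Carrier) → Set (c ⊔ ℓ₁) where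
    constant : ∀ {a f} → (∀ x → f x ≈ a) → Poly zero a f
    horner   : ∀ {n a f} b g → Poly n a g → (∀ x → f x ≈ b + x * g x) → Poly (suc n) a f

  -- Polynomial functions, of any degree.
  IsPoly : (Carrier → Carrier) → Set (c ⊔ ℓ₁)
  IsPoly f = ∃[ n ] ∃[ a ] Poly n a f

  poly-resp : ∀ {n a b f g} → a ≈ b → (∀ x → g x ≈ f x) → Poly n a f → Poly n b g
  poly-resp a≈b g≈f (constant f≈a)        = constant λ x → trans (g≈f x) (trans (f≈a x) a≈b)
  poly-resp a≈b g≈f (horner b₀ h ph f≈) =
    horner b₀ h (poly-resp a≈b (λ _ → refl) ph) λ x → trans (g≈f x) (f≈ x)

  poly-cong : ∀ {n a f} → Poly n a f → ∀ {x y} → x ≈ y → f x ≈ f y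
  poly-cong (constant f≈a)      {x} {y} x≈y = trans (f≈a x) (sym (f≈a y))
  poly-cong (horner b g pg f≈)  {x} {y} x≈y = begin
    _          ≈⟨ f≈ x ⟩
    b + x * g x  ≈⟨ +-congˡ (*-cong x≈y (poly-cong pg x≈y)) ⟩
    b + y * g y  ≈⟨ f≈ y ⟨
    _          ∎

  poly-+ : ∀ {n a b f g} → Poly n a f → Poly n b g → Poly n (a + b) (λ x → f x + g x)
  poly-+ (constant f≈a) (constant g≈b) = constant λ x → +-cong (f≈a x) (g≈b x)
  poly-+ (horner b f′ pf f≈) (horner d g′ pg g≈) =
    horner (b + d) (λ x → f′ x + g′ x) (poly-+ pf pg) λ x →
      trans (+-cong (f≈ x) (g≈ x))
        (solve 5 (λ b d x f g → (b :+ x :* f) :+ (d :+ x :* g) := (b :+ d) :+ x :* (f :+ g)) refl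
           b d x (f′ x) (g′ x))

  poly-scale : ∀ {n a f} k → Poly n a f → Poly n (k * a) (λ x → k * f x)
  poly-scale k (constant f≈a) = constant λ x → *-congˡ (f≈a x)
  poly-scale k (horner b f′ pf f≈) =
    horner (k * b) (λ x → k * f′ x) (poly-scale k pf) λ x →
      trans (*-congˡ (f≈ x))
        (solve 4 (λ k b x f → k :* (b :+ x :* f) := k :* b :+ x :* (k :* f)) refl k b x (f′ x))

  poly-x* : ∀ {n a f} → Poly n a f → Poly (suc n) a (λ x → x * f x)
  poly-x* pf = horner 0# _ pf λ x → sym (+-identityˡ _)

  poly-^ : ∀ n → Poly n 1# (_^ n)
  poly-^ zero    = constant λ x → refl
  poly-^ (suc n) = poly-x* (poly-^ n)

  poly-raise₁ : ∀ {n a f} → Poly n a f → Poly (suc n) 0# f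
  poly-raise₁ {a = a} (constant f≈a) = horner a (const 0#) (constant λ _ → refl) λ x →
    trans (f≈a x) (solve 2 (λ a x → a := a :+ x :* :0) refl a x)
  poly-raise₁ (horner b g pg f≈) = horner b g (poly-raise₁ pg) f≈

  poly-raise : ∀ {n a f} m → Poly n a f → Poly (suc m ℕ.+ n) 0# f
  poly-raise zero    pf = poly-raise₁ pf
  poly-raise (suc m) pf = poly-raise₁ (poly-raise m pf)

  poly-* : ∀ {m n a b f g} → Poly m a f → Poly n b g → Poly (m ℕ.+ n) (a * b) (λ x → f x * g x)
  poly-* {a = a} (constant f≈a) pg = poly-resp refl (λ x → *-congʳ (f≈a x)) (poly-scale a pg)
  poly-* {suc m} {n} {g = g} (horner b f′ pf f≈) pg =
    poly-resp (+-identityˡ _)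
      (λ x → trans (*-congʳ (f≈ x))
        (solve 4 (λ b x f g → (b :+ x :* f) :* g := b :* g :+ x :* (f :* g)) refl b x (f′ x) (g x)))
      (poly-+ (poly-raise m (poly-scale b pg)) (poly-x* (poly-* pf pg)))

  poly-sum : ∀ {n k} (f : Fin k → Carrier → Carrier) → (∀ i → ∃[ a ] Poly n a (f i)) →
             ∃[ a ] Poly n a (λ x → sum (λ i → f i x))
  poly-sum {n} {zero} f pf = 0# , zeroes n
    where
    zeroes : ∀ n → Poly n 0# (const 0#)
    zeroes zero    = constant λ _ → refl
    zeroes (suc n) = poly-raise₁ (zeroes n)
  poly-sum {k = suc k} f pf =
    _ , poly-+ (proj₂ (pf zero)) (proj₂ (poly-sum (f ∘ suc) (pf ∘ suc)))

  isPoly-* : ∀ {f g} → IsPoly f → IsPoly g → IsPoly (λ x → f x * g x)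
  isPoly-* (m , a , pf) (n , b , pg) = _ , _ , poly-* pf pg

  isPoly-- : ∀ {f g} → IsPoly f → IsPoly g → IsPoly (λ x → f x - g x)
  isPoly-- {f} {g} (m , a , pf) (n , b , pg) = _ , _ , poly-resp refl
    (λ x → solve 2 (λ f g → f :- g := f :+ (:- :1) :* g) refl (f x) (g x))
    (poly-+ (poly-raise n pf)
       (≡.subst (λ k → Poly k 0# (λ x → - 1# * g x)) (≡.cong suc (ℕₚ.+-comm m n)) (poly-raise m (poly-scale (- 1#) pg))))

  isPoly-shift : ∀ t → Poly 1 1# (λ x → x - t)
  isPoly-shift t = horner (- t) (const 1#) (constant λ _ → refl) λ x →
    solve 2 (λ x t → x :- t := :- t :+ x :* :1) refl x t

  isPoly-shift^ : ∀ t n → IsPoly (λ x → (x - t) ^ n)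
  isPoly-shift^ t zero    = 0 , 1# , constant λ _ → refl
  isPoly-shift^ t (suc n) = isPoly-* (1 , 1# , isPoly-shift t) (isPoly-shift^ t n)

  isPoly-eval : ∀ p → IsPoly (eval K p)
  isPoly-eval []      = 0 , 0# , constant λ _ → refl
  isPoly-eval (a ∷ p) with isPoly-eval p
  ... | n , b , pp = suc n , b , horner a (eval K p) pp λ x → refl

  coefficients : ∀ {f} → IsPoly f → ∃[ p ] ∀ x → f x ≈ eval K p x
  coefficients (n , a , pf) = go pf
    where
    go : ∀ {n a f} → Poly n a f → ∃[ p ] ∀ x → f x ≈ eval K p x
    go {a = a} (constant f≈a) = a ∷ [] , λ x →
      trans (f≈a x) (solve 2 (λ a x → a := a :+ x :* :0) refl a x)
    go (horner b g pg f≈) with go pg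
    ... | p , g≈ = b ∷ p , λ x → trans (f≈ x) (+-congˡ (*-congˡ (g≈ x)))

  -- Division by x − r keeps the leading coefficient.
  factor : ∀ {n a f} → Poly (suc n) a f → ∀ r → ∃[ h ] Poly n a h × (∀ x → f x ≈ f r + (x - r) * h x)
  factor {a = a} {f} (horner b g (constant g≈a) f≈) r = const a , constant (λ _ → refl) , λ x → begin
    f x                      ≈⟨ f≈ x ⟩
    b + x * g x              ≈⟨ +-congˡ (*-congˡ (g≈a x)) ⟩
    b + x * a                ≈⟨ solve 4 (λ b x a r → b :+ x :* a := b :+ r :* a :+ (x :- r) :* a) refl b x a r ⟩
    b + r * a + (x - r) * a  ≈⟨ +-congʳ (trans (f≈ r) (+-congˡ (*-congˡ (g≈a r)))) ⟨
    f r + (x - r) * a        ∎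
  factor {f = f} (horner b g pg@(horner _ _ _ _) f≈) r with factor pg r
  ... | h , ph , g≈ = (λ x → g r + x * h x) , horner (g r) h ph (λ _ → refl) , λ x → begin
    f x                                  ≈⟨ f≈ x ⟩
    b + x * g x                          ≈⟨ +-congˡ (*-congˡ (g≈ x)) ⟩
    b + x * (g r + (x - r) * h x)        ≈⟨ solve 5 (λ b x g r h → b :+ x :* (g :+ (x :- r) :* h)
                                               := b :+ r :* g :+ (x :- r) :* (g :+ x :* h)) refl b x (g r) r (h x) ⟩
    b + r * g r + (x - r) * (g r + x * h x)  ≈⟨ +-congʳ (f≈ r) ⟨
    f r + (x - r) * (g r + x * h x)      ∎

  -- In characteristic zero the points s, s + 1, s + 2, … are pairwise apart,
  -- so a polynomial vanishing at all of them vanishes everywhere.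
  vanishing : ∀ {n a h} → Poly n a h → ∀ s → (∀ i → h (s + ι i) ≈ 0#) → ∀ x → h x ≈ 0#
  vanishing {h = h} (constant h≈a) s zeros x = begin
    h x          ≈⟨ h≈a x ⟩
    _            ≈⟨ h≈a (s + ι 0) ⟨
    h (s + ι 0)  ≈⟨ zeros 0 ⟩
    0#           ∎
  vanishing {suc n} {a} {h} ph@(horner _ _ _ _) s zeros x with factor ph (s + ι 0)
  ... | k , pk , h≈ = begin
    h x                                        ≈⟨ h≈ x ⟩
    h (s + ι 0) + (x - (s + ι 0)) * k x        ≈⟨ +-cong (zeros 0) (*-congˡ (k≈0 x)) ⟩
    0# + (x - (s + ι 0)) * 0#                  ≈⟨ solve 1 (λ y → :0 :+ y :* :0 := :0) refl _ ⟩
    0#                                         ∎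
    where
    at : ∀ i → k (s + 1# + ι i) ≈ 0#
    at i = *-cancel-# (char0 i) (begin
      ι (suc i) * k (s + 1# + ι i)
        ≈⟨ *-congˡ (poly-cong pk (+-assoc s 1# (ι i))) ⟩
      ι (suc i) * k (s + ι (suc i))
        ≈⟨ solve 4 (λ h s i k → (:1 :+ i) :* k := :0 :+ ((s :+ (:1 :+ i)) :- (s :+ :0)) :* k) refl
             (h (s + ι 0)) s (ι i) (k (s + ι (suc i))) ⟩
      0# + (s + ι (suc i) - (s + ι 0)) * k (s + ι (suc i))
        ≈⟨ +-congʳ (zeros 0) ⟨
      h (s + ι 0) + (s + ι (suc i) - (s + ι 0)) * k (s + ι (suc i))
        ≈⟨ h≈ (s + ι (suc i)) ⟨
      h (s + ι (suc i))
        ≈⟨ zeros (suc i) ⟩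
      0# ∎)

    k≈0 : ∀ x → k x ≈ 0#
    k≈0 = vanishing pk (s + 1#) at

  cancel-shift : ∀ {f} → IsPoly f → ∀ t → (∀ x → (x - t) * f x ≈ 0#) → ∀ x → f x ≈ 0#
  cancel-shift {f} (_ , _ , pf) t zeros = vanishing pf (t + 1#) λ i →
    *-cancel-# (char0 i) (begin
      ι (suc i) * f (t + 1# + ι i)
        ≈⟨ *-congʳ (solve 2 (λ t i → :1 :+ i := t :+ :1 :+ i :- t) refl t (ι i)) ⟩
      (t + 1# + ι i - t) * f (t + 1# + ι i)
        ≈⟨ zeros (t + 1# + ι i) ⟩
      0# ∎)

  cancel-shift-≈ : ∀ {f g} → IsPoly f → IsPoly g → ∀ t →
    (∀ x → (x - t) * f x ≈ (x - t) * g x) → ∀ x → f x ≈ g x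
  cancel-shift-≈ {f} {g} pf pg t eq x = x-y≈0⇒x≈y (cancel-shift (isPoly-- pf pg) t
    (λ x → begin
      (x - t) * (f x - g x)            ≈⟨ solve 3 (λ y f g → y :* (f :- g) := y :* f :- y :* g) refl (x - t) (f x) (g x) ⟩
      (x - t) * f x - (x - t) * g x    ≈⟨ x≈y⇒x-y≈0 (eq x) ⟩
      0#                               ∎) x)

  -- Polynomials agreeing at all points apart from finitely many given ones
  -- agree everywhere.
  agree-off : ∀ l {f g} → IsPoly f → IsPoly g → (∀ x → All (x #_) l → f x ≈ g x) → ∀ x → f x ≈ g x
  agree-off []      pf pg eq x = eq x []
  agree-off (t ∷ l) pf pg eq = cancel-shift-≈ pf pg t
    (agree-off l (isPoly-* (1 , 1# , isPoly-shift t) pf) (isPoly-* (1 , 1# , isPoly-shift t) pg) λ x x#l →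
      ≈-by-cases {a = x} {b = t}
        (λ x#t → *-congˡ (eq x (x#t ∷ x#l)))
        (λ x≈t → trans (trans (*-congʳ (x≈y⇒x-y≈0 x≈t)) (zeroˡ _))
                       (sym (trans (*-congʳ (x≈y⇒x-y≈0 x≈t)) (zeroˡ _)))))

  leading-zero : ∀ {n a f} → Poly n a f → (∀ x → f x ≈ 0#) → a ≈ 0#
  leading-zero (constant f≈a) f≈0 = trans (sym (f≈a 0#)) (f≈0 0#)
  leading-zero pf@(horner _ _ _ _) f≈0 with factor pf 0#
  ... | h , ph , f≈ = leading-zero ph (cancel-shift (_ , _ , ph) 0# λ x →
    trans (sym (+-identityˡ _)) (trans (+-congʳ (sym (f≈0 0#))) (trans (sym (f≈ x)) (f≈0 x))))

  leading-unique : ∀ {n a b f g} → Poly n a f → Poly n b g → (∀ x → f x ≈ g x) → a ≈ b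
  leading-unique {a = a} {b} {f} {g} pf pg f≈g = x-y≈0⇒x≈y (trans
    (solve 2 (λ a b → a :- b := a :+ (:- :1) :* b) refl a b)
    (leading-zero (poly-+ pf (poly-scale (- 1#) pg)) λ x → trans
      (solve 2 (λ f g → f :+ (:- :1) :* g := f :- g) refl (f x) (g x)) (x≈y⇒x-y≈0 (f≈g x))))

  monic-≮ : ∀ {m n f g} → Poly m 1# f → Poly n 1# g → (∀ x → f x ≈ g x) → ¬ m ℕ.< n
  monic-≮ {m} {n} {f} pf pg f≈g m<n = #⇒≉ 1#0 (sym (leading-unique
    (≡.subst (λ k → Poly k 0# f) eq (poly-raise (n ℕ.∸ suc m) pf)) pg f≈g))
    where
    eq : suc (n ℕ.∸ suc m) ℕ.+ m ≡ n
    eq = ≡.trans (≡.sym (ℕₚ.+-suc (n ℕ.∸ suc m) m)) (ℕₚ.m∸n+n≡m m<n)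

  monic-degree-unique : ∀ {m n f g} → Poly m 1# f → Poly n 1# g → (∀ x → f x ≈ g x) → m ≡ n
  monic-degree-unique {m} {n} pf pg f≈g with ℕₚ.<-cmp m n
  ... | tri< m<n _ _ = ⊥-elim (monic-≮ pf pg f≈g m<n)
  ... | tri≈ _ m≡n _ = m≡n
  ... | tri> _ _ n<m = ⊥-elim (monic-≮ pg pf (λ x → sym (f≈g x)) n<m)

  -- The sum of finitely many natural numbers.
  total : ∀ {n} → (Fin n → ℕ) → ℕ
  total = Vector.foldr ℕ._+_ 0

  -- d bounds the degrees of the entries, row by row.
  poly-det : ∀ {n} (d : Fin n → ℕ) (M : Fin n → Fin n → Carrier → Carrier) →
    (∀ i j → ∃[ a ] Poly (d i) a (M i j)) →
    ∃[ a ] Poly (total d) a (λ x → det K (λ i j → M i j x))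
  poly-det {zero}  d M pM = 1# , constant λ _ → refl
  poly-det {suc n} d M pM = poly-sum _ λ j →
    _ , poly-* (poly-scale (sign j) (proj₂ (pM zero j)))
               (proj₂ (poly-det (d ∘ suc) (λ i k → M (suc i) (punchIn j k)) (λ i k → pM (suc i) (punchIn j k))))

  poly-charEntry : ∀ {n} (M : Matrix K n) i j → ∃[ a ] Poly 1 a (λ x → scalar K x i j - M i j)
  poly-charEntry M i j with does (i ≟ j)
  ... | true  = 1# , isPoly-shift (M i j)
  ... | false = 0# , poly-raise₁ (constant λ _ → refl)

  isPoly-onesFirst : ∀ {n} (M : Matrix K n) →
    IsPoly (λ x → det K (onesFirst (λ i j → scalar K x i j - M i j)))
  isPoly-onesFirst {n} M = _ , poly-det (const 1) entry poly-entry
    where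
    entry : Fin n → Fin n → Carrier → Carrier
    entry i j x = onesFirst (λ i j → scalar K x i j - M i j) i j
    poly-entry : ∀ i j → ∃[ a ] Poly 1 a (entry i j)
    poly-entry zero    j = 0# , poly-raise₁ (constant λ _ → refl)
    poly-entry (suc i) j = poly-charEntry M (suc i) j

  trace : ∀ {n} → Matrix K n → Carrier
  trace M = sum λ i → M i i

  -- The two leading coefficients of the characteristic polynomial.  The
  -- expansion along the first row contributes to them only through the minor
  -- of the corner: every other minor has one row free of x.
  charPoly-trace : ∀ {n} (M : Matrix K (suc n)) →
    ∃[ g ] Poly n (- trace M) g × (∀ x → charPoly K M x ≈ x ^ suc n + g x)
  charPoly-trace {zero} M = const (- trace M) , constant (λ _ → refl) , λ x →
    solve 2 (λ x m → :1 :* (x :- m) :* :1 :+ :0 := x :* :1 :+ :- (m :+ :0)) refl x (M zero zero)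
  charPoly-trace {suc n} M with charPoly-trace (λ i j → M (suc i) (suc j))
  ... | g , pg , M′≈ =
      (λ x → x * g x + (- m * x ^ suc n + - m * g x) + R x)
    , poly-resp (solve 2 (λ t m → :- t :+ ((:- m) :* :1 :+ :0) :+ :0 := :- (m :+ t)) refl
                   (trace (λ i j → M (suc i) (suc j))) m)
        (λ x → refl)
        (poly-+ (poly-+ (poly-x* pg) (poly-+ (poly-scale (- m) (poly-^ (suc n)))
                                             (poly-raise₁ (poly-scale (- m) pg))))
                (poly-raise₁ (proj₂ poly-R)))
    , λ x → begin
        1# * (x - m) * charPoly K (λ i j → M (suc i) (suc j)) x + R x
          ≈⟨ +-congʳ (*-congˡ (M′≈ x)) ⟩
        1# * (x - m) * (x ^ suc n + g x) + R x
          ≈⟨ solve 5 (λ x m p g r → :1 :* (x :- m) :* (p :+ g) :+ r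
                        := x :* p :+ (x :* g :+ ((:- m) :* p :+ (:- m) :* g) :+ r)) refl
               x m (x ^ suc n) (g x) (R x) ⟩
        x ^ suc (suc n) + (x * g x + (- m * x ^ suc n + - m * g x) + R x)
          ∎
    where
    m : Carrier
    m = M zero zero
    entry : Fin (suc n) → Fin (suc n) → Fin (suc n) → Carrier → Carrier
    entry j i k x = scalar K x (suc i) (punchIn (suc j) k) - M (suc i) (punchIn (suc j) k)
    termR : Fin (suc n) → Carrier → Carrier
    termR j x = sign (suc j) * (0# - M zero (suc j)) * det K (λ i k → entry j i k x)
    R : Carrier → Carrier
    R x = sum λ j → termR j x

    -- In the minor of column j + 1, row j is free of x, since the diagonal entry
    -- of row j + 1 of the matrix has been deleted.
    d : Fin (suc n) → Fin (suc n) → ℕ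
    d j i = if does (i ≟ j) then 0 else 1

    total-ones : ∀ n → total {n} (const 1) ≡ n
    total-ones zero    = ≡.refl
    total-ones (suc n) = ≡.cong suc (total-ones n)

    total-d : ∀ {n} (j : Fin (suc n)) → total (λ i → if does (i ≟ j) then 0 else 1) ≡ n
    total-d {n}     zero    = total-ones n
    total-d {suc n} (suc j) = ≡.cong suc (total-d j)

    punchIn-suc≢ : ∀ {n} (j : Fin n) k → punchIn (suc j) k ≢ suc j
    punchIn-suc≢ j k = punchInᵢ≢i (suc j) k

    poly-entry : ∀ j i k → ∃[ a ] Poly (d j i) a (entry j i k)
    poly-entry j i k with i ≟ j
    ... | no _       = poly-charEntry M (suc i) (punchIn (suc j) k)
    ... | yes ≡.refl = _ , constant λ x → +-congʳ (reflexive (≡.cong (λ b → if b then x else 0#)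
                             (dec-false (suc j ≟ punchIn (suc j) k) (punchIn-suc≢ j k ∘ ≡.sym))))

    poly-termR : ∀ j → ∃[ a ] Poly n a (termR j)
    poly-termR j = _ , poly-scale (sign (suc j) * (0# - M zero (suc j)))
      (≡.subst (λ k → Poly k (proj₁ (poly-det (d j) (entry j) (poly-entry j))) (λ x → det K (λ i k → entry j i k x))) (total-d j)
        (proj₂ (poly-det (d j) (entry j) (poly-entry j))))

    poly-R : ∃[ a ] Poly n a R
    poly-R = poly-sum termR poly-termR

  charPoly-monic : ∀ {n} (M : Matrix K n) → Poly n 1# (charPoly K M)
  charPoly-monic {zero}  M = constant λ _ → refl
  charPoly-monic {suc n} M with charPoly-trace M
  ... | g , pg , M≈ = poly-resp (+-identityʳ 1#) M≈ (poly-+ (poly-^ (suc n)) (poly-raise₁ pg))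

  charPoly-determines-order : ∀ {m n} (M : Matrix K m) (N : Matrix K n) →
    (∀ x → charPoly K M x ≈ charPoly K N x) → m ≡ n
  charPoly-determines-order M N = monic-degree-unique (charPoly-monic M) (charPoly-monic N)

  charPoly-determines-trace : ∀ {m n} (M : Matrix K m) (N : Matrix K n) →
    (∀ x → charPoly K M x ≈ charPoly K N x) → trace M ≈ trace N
  charPoly-determines-trace M N M≈N with charPoly-determines-order M N M≈N
  charPoly-determines-trace {zero}  M N M≈N | ≡.refl = refl
  charPoly-determines-trace {suc n} M N M≈N | ≡.refl with charPoly-trace M | charPoly-trace N
  ... | g , pg , M≈ | h , ph , N≈ = begin
    trace M      ≈⟨ solve 1 (λ t → t := :- (:- t)) refl (trace M) ⟩
    - - trace M  ≈⟨ -‿cong (leading-unique pg ph λ x → begin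
                      g x                          ≈⟨ solve 2 (λ p g → g := (p :+ g) :- p) refl (x ^ suc n) (g x) ⟩
                      (x ^ suc n + g x) - x ^ suc n ≈⟨ +-congʳ (trans (sym (M≈ x)) (trans (M≈N x) (N≈ x))) ⟩
                      (x ^ suc n + h x) - x ^ suc n ≈⟨ solve 2 (λ p g → (p :+ g) :- p := g) refl (x ^ suc n) (h x) ⟩
                      h x                          ∎) ⟩
    - - trace N  ≈⟨ solve 1 (λ t → :- (:- t) := t) refl (trace N) ⟩
    trace N      ∎

-- Multiplicities of eigenvalues determine the characteristic polynomial

module Spectrum {c ℓ₁ ℓ₂ : Level} (K : HeytingField c ℓ₁ ℓ₂)
  (closed : AlgebraicallyClosed K) (char0 : CharacteristicZero K) where

  open Field K
  open Determinants K
  open Polynomials K char0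

  -- t is a root of f of multiplicity exactly m.
  Multiplicity : (Carrier → Carrier) → Carrier → ℕ → Set (c ⊔ ℓ₁ ⊔ ℓ₂)
  Multiplicity f t m = ∃[ q ] (∀ x → f x ≈ (x - t) ^ m * eval K q x) × (eval K q t # 0#)

  multiplicity : ∀ {f g} t m → IsPoly g → (∀ x → f x ≈ (x - t) ^ m * g x) → g t # 0# → Multiplicity f t m
  multiplicity t m pg f≈ gt#0 with coefficients pg
  ... | q , g≈q = q , (λ x → trans (f≈ x) (*-congˡ (g≈q x))) , #-congʳ (g≈q t) gt#0

  shift-zero : ∀ t m y → (t - t) ^ suc m * y ≈ 0#
  shift-zero t m y = trans (*-congʳ (trans (*-congʳ (-‿inverseʳ t)) (zeroˡ _))) (zeroˡ y)

  exponent-unique : ∀ m n {f g t} → IsPoly f → IsPoly g → f t # 0# → g t # 0# →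
    (∀ x → (x - t) ^ m * f x ≈ (x - t) ^ n * g x) → m ≡ n
  exponent-unique zero    zero    pf pg ft#0 gt#0 eq = ≡.refl
  exponent-unique zero    (suc n) {f} {g} {t} pf pg ft#0 gt#0 eq =
    ⊥-elim (#⇒≉ ft#0 (trans (sym (*-identityˡ (f t))) (trans (eq t) (shift-zero t n (g t)))))
  exponent-unique (suc m) zero    {f} {g} {t} pf pg ft#0 gt#0 eq =
    ⊥-elim (#⇒≉ gt#0 (trans (sym (*-identityˡ (g t))) (trans (sym (eq t)) (shift-zero t m (f t)))))
  exponent-unique (suc m) (suc n) {f} {g} {t} pf pg ft#0 gt#0 eq =
    ≡.cong suc (exponent-unique m n pf pg ft#0 gt#0
      (cancel-shift-≈ (isPoly-* (isPoly-shift^ t m) pf) (isPoly-* (isPoly-shift^ t n) pg) t λ x →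
        trans (sym (*-assoc _ _ (f x))) (trans (eq x) (*-assoc _ _ (g x)))))

  multiplicity-unique : ∀ {f} t m n → Multiplicity f t m → Multiplicity f t n → m ≡ n
  multiplicity-unique t m n (p , f≈p , pt#0) (q , f≈q , qt#0) =
    exponent-unique m n (isPoly-eval p) (isPoly-eval q) pt#0 qt#0 λ x → trans (sym (f≈p x)) (f≈q x)

  -- The product of the linear factors x − r, for r in the list l.
  splitPoly : List Carrier → Carrier → Carrier
  splitPoly l x = foldr (λ r y → (x - r) * y) 1# l

  isPoly-split : ∀ l → IsPoly (splitPoly l)
  isPoly-split []      = 0 , 1# , constant λ _ → refl
  isPoly-split (r ∷ l) = isPoly-* (1 , 1# , isPoly-shift r) (isPoly-split l)

  split-cong : ∀ l {x y} → x ≈ y → splitPoly l x ≈ splitPoly l y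
  split-cong l = poly-cong (proj₂ (proj₂ (isPoly-split l)))

  split-#0 : ∀ {t} l → All (t #_) l → splitPoly l t # 0#
  split-#0 []      []            = 1#0
  split-#0 (r ∷ l) (t#r ∷ t#l)   = x#0y#0→xy#0 (#⇒-#0 t#r) (split-#0 l t#l)

  poly-coefficients : ∀ {n a f} → Poly n a f →
    Σ[ b ∈ (Fin n → Carrier) ] ∀ x → f x ≈ a * x ^ n + sum (λ i → b i * x ^ toℕ i)
  poly-coefficients {a = a} (constant f≈a) = (λ ()) , λ x →
    trans (f≈a x) (solve 1 (λ a → a := a :* :1 :+ :0) refl a)
  poly-coefficients {suc n} {a} {f} (horner b g pg f≈) with poly-coefficients pg
  ... | d , g≈ = (b Vector.∷ d) , λ x → begin
    f x
      ≈⟨ f≈ x ⟩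
    b + x * g x
      ≈⟨ +-congˡ (*-congˡ (g≈ x)) ⟩
    b + x * (a * x ^ n + sum (λ i → d i * x ^ toℕ i))
      ≈⟨ solve 5 (λ b x a p s → b :+ x :* (a :* p :+ s) := a :* (x :* p) :+ (b :* :1 :+ x :* s)) refl
           b x a (x ^ n) (sum (λ i → d i * x ^ toℕ i)) ⟩
    a * x ^ suc n + (b * 1# + x * sum (λ i → d i * x ^ toℕ i))
      ≈⟨ +-congˡ (+-congˡ (trans (*-distribˡ-sum x (λ i → d i * x ^ toℕ i))
           (sum-cong λ i → solve 3 (λ x d p → x :* (d :* p) := d :* (x :* p)) refl x (d i) (x ^ toℕ i)))) ⟩
    a * x ^ suc n + (b * 1# + sum (λ i → d i * (x * x ^ toℕ i)))
      ∎

  monic-splits : ∀ n {f} → Poly n 1# f → ∃[ l ] ∀ x → f x ≈ splitPoly l x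
  monic-splits zero    (constant f≈1) = [] , f≈1
  monic-splits (suc n) {f} pf with poly-coefficients pf
  ... | a , f≈ with closed n a
  ... | r , root with factor pf r
  ... | h , ph , f≈h with monic-splits n ph
  ... | l , h≈l = r ∷ l , λ x → begin
    f x                  ≈⟨ f≈h x ⟩
    f r + (x - r) * h x  ≈⟨ +-cong (trans (f≈ r) (trans (+-congʳ (*-identityˡ _)) root)) (*-congˡ (h≈l x)) ⟩
    0# + (x - r) * splitPoly l x  ≈⟨ +-identityˡ _ ⟩
    (x - r) * splitPoly l x       ∎

  -- A factorisation of splitPoly l exhibiting t as a root of multiplicity count.
  -- Finding one means comparing t with the members of l, so in general it
  -- exists under a double negation only.
  record Extraction (t : Carrier) (l : List Carrier) : Set (c ⊔ ℓ₁ ⊔ ℓ₂) where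
    constructor extraction
    field
      count  : ℕ
      rest   : List Carrier
      factors : ∀ x → splitPoly l x ≈ (x - t) ^ count * splitPoly rest x
      others : All (t #_) rest
      shorter : length rest ≤ length l

    hasMultiplicity : Multiplicity (splitPoly l) t count
    hasMultiplicity = multiplicity t count (isPoly-split rest) factors (split-#0 rest others)

  open Extraction

  extract : ∀ t l → ¬ ¬ Extraction t l
  extract t []      k = k (extraction 0 [] (λ x → sym (*-identityˡ 1#)) [] z≤n)
  extract t (r ∷ l) k = extract t l λ (extraction m l′ eq apart len) →
    let apart? : ¬ (t # r)
        apart? t#r = k (extraction m (r ∷ l′)
          (λ x → trans (*-congˡ (eq x))
             (solve 3 (λ y p s → y :* (p :* s) := p :* (y :* s)) refl (x - r) ((x - t) ^ m) (splitPoly l′ x)))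
          (t#r ∷ apart) (s≤s len))
        t≈r : t ≈ r
        t≈r = ¬#⇒≈ apart?
    in k (extraction (suc m) l′
         (λ x → trans (*-cong (+-congˡ (-‿cong (sym t≈r))) (eq x)) (sym (*-assoc _ _ _)))
         apart (ℕₚ.m≤n⇒m≤1+n len))

  -- If r is the head of a list, it occurs at least once and its extraction makes
  -- the list strictly shorter.
  extract-head : ∀ r l → ¬ ¬ (Σ[ e ∈ Extraction r (r ∷ l) ]
                                length (rest e) ≤ length l × ∃[ m ] count e ≡ suc m)
  extract-head r l k = extract r l λ (extraction m l′ eq apart len) →
    k (extraction (suc m) l′ (λ x → trans (*-congˡ (eq x)) (sym (*-assoc _ _ _))) apart (ℕₚ.m≤n⇒m≤1+n len)
      , len , m , ≡.refl)

  -- Up to double negation, a multiplicity of t for f is also one for g, where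
  -- multiplicity 0 says that t is not a root.
  _⊑_ : (f g : Carrier → Carrier) → Set (c ⊔ ℓ₁ ⊔ ℓ₂)
  f ⊑ g = ∀ t m → Multiplicity f t m → ¬ ¬ Multiplicity g t m

  -- Removing all occurrences of the root r from both sides.
  ⊑-remove : ∀ {r l₁ l₂} (e₁ : Extraction r l₁) (e₂ : Extraction r l₂) → count e₁ ≡ count e₂ →
    splitPoly l₁ ⊑ splitPoly l₂ → splitPoly (rest e₁) ⊑ splitPoly (rest e₂)
  ⊑-remove {r} {l₁} {l₂} e₁ e₂ ≡.refl l₁⊑l₂ t m (q , rest₁≈ , qt#0) k = not-apart apart
    where
    N : ℕ
    N = count e₁

    apart : t # r → ⊥
    apart t#r = l₁⊑l₂ t m in-l₁ λ in-l₂ → extract t (rest e₂) λ e →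
      k (≡.subst (Multiplicity (splitPoly (rest e₂)) t)
           (multiplicity-unique t (count e) m (multiplicity t (count e) (isPoly-* (isPoly-shift^ r N) (isPoly-split (rest e)))
              (λ x → begin
                 splitPoly l₂ x
                   ≈⟨ factors e₂ x ⟩
                 (x - r) ^ N * splitPoly (rest e₂) x
                   ≈⟨ *-congˡ (factors e x) ⟩
                 (x - r) ^ N * ((x - t) ^ count e * splitPoly (rest e) x)
                   ≈⟨ solve 3 (λ a b s → a :* (b :* s) := b :* (a :* s)) refl
                        ((x - r) ^ N) ((x - t) ^ count e) (splitPoly (rest e) x) ⟩
                 (x - t) ^ count e * ((x - r) ^ N * splitPoly (rest e) x)
                   ∎)
              (x#0y#0→xy#0 (^-#0 N (#⇒-#0 t#r)) (split-#0 (rest e) (others e)))) in-l₂)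
           (hasMultiplicity e))
      where
      in-l₁ : Multiplicity (splitPoly l₁) t m
      in-l₁ = multiplicity t m (isPoly-* (isPoly-shift^ r N) (isPoly-eval q))
        (λ x → begin
           splitPoly l₁ x                        ≈⟨ factors e₁ x ⟩
           (x - r) ^ N * splitPoly (rest e₁) x   ≈⟨ *-congˡ (rest₁≈ x) ⟩
           (x - r) ^ N * ((x - t) ^ m * eval K q x)
             ≈⟨ solve 3 (λ a b s → a :* (b :* s) := b :* (a :* s)) refl ((x - r) ^ N) ((x - t) ^ m) (eval K q x) ⟩
           (x - t) ^ m * ((x - r) ^ N * eval K q x) ∎)
        (x#0y#0→xy#0 (^-#0 N (#⇒-#0 t#r)) qt#0)

    -- Neither side vanishes at t ≈ r.
    not-apart : ¬ (t # r) → ⊥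
    not-apart ¬t#r = k (≡.subst (Multiplicity (splitPoly (rest e₂)) t) (≡.sym (m≡0 m rest₁≈))
        (multiplicity t 0 (isPoly-split (rest e₂)) (λ x → sym (*-identityˡ _))
           (#-congʳ (split-cong (rest e₂) r≈t) (split-#0 (rest e₂) (others e₂)))))
      where
      r≈t : r ≈ t
      r≈t = sym (¬#⇒≈ ¬t#r)
      m≡0 : ∀ m → (∀ x → splitPoly (rest e₁) x ≈ (x - t) ^ m * eval K q x) → m ≡ 0
      m≡0 zero    _  = ≡.refl
      m≡0 (suc m) eq = ⊥-elim (#⇒≉ (split-#0 (rest e₁) (others e₁))
        (trans (split-cong (rest e₁) r≈t) (trans (eq t) (shift-zero t m (eval K q t)))))

  -- The multiplicities determine a split polynomial: strip off one root
  -- after the other.  N bounds the number of roots of the first polynomial.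
  split-unique : ∀ N l₁ l₂ → length l₁ ≤ N →
    splitPoly l₁ ⊑ splitPoly l₂ → splitPoly l₂ ⊑ splitPoly l₁ → ∀ x → splitPoly l₁ x ≈ splitPoly l₂ x
  split-unique N       []       []       _   _     _     x = refl
  split-unique N       []       (r ∷ l₂) _   _     l₂⊑[] x = ⊥-elim
    (extract-head r l₂ λ { (e , _ , m , ≡.refl) →
      l₂⊑[] r (suc m) (hasMultiplicity e) λ (q , 1≈ , _) →
        #⇒≉ 1#0 (trans (1≈ r) (shift-zero r m (eval K q r))) })
  split-unique (suc N) (r ∷ l₁) l₂ (s≤s len) l₁⊑l₂ l₂⊑l₁ x = ≈-stable λ k →
    extract-head r l₁ λ (e₁ , len₁ , _) → extract r l₂ λ e₂ →
    l₁⊑l₂ r (count e₁) (hasMultiplicity e₁) λ in-l₂ →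
    let count≡ = multiplicity-unique r (count e₁) (count e₂) in-l₂ (hasMultiplicity e₂)
        rests≈ = split-unique N (rest e₁) (rest e₂) (ℕₚ.≤-trans len₁ len)
                   (⊑-remove e₁ e₂ count≡ l₁⊑l₂) (⊑-remove e₂ e₁ (≡.sym count≡) l₂⊑l₁)
    in k (begin
      splitPoly (r ∷ l₁) x                         ≈⟨ factors e₁ x ⟩
      (x - r) ^ count e₁ * splitPoly (rest e₁) x   ≈⟨ *-cong (reflexive (≡.cong ((x - r) ^_) count≡)) (rests≈ x) ⟩
      (x - r) ^ count e₂ * splitPoly (rest e₂) x   ≈⟨ factors e₂ x ⟨
      splitPoly l₂ x                               ∎)

  multiplicity-resp : ∀ {f g} → (∀ x → f x ≈ g x) → ∀ t m → Multiplicity f t m → Multiplicity g t m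
  multiplicity-resp f≈g t m (q , f≈q , qt#0) = q , (λ x → trans (sym (f≈g x)) (f≈q x)) , qt#0

  sameSpectrum⇒sameCharPoly : ∀ {m n} (M : Matrix K m) (N : Matrix K n) →
    (∀ t k → HasMultiplicity K M t k ⇔ HasMultiplicity K N t k) →
    ∀ x → charPoly K M x ≈ charPoly K N x
  sameSpectrum⇒sameCharPoly {m} {n} M N same x
    with monic-splits m (charPoly-monic M) | monic-splits n (charPoly-monic N)
  ... | l₁ , M≈ | l₂ , N≈ = trans (M≈ x) (trans
    (split-unique (length l₁) l₁ l₂ ℕₚ.≤-refl
      (λ t k p ¬p → ¬p (multiplicity-resp N≈ t k (Equivalence.to (same t k) (multiplicity-resp (λ y → sym (M≈ y)) t k p))))
      (λ t k p ¬p → ¬p (multiplicity-resp M≈ t k (Equivalence.from (same t k) (multiplicity-resp (λ y → sym (N≈ y)) t k p))))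
      x)
    (sym (N≈ x)))

  sameCharPoly⇒sameSpectrum : ∀ {m n} (M : Matrix K m) (N : Matrix K n) →
    (∀ x → charPoly K M x ≈ charPoly K N x) →
    ∀ t k → HasMultiplicity K M t k ⇔ HasMultiplicity K N t k
  sameCharPoly⇒sameSpectrum M N M≈N t k =
    mk⇔ (multiplicity-resp M≈N t k) (multiplicity-resp (λ x → sym (M≈N x)) t k)

-- Degrees, adjacency and incidence in terms of sums

open Graph

module GraphSums {c ℓ₁ ℓ₂ : Level} (K : HeytingField c ℓ₁ ℓ₂) where

  open Field K

  []-idem : ∀ b → [ b ] * [ b ] ≈ [ b ]
  []-idem true  = *-identityˡ 1#
  []-idem false = zeroˡ 0#

  []-not : ∀ b → [ not b ] ≈ 1# - [ b ]
  []-not true  = sym (-‿inverseʳ 1#)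
  []-not false = solve 0 (:1 := :1 :- :0) refl

  []-∧ : ∀ a b → [ a ∧ b ] ≈ [ a ] * [ b ]
  []-∧ true  b = sym (*-identityˡ _)
  []-∧ false b = sym (zeroˡ _)

  δ-refl : ∀ {n} (i : Fin n) → δ i i ≡ 1#
  δ-refl i = ≡.cong [_] (dec-true (i ≟ i) ≡.refl)

  δ-≢ : ∀ {n} {i j : Fin n} → i ≢ j → δ i j ≡ 0#
  δ-≢ {i = i} {j} i≢j = ≡.cong [_] (dec-false (i ≟ j) i≢j)

  δ-injective : ∀ {m n} (f : Fin m → Fin n) → (∀ i j → f i ≡ f j → i ≡ j) → ∀ i j → δ (f i) (f j) ≡ δ i j
  δ-injective f inj i j = ≡.cong [_] (does-⇔ (mk⇔ (inj i j) (≡.cong f)) (f i ≟ f j) (i ≟ j))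

  if-δ : ∀ {n} (i j : Fin n) x → (if does (i ≟ j) then x else 0#) ≈ δ i j * x
  if-δ i j x with does (i ≟ j)
  ... | true  = sym (*-identityˡ x)
  ... | false = sym (zeroˡ x)

  δ-subst : ∀ {n} (i j : Fin n) (f : Fin n → Carrier) → δ i j * f j ≈ δ i j * f i
  δ-subst i j f with i ≟ j
  ... | yes ≡.refl = refl
  ... | no _       = trans (zeroˡ (f j)) (sym (zeroˡ (f i)))

  sum-δʳ : ∀ {n} (i : Fin n) (f : Fin n → Carrier) → sum (λ j → δ j i * f j) ≈ f i
  sum-δʳ i f = trans (sum-cong λ j → *-congʳ (reflexive (δ-sym j i))) (sum-δ i f)

  sum-δ₁ : ∀ {n} (i : Fin n) → sum (λ j → δ j i) ≈ 1#
  sum-δ₁ i = trans (sum-cong λ j → sym (*-identityʳ (δ j i))) (sum-δʳ i (const 1#))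

  ι-∣∣ : ∀ {n} (f : Fin n → Bool) → ι ∣ tabulate f ∣ ≈ sum (λ j → [ f j ])
  ι-∣∣ {zero}  f = refl
  ι-∣∣ {suc n} f with f zero
  ... | true  = +-congˡ (ι-∣∣ (f ∘ suc))
  ... | false = trans (ι-∣∣ (f ∘ suc)) (sym (+-identityˡ _))

  adjacency : (G : Graph) → Vertex G → Vertex G → Carrier
  adjacency G u v = [ adj G u v ]

  adjacency-sym : ∀ G u v → adjacency G u v ≡ adjacency G v u
  adjacency-sym G u v = ≡.cong [_] (adj-sym G u v)

  adjacency-irrefl : ∀ G v → adjacency G v v ≡ 0#
  adjacency-irrefl G v = ≡.cong [_] (adj-irrefl G v)

  ι-degree : ∀ G v → ι (degree G v) ≈ sum (adjacency G v)
  ι-degree G v = ι-∣∣ (adj G v)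

  nonadjacent-entry : ∀ G u v →
    [ not (does (u ≟ v)) ∧ not (adj G u v) ] ≈ 1# - δ u v - adjacency G u v
  nonadjacent-entry G u v = begin
    [ not (does (u ≟ v)) ∧ not (adj G u v) ]
      ≈⟨ trans ([]-∧ (not (does (u ≟ v))) (not (adj G u v)))
               (*-cong ([]-not (does (u ≟ v))) ([]-not (adj G u v))) ⟩
    (1# - δ u v) * (1# - adjacency G u v)
      ≈⟨ solve 2 (λ d a → (:1 :- d) :* (:1 :- a) := (:1 :- d :- a) :+ d :* a) refl (δ u v) (adjacency G u v) ⟩
    (1# - δ u v - adjacency G u v) + δ u v * adjacency G u v
      ≈⟨ +-congˡ (trans (δ-subst u v (adjacency G u))
                   (trans (*-congˡ (reflexive (adjacency-irrefl G u))) (zeroʳ (δ u v)))) ⟩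
    (1# - δ u v - adjacency G u v) + 0#
      ≈⟨ +-identityʳ _ ⟩
    1# - δ u v - adjacency G u v
      ∎

  sum-nonadjacent : ∀ G u →
    sum (λ v → [ not (does (u ≟ v)) ∧ not (adj G u v) ]) ≈ ι (order G) - 1# - ι (degree G u)
  sum-nonadjacent G u = begin
    sum (λ v → [ not (does (u ≟ v)) ∧ not (adj G u v) ])
      ≈⟨ sum-cong (nonadjacent-entry G u) ⟩
    sum (λ v → 1# - δ u v - adjacency G u v)
      ≈⟨ ∑-distrib-+ (λ v → 1# - δ u v) (λ v → - adjacency G u v) ⟩
    sum (λ v → 1# - δ u v) + sum (λ v → - adjacency G u v)
      ≈⟨ +-congʳ (∑-distrib-+ (λ v → 1#) (λ v → - δ u v)) ⟩
    sum {order G} (λ v → 1#) + sum (λ v → - δ u v) + sum (λ v → - adjacency G u v)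
      ≈⟨ +-cong (+-cong (trans (sum-const (order G) 1#) (*-identityʳ _))
                   (trans (sum-neg (δ u)) (-‿cong (trans (sum-cong λ v → reflexive (δ-sym u v)) (sum-δ₁ u)))))
                (trans (sum-neg (adjacency G u)) (-‿cong (sym (ι-degree G u)))) ⟩
    ι (order G) - 1# - ι (degree G u)
      ∎

  -- The signless Laplacian matrix of G.
  Q : (G : Graph) → Matrix K (order G)
  Q = signlessLaplacian K

  Q-entry : ∀ G u v → Q G u v ≈ δ u v * ι (degree G u) + adjacency G u v
  Q-entry G u v = +-congʳ (if-δ u v (ι (degree G u)))

  Q-diagonal : ∀ G v → Q G v v ≈ ι (degree G v)
  Q-diagonal G v = begin
    Q G v v                                       ≈⟨ Q-entry G v v ⟩
    δ v v * ι (degree G v) + adjacency G v v      ≡⟨ ≡.cong₂ (λ a b → a * ι (degree G v) + b) (δ-refl v) (adjacency-irrefl G v) ⟩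
    1# * ι (degree G v) + 0#                      ≈⟨ solve 1 (λ d → :1 :* d :+ :0 := d) refl (ι (degree G v)) ⟩
    ι (degree G v)                                ∎

  Q-column : ∀ G v → sum (λ u → Q G u v) ≈ ι (degree G v) + ι (degree G v)
  Q-column G v = begin
    sum (λ u → Q G u v)
      ≈⟨ sum-cong (Q-entry′) ⟩
    sum (λ u → δ u v * ι (degree G u) + adjacency G v u)
      ≈⟨ ∑-distrib-+ (λ u → δ u v * ι (degree G u)) (adjacency G v) ⟩
    sum (λ u → δ u v * ι (degree G u)) + sum (adjacency G v)
      ≈⟨ +-cong (sum-δʳ v (λ u → ι (degree G u))) (sym (ι-degree G v)) ⟩
    ι (degree G v) + ι (degree G v)
      ∎
    where
    Q-entry′ : ∀ u → Q G u v ≈ δ u v * ι (degree G u) + adjacency G v u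
    Q-entry′ u = trans (Q-entry G u v) (+-congˡ (reflexive (adjacency-sym G u v)))

  charEntry : ∀ H x u v → scalar K x u v - Q H u v ≈ δ u v * (x - ι (degree H u)) - adjacency H u v
  charEntry H x u v = trans (+-cong (if-δ u v x) (-‿cong (Q-entry H u v)))
    (solve 4 (λ d x g a → d :* x :- (d :* g :+ a) := d :* (x :- g) :- a) refl
       (δ u v) x (ι (degree H u)) (adjacency H u v))

  charMatrix-column : ∀ H x v → sum (λ u → scalar K x u v - Q H u v) ≈ x - (ι (degree H v) + ι (degree H v))
  charMatrix-column H x v = begin
    sum (λ u → scalar K x u v - Q H u v)
      ≈⟨ ∑-distrib-+ (λ u → scalar K x u v) (λ u → - Q H u v) ⟩
    sum (λ u → scalar K x u v) + sum (λ u → - Q H u v)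
      ≈⟨ +-cong (trans (sum-cong λ u → if-δ u v x) (sum-δʳ v (λ _ → x)))
                (trans (sum-neg (λ u → Q H u v)) (-‿cong (Q-column H v))) ⟩
    x - (ι (degree H v) + ι (degree H v))
      ∎

  -- The sum of F over the members of a list.
  listSum : ∀ {a} {A : Set a} → List A → (A → Carrier) → Carrier
  listSum l F = foldr (λ x s → F x + s) 0# l

  sum-lookup : ∀ {a} {A : Set a} (l : List A) F → sum (λ i → F (lookup l i)) ≈ listSum l F
  sum-lookup []      F = refl
  sum-lookup (x ∷ l) F = +-congˡ (sum-lookup l F)

  listSum-++ : ∀ {a} {A : Set a} (l l′ : List A) F → listSum (l ++ l′) F ≈ listSum l F + listSum l′ F
  listSum-++ []      l′ F = sym (+-identityˡ _)
  listSum-++ (x ∷ l) l′ F = trans (+-congˡ (listSum-++ l l′ F)) (sym (+-assoc _ _ _))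

  listSum-map : ∀ {a b} {A : Set a} {B : Set b} (f : A → B) l F → listSum (map f l) F ≈ listSum l (F ∘ f)
  listSum-map f []      F = refl
  listSum-map f (x ∷ l) F = +-congˡ (listSum-map f l F)

  listSum-cong : ∀ {a} {A : Set a} (l : List A) {F F′ : A → Carrier} → (∀ x → F x ≈ F′ x) → listSum l F ≈ listSum l F′
  listSum-cong []      F≈F′ = refl
  listSum-cong (x ∷ l) F≈F′ = +-cong (F≈F′ x) (listSum-cong l F≈F′)

  listSum-tabulate : ∀ {a} {A : Set a} {n} (f : Fin n → A) F → listSum (tabulateᴸ f) F ≈ sum (λ i → F (f i))
  listSum-tabulate {n = zero}  f F = refl
  listSum-tabulate {n = suc n} f F = +-congˡ (listSum-tabulate (f ∘ suc) F)

  listSum-filterᵇ : ∀ {a} {A : Set a} (p : A → Bool) l F → listSum (filterᵇ p l) F ≈ listSum l (λ x → [ p x ] * F x)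
  listSum-filterᵇ p []      F = refl
  listSum-filterᵇ p (x ∷ l) F with p x
  ... | true  = +-cong (sym (*-identityˡ (F x))) (listSum-filterᵇ p l F)
  ... | false = trans (listSum-filterᵇ p l F) (trans (sym (+-identityˡ _)) (+-congʳ (sym (zeroˡ (F x)))))

  listSum-product : ∀ {a b} {A : Set a} {B : Set b} (l : List A) (l′ : List B) F →
    listSum (cartesianProduct l l′) F ≈ listSum l (λ x → listSum l′ (λ y → F (x , y)))
  listSum-product []      l′ F = refl
  listSum-product (x ∷ l) l′ F = trans (listSum-++ (map (x ,_) l′) (cartesianProduct l l′) F)
    (+-cong (listSum-map (x ,_) l′ F) (listSum-product l l′ F))

  -- Whether (u , v) is the listed orientation of an edge.
  isEdge : (G : Graph) → Vertex G → Vertex G → Bool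
  isEdge G u v = (toℕ u <ᵇ toℕ v) ∧ adj G u v

  sum-edges : ∀ G (F : Vertex G × Vertex G → Carrier) →
    sum (λ e → F (lookup (edges G) e)) ≈ sum (λ u → sum (λ v → [ isEdge G u v ] * F (u , v)))
  sum-edges G F = begin
    sum (λ e → F (lookup (edges G) e))
      ≈⟨ sum-lookup (edges G) F ⟩
    listSum (edges G) F
      ≈⟨ listSum-filterᵇ (λ (u , v) → isEdge G u v) (cartesianProduct V V) F ⟩
    listSum (cartesianProduct V V) F′
      ≈⟨ listSum-product V V F′ ⟩
    listSum V (λ u → listSum V (λ v → F′ (u , v)))
      ≈⟨ listSum-cong V (λ u → listSum-tabulate (λ i → i) (λ v → F′ (u , v))) ⟩
    listSum V (λ u → sum (λ v → F′ (u , v)))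
      ≈⟨ listSum-tabulate (λ i → i) (λ u → sum (λ v → F′ (u , v))) ⟩
    sum (λ u → sum (λ v → F′ (u , v)))
      ∎
    where
    V : List (Vertex G)
    V = allFin (order G)
    F′ : Vertex G × Vertex G → Carrier
    F′ (u , v) = [ isEdge G u v ] * F (u , v)

  lookup-filterᵇ : ∀ {a} {A : Set a} (p : A → Bool) l i → T (p (lookup (filterᵇ p l) i))
  lookup-filterᵇ p (x ∷ l) i with p x in eq
  lookup-filterᵇ p (x ∷ l) zero    | true rewrite eq = _
  lookup-filterᵇ p (x ∷ l) (suc i) | true  = lookup-filterᵇ p l i
  lookup-filterᵇ p (x ∷ l) i       | false = lookup-filterᵇ p l i

  -- The smaller and the larger endpoint of an edge.
  source target : (G : Graph) → Edge G → Vertex G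
  source G e = proj₁ (lookup (edges G) e)
  target G e = proj₂ (lookup (edges G) e)

  source≢target : ∀ G e → source G e ≢ target G e
  source≢target G e eq = ℕₚ.<-irrefl (≡.cong toℕ eq) (ℕₚ.<ᵇ⇒< _ _ (proj₁ (Equivalence.to T-∧
    (lookup-filterᵇ (λ (u , v) → isEdge G u v) (cartesianProduct (allFin (order G)) (allFin (order G))) e))))

  isEdge-either : ∀ G u v → [ isEdge G u v ] + [ isEdge G v u ] ≈ adjacency G u v
  isEdge-either G u v rewrite adj-sym G v u with ℕₚ.<-cmp (toℕ u) (toℕ v)
  ... | tri< u<v _ v≮u = begin
    [ (toℕ u <ᵇ toℕ v) ∧ adj G u v ] + [ (toℕ v <ᵇ toℕ u) ∧ adj G u v ]
      ≡⟨ ≡.cong₂ (λ a b → [ a ∧ adj G u v ] + [ b ∧ adj G u v ])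
           (dec-true (toℕ u ℕₚ.<? toℕ v) u<v) (dec-false (toℕ v ℕₚ.<? toℕ u) v≮u) ⟩
    adjacency G u v + 0#  ≈⟨ +-identityʳ _ ⟩
    adjacency G u v       ∎
  ... | tri> u≮v _ v<u = begin
    [ (toℕ u <ᵇ toℕ v) ∧ adj G u v ] + [ (toℕ v <ᵇ toℕ u) ∧ adj G u v ]
      ≡⟨ ≡.cong₂ (λ a b → [ a ∧ adj G u v ] + [ b ∧ adj G u v ])
           (dec-false (toℕ u ℕₚ.<? toℕ v) u≮v) (dec-true (toℕ v ℕₚ.<? toℕ u) v<u) ⟩
    0# + adjacency G u v  ≈⟨ +-identityˡ _ ⟩
    adjacency G u v       ∎
  ... | tri≈ u≮v u≡v v≮u = begin
    [ (toℕ u <ᵇ toℕ v) ∧ adj G u v ] + [ (toℕ v <ᵇ toℕ u) ∧ adj G u v ]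
      ≡⟨ ≡.cong₂ (λ a b → [ a ∧ adj G u v ] + [ b ∧ adj G u v ])
           (dec-false (toℕ u ℕₚ.<? toℕ v) u≮v) (dec-false (toℕ v ℕₚ.<? toℕ u) v≮u) ⟩
    0# + 0#          ≈⟨ +-identityˡ _ ⟩
    0#               ≡⟨ adjacency-irrefl G u ⟨
    adjacency G u u  ≡⟨ ≡.cong (adjacency G u) (toℕ-injective u≡v) ⟩
    adjacency G u v  ∎

  -- The incidence matrix of vertices and edges.
  incidence : (G : Graph) → Vertex G → Edge G → Carrier
  incidence G v e = [ incident G v e ]

  incidence-δ : ∀ G v e → incidence G v e ≈ δ v (source G e) + δ v (target G e)
  incidence-δ G v e with v ≟ source G e | v ≟ target G e
  ... | yes p | yes q = ⊥-elim (source≢target G e (≡.trans (≡.sym p) q))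
  ... | yes _ | no _  = sym (+-identityʳ 1#)
  ... | no _  | yes _ = sym (+-identityˡ 1#)
  ... | no _  | no _  = sym (+-identityˡ 0#)

  incidence-column : ∀ G e → sum (λ v → incidence G v e) ≈ ι 2
  incidence-column G e = begin
    sum (λ v → incidence G v e)
      ≈⟨ sum-cong (λ v → incidence-δ G v e) ⟩
    sum (λ v → δ v (source G e) + δ v (target G e))
      ≈⟨ ∑-distrib-+ (λ v → δ v (source G e)) (λ v → δ v (target G e)) ⟩
    sum (λ v → δ v (source G e)) + sum (λ v → δ v (target G e))
      ≈⟨ +-cong (sum-δ₁ (source G e)) (sum-δ₁ (target G e)) ⟩
    1# + 1#
      ≈⟨ +-congˡ (+-identityʳ 1#) ⟨
    ι 2
      ∎

  -- The signless Laplacian is the Gram matrix of the rows of the incidence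
  -- matrix.
  incidence-gram : ∀ G u v → sum (λ e → incidence G u e * incidence G v e) ≈ Q G u v
  incidence-gram G i j = begin
    sum (λ e → incidence G i e * incidence G j e)
      ≈⟨ sum-cong (λ e → *-cong (incidence-δ G i e) (incidence-δ G j e)) ⟩
    sum (λ e → F (lookup (edges G) e))
      ≈⟨ sum-edges G F ⟩
    sum (λ u → sum (λ v → w u v * F (u , v)))
      ≈⟨ sum-cong (λ u → trans (sum-cong (expand u)) (inner u)) ⟩
    sum (λ u → δ i u * (δ j u * W u + w u j) + (δ j u * w u i + δ j i * w u i))
      ≈⟨ ∑-distrib-+ (λ u → δ i u * (δ j u * W u + w u j)) (λ u → δ j u * w u i + δ j i * w u i) ⟩
    sum (λ u → δ i u * (δ j u * W u + w u j)) + sum (λ u → δ j u * w u i + δ j i * w u i)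
      ≈⟨ +-cong (sum-δ i (λ u → δ j u * W u + w u j))
           (trans (∑-distrib-+ (λ u → δ j u * w u i) (λ u → δ j i * w u i))
              (+-cong (sum-δ j (λ u → w u i)) (sym (*-distribˡ-sum (δ j i) (λ u → w u i))))) ⟩
    (δ j i * W i + w i j) + (w j i + δ j i * sum (λ u → w u i))
      ≈⟨ solve 5 (λ d s a b t → (d :* s :+ a) :+ (b :+ d :* t) := d :* (s :+ t) :+ (a :+ b)) refl
           (δ j i) (W i) (w i j) (w j i) (sum (λ u → w u i)) ⟩
    δ j i * (W i + sum (λ u → w u i)) + (w i j + w j i)
      ≈⟨ +-cong (*-cong (reflexive (δ-sym j i)) degree≈) (isEdge-either G i j) ⟩
    δ i j * ι (degree G i) + adjacency G i j
      ≈⟨ Q-entry G i j ⟨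
    Q G i j
      ∎
    where
    w : Vertex G → Vertex G → Carrier
    w u v = [ isEdge G u v ]
    W : Vertex G → Carrier
    W u = sum (w u)
    F : Vertex G × Vertex G → Carrier
    F (u , v) = (δ i u + δ i v) * (δ j u + δ j v)

    -- The terms δ i u δ j u and δ i v δ j v of F (u , v) lead to the degree of i,
    -- the mixed ones to the adjacency of i and j.
    expand : ∀ u v → w u v * F (u , v)
      ≈ (δ i u * δ j u * w u v + δ j v * (δ i u * w u v))
        + (δ i v * (δ j u * w u v) + δ i v * (δ j v * w u v))
    expand u v = solve 5 (λ w a b c d → w :* ((a :+ b) :* (c :+ d))
        := (a :* c :* w :+ d :* (a :* w)) :+ (b :* (c :* w) :+ b :* (d :* w))) refl
      (w u v) (δ i u) (δ i v) (δ j u) (δ j v)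

    inner : ∀ u → sum (λ v → (δ i u * δ j u * w u v + δ j v * (δ i u * w u v))
                             + (δ i v * (δ j u * w u v) + δ i v * (δ j v * w u v)))
      ≈ δ i u * (δ j u * W u + w u j) + (δ j u * w u i + δ j i * w u i)
    inner u = begin
      sum (λ v → (t₁ v + t₂ v) + (t₃ v + t₄ v))
        ≈⟨ ∑-distrib-+ (λ v → t₁ v + t₂ v) (λ v → t₃ v + t₄ v) ⟩
      sum (λ v → t₁ v + t₂ v) + sum (λ v → t₃ v + t₄ v)
        ≈⟨ +-cong (∑-distrib-+ t₁ t₂) (∑-distrib-+ t₃ t₄) ⟩
      (sum t₁ + sum t₂) + (sum t₃ + sum t₄)
        ≈⟨ +-cong (+-cong (sym (*-distribˡ-sum (δ i u * δ j u) (w u))) (sum-δ j (λ v → δ i u * w u v)))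
                  (+-cong (sum-δ i (λ v → δ j u * w u v)) (sum-δ i (λ v → δ j v * w u v))) ⟩
      (δ i u * δ j u * W u + δ i u * w u j) + (δ j u * w u i + δ j i * w u i)
        ≈⟨ +-congʳ (solve 4 (λ a c s x → a :* c :* s :+ a :* x := a :* (c :* s :+ x)) refl
                      (δ i u) (δ j u) (W u) (w u j)) ⟩
      δ i u * (δ j u * W u + w u j) + (δ j u * w u i + δ j i * w u i)
        ∎
      where
      t₁ t₂ t₃ t₄ : Vertex G → Carrier
      t₁ v = δ i u * δ j u * w u v
      t₂ v = δ j v * (δ i u * w u v)
      t₃ v = δ i v * (δ j u * w u v)
      t₄ v = δ i v * (δ j v * w u v)

    degree≈ : W i + sum (λ u → w u i) ≈ ι (degree G i)
    degree≈ = begin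
      sum (w i) + sum (λ u → w u i)   ≈⟨ ∑-distrib-+ (w i) (λ u → w u i) ⟨
      sum (λ u → w i u + w u i)       ≈⟨ sum-cong (isEdge-either G i) ⟩
      sum (adjacency G i)             ≈⟨ ι-degree G i ⟨
      ι (degree G i)                  ∎

  incidence-row : ∀ G v → sum (incidence G v) ≈ ι (degree G v)
  incidence-row G v = begin
    sum (incidence G v)                            ≈⟨ sum-cong (λ e → []-idem (incident G v e)) ⟨
    sum (λ e → incidence G v e * incidence G v e)  ≈⟨ incidence-gram G v v ⟩
    Q G v v                                        ≈⟨ Q-diagonal G v ⟩
    ι (degree G v)                                 ∎

  handshake : ∀ G → sum (λ v → ι (degree G v)) ≈ ι (size G) * ι 2
  handshake G = begin
    sum (λ v → ι (degree G v))                  ≈⟨ sum-cong (incidence-row G) ⟨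
    sum (λ v → sum (λ e → incidence G v e))     ≈⟨ ∑-comm (incidence G) ⟩
    sum (λ e → sum (λ v → incidence G v e))     ≈⟨ sum-cong (incidence-column G) ⟩
    sum {size G} (λ e → ι 2)                    ≈⟨ sum-const (size G) (ι 2) ⟩
    ι (size G) * ι 2                            ∎

-- Vertices and adjacency of the central vertex corona

module CoronaGraph (G G′ : Graph) where

  private
    n m n′ : ℕ
    n  = order G
    m  = size G
    n′ = order G′

  -- A vertex of the central graph, viewed in the corona.
  fromCentral : Vertex (central G) → Vertex (G ⊙ G′)
  fromCentral c = c ↑ˡ (n ℕ.* n′)

  -- A vertex of G, viewed in the corona.
  base : Vertex G → Vertex (G ⊙ G′)
  base u = fromCentral (u ↑ˡ m)

  -- The vertex subdividing an edge.
  middle : Edge G → Vertex (G ⊙ G′)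
  middle e = fromCentral (n ↑ʳ e)

  -- The vertex w of the i-th copy of G′.
  copy : Vertex G → Vertex G′ → Vertex (G ⊙ G′)
  copy i w = (n ℕ.+ m) ↑ʳ combine i w

  ↑ˡ≢↑ʳ : ∀ {a b} (i : Fin a) (j : Fin b) → i ↑ˡ b ≢ a ↑ʳ j
  ↑ˡ≢↑ʳ {a} {b} i j eq with ≡.trans (≡.sym (splitAt-↑ˡ a i b)) (≡.trans (≡.cong (splitAt a) eq) (splitAt-↑ʳ a b j))
  ... | ()

  private
    -- The argument at which coronaAdj is evaluated for the vertex p.
    label : Vertex (G ⊙ G′) → Vertex (central G) Sum.⊎ (Vertex G × Vertex G′)
    label p = Sum.map₂ (remQuot {n} n′) (splitAt (n ℕ.+ m) p)

    label-fromCentral : ∀ c → label (fromCentral c) ≡ inj₁ c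
    label-fromCentral c = ≡.cong (Sum.map₂ (remQuot {n} n′)) (splitAt-↑ˡ (n ℕ.+ m) c (n ℕ.* n′))

    label-copy : ∀ i w → label (copy i w) ≡ inj₂ (i , w)
    label-copy i w = ≡.trans
      (≡.cong (Sum.map₂ (remQuot {n} n′)) (splitAt-↑ʳ (n ℕ.+ m) (n ℕ.* n′) (combine i w)))
      (≡.cong inj₂ (remQuot-combine i w))

    adj-central : ∀ c d {a b} → splitAt n c ≡ a → splitAt n d ≡ b →
                  adj (G ⊙ G′) (fromCentral c) (fromCentral d) ≡ centralAdj G a b
    adj-central c d c≡a d≡b = ≡.trans
      (≡.cong₂ (coronaAdj G G′) (label-fromCentral c) (label-fromCentral d))
      (≡.cong₂ (centralAdj G) c≡a d≡b)

  adj-base-base : ∀ u v → adj (G ⊙ G′) (base u) (base v) ≡ not (does (u ≟ v)) ∧ not (adj G u v)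
  adj-base-base u v = adj-central _ _ (splitAt-↑ˡ n u m) (splitAt-↑ˡ n v m)

  adj-base-middle : ∀ u e → adj (G ⊙ G′) (base u) (middle e) ≡ incident G u e
  adj-base-middle u e = adj-central _ _ (splitAt-↑ˡ n u m) (splitAt-↑ʳ n m e)

  adj-middle-base : ∀ e u → adj (G ⊙ G′) (middle e) (base u) ≡ incident G u e
  adj-middle-base e u = adj-central _ _ (splitAt-↑ʳ n m e) (splitAt-↑ˡ n u m)

  adj-middle-middle : ∀ e f → adj (G ⊙ G′) (middle e) (middle f) ≡ false
  adj-middle-middle e f = adj-central _ _ (splitAt-↑ʳ n m e) (splitAt-↑ʳ n m f)

  adj-central-copy : ∀ c i w → adj (G ⊙ G′) (fromCentral c) (copy i w) ≡ does (c ≟ i ↑ˡ m)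
  adj-central-copy c i w = ≡.cong₂ (coronaAdj G G′) (label-fromCentral c) (label-copy i w)

  adj-copy-central : ∀ i w c → adj (G ⊙ G′) (copy i w) (fromCentral c) ≡ does (c ≟ i ↑ˡ m)
  adj-copy-central i w c = ≡.cong₂ (coronaAdj G G′) (label-copy i w) (label-fromCentral c)

  adj-copy-copy : ∀ i w j z → adj (G ⊙ G′) (copy i w) (copy j z) ≡ does (i ≟ j) ∧ adj G′ w z
  adj-copy-copy i w j z = ≡.cong₂ (coronaAdj G G′) (label-copy i w) (label-copy j z)

  adj-same-copy : ∀ i w z → adj (G ⊙ G′) (copy i w) (copy i z) ≡ adj G′ w z
  adj-same-copy i w z = ≡.trans (adj-copy-copy i w i z) (≡.cong (_∧ adj G′ w z) (dec-true (i ≟ i) ≡.refl))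

  copy-injective : ∀ i w z → copy i w ≡ copy i z → w ≡ z
  copy-injective i w z eq = proj₂ (combine-injective i w i z (↑ʳ-injective (n ℕ.+ m) _ _ eq))

  base-injective : ∀ u v → base u ≡ base v → u ≡ v
  base-injective u v eq = ↑ˡ-injective m u v (↑ˡ-injective (n ℕ.* n′) _ _ eq)

  -- Every vertex of the corona is of one of the three kinds.
  data View : Vertex (G ⊙ G′) → Set where
    isBase   : ∀ u → View (base u)
    isMiddle : ∀ e → View (middle e)
    isCopy   : ∀ i w → View (copy i w)

  view : ∀ p → View p
  view p with splitAt (n ℕ.+ m) p | join-splitAt (n ℕ.+ m) (n ℕ.* n′) p
  ... | inj₁ c | ≡.refl with splitAt n c | join-splitAt n m c
  ...   | inj₁ u | ≡.refl = isBase u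
  ...   | inj₂ e | ≡.refl = isMiddle e
  view p | inj₂ l | ≡.refl =
    ≡.subst (λ l → View ((n ℕ.+ m) ↑ʳ l)) (combine-remQuot {n} n′ l)
      (isCopy (proj₁ (remQuot {n} n′ l)) (proj₂ (remQuot {n} n′ l)))

-- Degrees and characteristic matrix of the corona

module CoronaSums {c ℓ₁ ℓ₂ : Level} (K : HeytingField c ℓ₁ ℓ₂) (G G′ : Graph) where

  open Field K
  open GraphSums K
  open CoronaGraph G G′ public

  private
    n m n′ : ℕ
    n  = order G
    m  = size G
    n′ = order G′
    Γ : Graph
    Γ = G ⊙ G′

  sum-corona : ∀ (f : Vertex Γ → Carrier) →
    sum f ≈ (sum (λ u → f (base u)) + sum (λ e → f (middle e))) + sum (λ i → sum (λ w → f (copy i w)))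
  sum-corona f = trans (sum-+-split (n ℕ.+ m) f)
    (+-cong (sum-+-split n (λ c → f (fromCentral c)))
            (sum-*-split n (λ l → f ((n ℕ.+ m) ↑ʳ l))))

  A-base-base : ∀ u v → adjacency Γ (base u) (base v) ≈ 1# - δ u v - adjacency G u v
  A-base-base u v = trans (reflexive (≡.cong [_] (adj-base-base u v))) (nonadjacent-entry G u v)

  A-base-middle : ∀ u e → adjacency Γ (base u) (middle e) ≡ incidence G u e
  A-base-middle u e = ≡.cong [_] (adj-base-middle u e)

  A-middle-base : ∀ e u → adjacency Γ (middle e) (base u) ≡ incidence G u e
  A-middle-base e u = ≡.cong [_] (adj-middle-base e u)

  A-middle-middle : ∀ e f → adjacency Γ (middle e) (middle f) ≡ 0#
  A-middle-middle e f = ≡.cong [_] (adj-middle-middle e f)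

  A-central-copy : ∀ d i w → adjacency Γ (fromCentral d) (copy i w) ≡ δ d (i ↑ˡ m)
  A-central-copy d i w = ≡.cong [_] (adj-central-copy d i w)

  A-copy-central : ∀ i w d → adjacency Γ (copy i w) (fromCentral d) ≡ δ d (i ↑ˡ m)
  A-copy-central i w d = ≡.cong [_] (adj-copy-central i w d)

  A-copy-copy : ∀ i w j z → adjacency Γ (copy i w) (copy j z) ≈ δ i j * adjacency G′ w z
  A-copy-copy i w j z = trans (reflexive (≡.cong [_] (adj-copy-copy i w j z))) ([]-∧ (does (i ≟ j)) (adj G′ w z))

  δ-↑ˡ : ∀ (u v : Vertex G) → δ (u ↑ˡ m) (v ↑ˡ m) ≡ δ u v
  δ-↑ˡ = δ-injective (_↑ˡ m) (↑ˡ-injective m)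

  δ-↑ʳ-↑ˡ : ∀ (e : Edge G) (v : Vertex G) → δ (n ↑ʳ e) (v ↑ˡ m) ≡ 0#
  δ-↑ʳ-↑ˡ e v = δ-≢ λ eq → ↑ˡ≢↑ʳ v e (≡.sym eq)

  -- A vertex of degree r in G has n − 1 − r non-neighbours, r incident edges and
  -- the n′ vertices of its copy as neighbours; so r cancels.
  ι-degree-base : ∀ u → ι (degree Γ (base u)) ≈ ι n - 1# + ι n′
  ι-degree-base u = begin
    ι (degree Γ (base u))
      ≈⟨ trans (ι-degree Γ (base u)) (sum-corona (adjacency Γ (base u))) ⟩
    (sum (λ v → adjacency Γ (base u) (base v)) + sum (λ e → adjacency Γ (base u) (middle e)))
      + sum (λ i → sum (λ w → adjacency Γ (base u) (copy i w)))
      ≈⟨ +-cong (+-cong among-base among-middle) among-copies ⟩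
    ((ι n - 1# - d) + d) + ι n′
      ≈⟨ solve 3 (λ n d k → ((n :- :1 :- d) :+ d) :+ k := n :- :1 :+ k) refl (ι n) d (ι n′) ⟩
    ι n - 1# + ι n′
      ∎
    where
    d : Carrier
    d = ι (degree G u)
    among-base : sum (λ v → adjacency Γ (base u) (base v)) ≈ ι n - 1# - d
    among-base = trans (sum-cong λ v → reflexive (≡.cong [_] (adj-base-base u v))) (sum-nonadjacent G u)
    among-middle : sum (λ e → adjacency Γ (base u) (middle e)) ≈ d
    among-middle = trans (sum-cong λ e → reflexive (A-base-middle u e)) (incidence-row G u)
    among-copies : sum (λ i → sum (λ w → adjacency Γ (base u) (copy i w))) ≈ ι n′
    among-copies = begin
      sum (λ i → sum (λ w → adjacency Γ (base u) (copy i w)))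
        ≈⟨ sum-cong (λ i → trans (sum-cong λ w → reflexive (≡.trans (A-central-copy (u ↑ˡ m) i w) (δ-↑ˡ u i)))
                            (trans (sum-const n′ (δ u i)) (*-comm _ _))) ⟩
      sum (λ i → δ u i * ι n′)
        ≈⟨ sum-δ u (λ _ → ι n′) ⟩
      ι n′
        ∎

  ι-degree-middle : ∀ e → ι (degree Γ (middle e)) ≈ ι 2
  ι-degree-middle e = begin
    ι (degree Γ (middle e))
      ≈⟨ trans (ι-degree Γ (middle e)) (sum-corona (adjacency Γ (middle e))) ⟩
    (sum (λ v → adjacency Γ (middle e) (base v)) + sum (λ f → adjacency Γ (middle e) (middle f)))
      + sum (λ i → sum (λ w → adjacency Γ (middle e) (copy i w)))
      ≈⟨ +-cong (+-cong (trans (sum-cong λ v → reflexive (A-middle-base e v)) (incidence-column G e))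
                        (sum-zero λ f → reflexive (A-middle-middle e f)))
                (sum-zero λ i → sum-zero λ w →
                   reflexive (≡.trans (A-central-copy (n ↑ʳ e) i w) (δ-↑ʳ-↑ˡ e i))) ⟩
    (ι 2 + 0#) + 0#
      ≈⟨ trans (+-identityʳ _) (+-identityʳ _) ⟩
    ι 2
      ∎

  ι-degree-copy : ∀ i w → ι (degree Γ (copy i w)) ≈ 1# + ι (degree G′ w)
  ι-degree-copy i w = begin
    ι (degree Γ (copy i w))
      ≈⟨ trans (ι-degree Γ (copy i w)) (sum-corona (adjacency Γ (copy i w))) ⟩
    (sum (λ v → adjacency Γ (copy i w) (base v)) + sum (λ e → adjacency Γ (copy i w) (middle e)))
      + sum (λ j → sum (λ z → adjacency Γ (copy i w) (copy j z)))
      ≈⟨ +-cong (+-cong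
           (trans (sum-cong λ v → reflexive (≡.trans (A-copy-central i w (v ↑ˡ m)) (δ-↑ˡ v i))) (sum-δ₁ i))
           (sum-zero λ e → reflexive (≡.trans (A-copy-central i w (n ↑ʳ e)) (δ-↑ʳ-↑ˡ e i))))
           (trans (sum-cong λ j → trans (sum-cong (A-copy-copy i w j))
                                        (sym (*-distribˡ-sum (δ i j) (adjacency G′ w))))
                  (sum-δ i (λ _ → sum (adjacency G′ w)))) ⟩
    (1# + 0#) + sum (adjacency G′ w)
      ≈⟨ +-cong (+-identityʳ 1#) (sym (ι-degree G′ w)) ⟩
    1# + ι (degree G′ w)
      ∎

  -- The blocks of x I − Q(Γ).
  module Blocks (x : Carrier) where

    X : Matrix K (order Γ)
    X p q = scalar K x p q - Q Γ p q

    X-off : ∀ p q → p ≢ q → X p q ≈ - adjacency Γ p q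
    X-off p q p≢q = begin
      X p q
        ≈⟨ charEntry Γ x p q ⟩
      δ p q * (x - ι (degree Γ p)) - adjacency Γ p q
        ≈⟨ +-congʳ (trans (*-congʳ (reflexive (δ-≢ p≢q))) (zeroˡ _)) ⟩
      0# - adjacency Γ p q
        ≈⟨ +-identityˡ _ ⟩
      - adjacency Γ p q
        ∎

    X-base-base : ∀ u v → X (base u) (base v)
      ≈ δ u v * (x - (ι n - 1# + ι n′)) - (1# - δ u v - adjacency G u v)
    X-base-base u v = trans (charEntry Γ x (base u) (base v))
      (+-cong (*-cong (reflexive (δ-injective base base-injective u v))
                      (+-congˡ (-‿cong (ι-degree-base u))))
              (-‿cong (A-base-base u v)))

    X-base-middle : ∀ u e → X (base u) (middle e) ≈ - incidence G u e
    X-base-middle u e = trans (X-off (base u) (middle e) (λ eq → ↑ˡ≢↑ʳ u e (↑ˡ-injective (n ℕ.* n′) _ _ eq)))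
      (-‿cong (reflexive (A-base-middle u e)))

    X-middle-base : ∀ e u → X (middle e) (base u) ≈ - incidence G u e
    X-middle-base e u = trans (X-off (middle e) (base u) (λ eq → ↑ˡ≢↑ʳ u e (↑ˡ-injective (n ℕ.* n′) _ _ (≡.sym eq))))
      (-‿cong (reflexive (A-middle-base e u)))

    X-middle-middle : ∀ e f → X (middle e) (middle f) ≈ δ e f * (x - ι 2)
    X-middle-middle e f = begin
      X (middle e) (middle f)
        ≈⟨ charEntry Γ x (middle e) (middle f) ⟩
      δ (middle e) (middle f) * (x - ι (degree Γ (middle e))) - adjacency Γ (middle e) (middle f)
        ≈⟨ +-cong (*-cong (reflexive (δ-injective middle
                     (λ e f eq → ↑ʳ-injective n e f (↑ˡ-injective (n ℕ.* n′) _ _ eq)) e f))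
                     (+-congˡ (-‿cong (ι-degree-middle e))))
                  (-‿cong (reflexive (A-middle-middle e f))) ⟩
      δ e f * (x - ι 2) - 0#
        ≈⟨ solve 1 (λ y → y :- :0 := y) refl (δ e f * (x - ι 2)) ⟩
      δ e f * (x - ι 2)
        ∎

    X-central-copy : ∀ d i w → X (fromCentral d) (copy i w) ≈ - δ d (i ↑ˡ m)
    X-central-copy d i w = trans (X-off _ _ (↑ˡ≢↑ʳ d (combine i w))) (-‿cong (reflexive (A-central-copy d i w)))

    X-copy-central : ∀ i w d → X (copy i w) (fromCentral d) ≈ - δ d (i ↑ˡ m)
    X-copy-central i w d = trans (X-off _ _ (λ eq → ↑ˡ≢↑ʳ d (combine i w) (≡.sym eq)))
      (-‿cong (reflexive (A-copy-central i w d)))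

    -- The block of each copy is the characteristic matrix of G′ at x − 1.
    Y : Matrix K n′
    Y w z = scalar K (x - 1#) w z - Q G′ w z

    δ-copy : ∀ i w j z → δ (copy i w) (copy j z) ≈ δ i j * δ w z
    δ-copy i w j z with i ≟ j | w ≟ z
    ... | yes ≡.refl | yes ≡.refl = trans (reflexive (δ-refl (copy i w))) (sym (*-identityˡ 1#))
    ... | yes ≡.refl | no w≢z = trans
      (reflexive (δ-≢ λ eq → w≢z (proj₂ (combine-injective i w i z (↑ʳ-injective (n ℕ.+ m) _ _ eq)))))
      (sym (*-identityˡ 0#))
    ... | no i≢j | b = trans
      (reflexive (δ-≢ λ eq → i≢j (proj₁ (combine-injective i w j z (↑ʳ-injective (n ℕ.+ m) _ _ eq)))))
      (sym (zeroˡ _))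

    X-copy-copy : ∀ i w j z → X (copy i w) (copy j z) ≈ δ i j * Y w z
    X-copy-copy i w j z = begin
      X (copy i w) (copy j z)
        ≈⟨ charEntry Γ x (copy i w) (copy j z) ⟩
      δ (copy i w) (copy j z) * (x - ι (degree Γ (copy i w))) - adjacency Γ (copy i w) (copy j z)
        ≈⟨ +-cong (*-cong (δ-copy i w j z) (+-congˡ (-‿cong (ι-degree-copy i w)))) (-‿cong (A-copy-copy i w j z)) ⟩
      δ i j * δ w z * (x - (1# + ι (degree G′ w))) - δ i j * adjacency G′ w z
        ≈⟨ solve 5 (λ d e x g a → d :* e :* (x :- (:1 :+ g)) :- d :* a := d :* (e :* (x :- :1 :- g) :- a)) refl
             (δ i j) (δ w z) x (ι (degree G′ w)) (adjacency G′ w z) ⟩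
      δ i j * (δ w z * (x - 1# - ι (degree G′ w)) - adjacency G′ w z)
        ≈⟨ *-congˡ (charEntry G′ (x - 1#) w z) ⟨
      δ i j * Y w z
        ∎


-- The characteristic polynomial of the corona of two regular graphs

module CoronaCharPoly {c ℓ₁ ℓ₂ : Level} (K : HeytingField c ℓ₁ ℓ₂)
  (closed : AlgebraicallyClosed K) (char0 : CharacteristicZero K) where

  open Field K
  open Determinants K
  open Alternating char0
  open Polynomials K char0
  open Spectrum K closed char0
  open GraphSums K

  -- The determinant of the characteristic matrix after its first row has been
  -- replaced by ones.  For a matrix with constant column sums γ, it is the
  -- characteristic polynomial divided by x − γ.
  onesPoly : ∀ {n} → Matrix K n → Carrier → Carrier
  onesPoly M z = det K (onesFirst (λ i j → scalar K z i j - M i j))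

  -- The characteristic polynomial of the corona at x, given n = k + 1 vertices,
  -- m edges, degree r and the value χ₁ of onesPoly for G, n′ vertices, degree
  -- r′ and the value χ₂ of the characteristic polynomial for G′.  The values
  -- of onesPoly and of the characteristic polynomial are taken at `point` and
  -- at x − 1.  The arguments s, t, i are inverses of x − 1 − 2 r′, x − 2, x − 3.
  module Formula (k n′ r r′ : ℕ) (x s t i : Carrier) where

    α β point : Carrier
    α = x - (ι (suc k) - 1# + ι n′) + 1# - ι r - s * ι n′
    β = 1# - t
    point = - (α * (x - ι 2) * i)

    value : (m : ℕ) (χ₁ χ₂ : Carrier) → Carrier
    value m χ₁ χ₂ =
      (- β * (point - (ι r + ι r)) - ι (suc k)) * ((- β) ^ k * χ₁) * (x - ι 2) ^ m * χ₂ ^ suc k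

  charMatrix-onesPoly : ∀ {n} k (M : Matrix K n) γ z → n ≡ suc k →
    (∀ j → sum (λ i → scalar K z i j - M i j) ≈ z - γ) →
    charPoly K M z ≈ (z - γ) * onesPoly M z
  charMatrix-onesPoly k M γ z ≡.refl columns = det-onesFirst (λ i j → scalar K z i j - M i j) (z - γ) columns

  -- det (y (z I − M) − J), for the all-ones matrix J.
  scaled-minus-ones : ∀ {n} k (M S : Matrix K n) γ y z → n ≡ suc k →
    (∀ j → sum (λ i → scalar K z i j - M i j) ≈ z - γ) →
    (∀ i j → S i j ≈ y * (scalar K z i j - M i j) - 1#) →
    det K S ≈ (y * (z - γ) - ι (suc k)) * (y ^ k * onesPoly M z)
  scaled-minus-ones k M S γ y z ≡.refl columns S≈ = begin
    det K S
      ≈⟨ det-cong S≈ ⟩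
    det K (λ i j → P i j - 1#)
      ≈⟨ det-minus-ones P (y * (z - γ)) (λ j →
           trans (sym (*-distribˡ-sum y (λ i → scalar K z i j - M i j))) (*-congˡ (columns j))) ⟩
    (y * (z - γ) - ι (suc k)) * det K (onesFirst P)
      ≈⟨ *-congˡ (det-onesFirst-* y (λ i j → scalar K z i j - M i j)) ⟩
    (y * (z - γ) - ι (suc k)) * (y ^ k * onesPoly M z)
      ∎
    where
    P : Matrix K (suc k)
    P i j = y * (scalar K z i j - M i j)

  module _ (G G′ : Graph) (r r′ : ℕ) (reg : ∀ v → degree G v ≡ r) (reg′ : ∀ w → degree G′ w ≡ r′)
           (k : ℕ) (order≡ : order G ≡ suc k) (x s t i : Carrier)
           (s-inverse : s * (x - (1# + (ι r′ + ι r′))) ≈ 1#)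
           (t-inverse : t * (x - ι 2) ≈ 1#)
           (i-inverse : i * (x - ι 3) ≈ 1#) where

    open CoronaSums K G G′
    open Blocks x
    open Formula k (order G′) r r′ x s t i

    private
      n m n′ : ℕ
      n  = order G
      m  = size G
      n′ = order G′

    -- The multiples of the rows of the copies that clear the block between the
    -- central graph and the copies.
    weight₁ : Vertex (central G) → Fin (n ℕ.* n′) → Carrier
    weight₁ d l = s * δ d (proj₁ (remQuot {n} n′ l) ↑ˡ m)

    sum-weight₁ : ∀ d (f : Fin (n ℕ.* n′) → Carrier) →
      sum (λ l → weight₁ d l * f l) ≈ sum (λ i → s * δ d (i ↑ˡ m) * sum (λ w → f (combine i w)))
    sum-weight₁ d f = trans (sum-*-split n (λ l → weight₁ d l * f l)) (sum-cong λ i →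
      trans (sum-cong {f = λ w → weight₁ d (combine i w) * f (combine i w)} λ w →
               *-congʳ (reflexive (≡.cong (λ q → s * δ d (proj₁ q ↑ˡ m)) (remQuot-combine {n} i w))))
            (sym (*-distribˡ-sum (s * δ d (i ↑ˡ m)) (λ w → f (combine i w)))))

    Y-column : ∀ z → sum (λ w → Y w z) ≈ x - (1# + (ι r′ + ι r′))
    Y-column z = begin
      sum (λ w → Y w z)
        ≈⟨ charMatrix-column G′ (x - 1#) z ⟩
      x - 1# - (ι (degree G′ z) + ι (degree G′ z))
        ≡⟨ ≡.cong (λ d → x - 1# - (ι d + ι d)) (reg′ z) ⟩
      x - 1# - (ι r′ + ι r′)
        ≈⟨ solve 2 (λ x y → x :- :1 :- y := x :- (:1 :+ y)) refl x (ι r′ + ι r′) ⟩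
      x - (1# + (ι r′ + ι r′))
        ∎

    clear₁ : ∀ d j z → X (fromCentral d) (copy j z)
      + sum (λ l → weight₁ d l * X ((n ℕ.+ m) ↑ʳ l) (copy j z)) ≈ 0#
    clear₁ d j z = begin
      X (fromCentral d) (copy j z) + sum (λ l → weight₁ d l * X ((n ℕ.+ m) ↑ʳ l) (copy j z))
        ≈⟨ +-cong (X-central-copy d j z) (sum-weight₁ d (λ l → X ((n ℕ.+ m) ↑ʳ l) (copy j z))) ⟩
      - δ d (j ↑ˡ m) + sum (λ i → s * δ d (i ↑ˡ m) * sum (λ w → X (copy i w) (copy j z)))
        ≈⟨ +-congˡ (sum-cong λ i → trans
             (*-congˡ (trans (sum-cong λ w → X-copy-copy i w j z)
                (trans (sym (*-distribˡ-sum (δ i j) (λ w → Y w z))) (*-congˡ (Y-column z)))))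
             (solve 4 (λ s a d y → s :* a :* (d :* y) := d :* (a :* (s :* y))) refl
                s (δ d (i ↑ˡ m)) (δ i j) (x - (1# + (ι r′ + ι r′))))) ⟩
      - δ d (j ↑ˡ m) + sum (λ i → δ i j * (δ d (i ↑ˡ m) * (s * (x - (1# + (ι r′ + ι r′))))))
        ≈⟨ +-congˡ (sum-δʳ j (λ i → δ d (i ↑ˡ m) * (s * (x - (1# + (ι r′ + ι r′)))))) ⟩
      - δ d (j ↑ˡ m) + δ d (j ↑ˡ m) * (s * (x - (1# + (ι r′ + ι r′))))
        ≈⟨ +-congˡ (*-congˡ s-inverse) ⟩
      - δ d (j ↑ˡ m) + δ d (j ↑ˡ m) * 1#
        ≈⟨ solve 1 (λ a → :- a :+ a :* :1 := :0) refl (δ d (j ↑ˡ m)) ⟩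
      0#
        ∎

    -- The Schur complement of the copies, of which the blocks are computed below.
    Z : Matrix K (n ℕ.+ m)
    Z d e = X (fromCentral d) (fromCentral e) + sum (λ l → weight₁ d l * X ((n ℕ.+ m) ↑ʳ l) (fromCentral e))

    det-X : det K X ≈ det K Z * det K Y ^ n
    det-X = trans
      (det-schur (n ℕ.+ m) X weight₁ (λ d l →
         ≡.subst (λ l → X (fromCentral d) ((n ℕ.+ m) ↑ʳ l)
                        + sum (λ l′ → weight₁ d l′ * X ((n ℕ.+ m) ↑ʳ l′) ((n ℕ.+ m) ↑ʳ l)) ≈ 0#)
           (combine-remQuot {n} n′ l) (clear₁ d (proj₁ (remQuot {n} n′ l)) (proj₂ (remQuot {n} n′ l)))))
      (*-congˡ (det-repeat-block n Y (λ p q → X ((n ℕ.+ m) ↑ʳ p) ((n ℕ.+ m) ↑ʳ q)) X-copy-copy))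

    correction : ∀ d e → sum (λ l → weight₁ d l * X ((n ℕ.+ m) ↑ʳ l) (fromCentral e))
      ≈ - (s * ι n′ * sum (λ i → δ d (i ↑ˡ m) * δ e (i ↑ˡ m)))
    correction d e = begin
      sum (λ l → weight₁ d l * X ((n ℕ.+ m) ↑ʳ l) (fromCentral e))
        ≈⟨ sum-weight₁ d (λ l → X ((n ℕ.+ m) ↑ʳ l) (fromCentral e)) ⟩
      sum (λ i → s * δ d (i ↑ˡ m) * sum (λ w → X (copy i w) (fromCentral e)))
        ≈⟨ sum-cong (λ i → trans
             (*-congˡ (trans (sum-cong λ w → X-copy-central i w e) (sum-const n′ (- δ e (i ↑ˡ m)))))
             (solve 4 (λ s a n b → s :* a :* (n :* (:- b)) := (:- (s :* n)) :* (a :* b)) refl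
                s (δ d (i ↑ˡ m)) (ι n′) (δ e (i ↑ˡ m)))) ⟩
      sum (λ i → - (s * ι n′) * (δ d (i ↑ˡ m) * δ e (i ↑ˡ m)))
        ≈⟨ *-distribˡ-sum (- (s * ι n′)) (λ i → δ d (i ↑ˡ m) * δ e (i ↑ˡ m)) ⟨
      - (s * ι n′) * sum (λ i → δ d (i ↑ˡ m) * δ e (i ↑ˡ m))
        ≈⟨ solve 2 (λ y s → (:- y) :* s := :- (y :* s)) refl (s * ι n′) _ ⟩
      - (s * ι n′ * sum (λ i → δ d (i ↑ˡ m) * δ e (i ↑ˡ m)))
        ∎

    -- The correction only affects pairs of vertices of G.
    no-correction : ∀ d e → (∀ i → δ d (i ↑ˡ m) * δ e (i ↑ˡ m) ≈ 0#) →
                    Z d e ≈ X (fromCentral d) (fromCentral e)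
    no-correction d e vanish = begin
      Z d e
        ≈⟨ +-congˡ (correction d e) ⟩
      X (fromCentral d) (fromCentral e) - s * ι n′ * sum (λ i → δ d (i ↑ˡ m) * δ e (i ↑ˡ m))
        ≈⟨ +-congˡ (-‿cong (*-congˡ (sum-zero vanish))) ⟩
      X (fromCentral d) (fromCentral e) - s * ι n′ * 0#
        ≈⟨ solve 2 (λ a b → a :- b :* :0 := a) refl (X (fromCentral d) (fromCentral e)) (s * ι n′) ⟩
      X (fromCentral d) (fromCentral e)
        ∎

    left-zero : ∀ e d i → δ (n ↑ʳ e) (i ↑ˡ m) * δ d (i ↑ˡ m) ≈ 0#
    left-zero e d i = trans (*-congʳ (reflexive (δ-↑ʳ-↑ˡ e i))) (zeroˡ (δ d (i ↑ˡ m)))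

    right-zero : ∀ d e i → δ d (i ↑ˡ m) * δ (n ↑ʳ e) (i ↑ˡ m) ≈ 0#
    right-zero d e i = trans (*-congˡ (reflexive (δ-↑ʳ-↑ˡ e i))) (zeroʳ (δ d (i ↑ˡ m)))

    Z-base-middle : ∀ u e → Z (u ↑ˡ m) (n ↑ʳ e) ≈ - incidence G u e
    Z-base-middle u e = trans (no-correction (u ↑ˡ m) (n ↑ʳ e) (right-zero (u ↑ˡ m) e)) (X-base-middle u e)

    Z-middle-base : ∀ e u → Z (n ↑ʳ e) (u ↑ˡ m) ≈ - incidence G u e
    Z-middle-base e u = trans (no-correction (n ↑ʳ e) (u ↑ˡ m) (left-zero e (u ↑ˡ m))) (X-middle-base e u)

    Z-middle-middle : ∀ e f → Z (n ↑ʳ e) (n ↑ʳ f) ≈ δ e f * (x - ι 2)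
    Z-middle-middle e f = trans (no-correction (n ↑ʳ e) (n ↑ʳ f) (left-zero e (n ↑ʳ f))) (X-middle-middle e f)

    Z-base-base : ∀ u v → Z (u ↑ˡ m) (v ↑ˡ m)
      ≈ δ u v * (x - (ι n - 1# + ι n′)) - (1# - δ u v - adjacency G u v) - s * ι n′ * δ u v
    Z-base-base u v = +-cong (X-base-base u v) (trans (correction (u ↑ˡ m) (v ↑ˡ m)) (-‿cong (*-congˡ (begin
      sum (λ i → δ (u ↑ˡ m) (i ↑ˡ m) * δ (v ↑ˡ m) (i ↑ˡ m))
        ≈⟨ sum-cong (λ i → *-cong (reflexive (δ-↑ˡ u i)) (reflexive (≡.trans (δ-↑ˡ v i) (δ-sym v i)))) ⟩
      sum (λ i → δ u i * δ i v)
        ≈⟨ sum-δ u (λ i → δ i v) ⟩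
      δ u v
        ∎))))

    -- The multiples of the rows of the subdividing vertices that clear the block
    -- between them and the vertices of G.
    weight₂ : Vertex G → Edge G → Carrier
    weight₂ u e = t * incidence G u e

    clear₂ : ∀ u f → Z (u ↑ˡ m) (n ↑ʳ f) + sum (λ e → weight₂ u e * Z (n ↑ʳ e) (n ↑ʳ f)) ≈ 0#
    clear₂ u f = begin
      Z (u ↑ˡ m) (n ↑ʳ f) + sum (λ e → weight₂ u e * Z (n ↑ʳ e) (n ↑ʳ f))
        ≈⟨ +-cong (Z-base-middle u f) (sum-cong λ e → trans (*-congˡ (Z-middle-middle e f))
             (solve 4 (λ t b d y → t :* b :* (d :* y) := d :* (b :* (t :* y))) refl t (incidence G u e) (δ e f) (x - ι 2))) ⟩
      - incidence G u f + sum (λ e → δ e f * (incidence G u e * (t * (x - ι 2))))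
        ≈⟨ +-congˡ (trans (sum-δʳ f (λ e → incidence G u e * (t * (x - ι 2)))) (*-congˡ t-inverse)) ⟩
      - incidence G u f + incidence G u f * 1#
        ≈⟨ solve 1 (λ a → :- a :+ a :* :1 := :0) refl (incidence G u f) ⟩
      0#
        ∎

    -- The Schur complement of the subdividing vertices in Z.
    S : Matrix K n
    S u v = Z (u ↑ˡ m) (v ↑ˡ m) + sum (λ e → weight₂ u e * Z (n ↑ʳ e) (v ↑ˡ m))

    det-Z : det K Z ≈ det K S * (x - ι 2) ^ m
    det-Z = trans (det-schur n Z weight₂ clear₂)
      (*-congˡ (trans (det-cong λ e f → trans (Z-middle-middle e f) (sym (if-δ e f (x - ι 2))))
                      (det-scalar m (x - ι 2))))

    β-inverse : β * ((x - ι 2) * i) ≈ 1#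
    β-inverse = begin
      (1# - t) * ((x - ι 2) * i)
        ≈⟨ solve 3 (λ t y i → (:1 :- t) :* (y :* i) := (y :- t :* y) :* i) refl t (x - ι 2) i ⟩
      ((x - ι 2) - t * (x - ι 2)) * i
        ≈⟨ *-congʳ (+-congˡ (-‿cong t-inverse)) ⟩
      ((x - ι 2) - 1#) * i
        ≈⟨ solve 2 (λ x i → ((x :- (:1 :+ (:1 :+ :0))) :- :1) :* i := i :* (x :- (:1 :+ (:1 :+ (:1 :+ :0))))) refl x i ⟩
      i * (x - ι 3)
        ≈⟨ i-inverse ⟩
      1#
        ∎

    β-point : - β * point ≈ α
    β-point = begin
      - β * - (α * (x - ι 2) * i)
        ≈⟨ solve 4 (λ b a y i → (:- b) :* (:- (a :* y :* i)) := (b :* (y :* i)) :* a) refl β α (x - ι 2) i ⟩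
      β * ((x - ι 2) * i) * α
        ≈⟨ *-congʳ β-inverse ⟩
      1# * α
        ≈⟨ *-identityˡ α ⟩
      α
        ∎

    -- S = α I + β Q(G) − J = − β (point I − Q(G)) − J.
    S-entry : ∀ u v → S u v ≈ - β * (scalar K point u v - Q G u v) - 1#
    S-entry u v = begin
      S u v
        ≈⟨ +-cong (Z-base-base u v) (begin
             sum (λ e → weight₂ u e * Z (n ↑ʳ e) (v ↑ˡ m))
               ≈⟨ sum-cong (λ e → trans (*-congˡ (Z-middle-base e v))
                    (solve 3 (λ t a b → t :* a :* (:- b) := (:- t) :* (a :* b)) refl t (incidence G u e) (incidence G v e))) ⟩
             sum (λ e → - t * (incidence G u e * incidence G v e))
               ≈⟨ *-distribˡ-sum (- t) (λ e → incidence G u e * incidence G v e) ⟨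
             - t * sum (λ e → incidence G u e * incidence G v e)
               ≈⟨ *-congˡ (incidence-gram G u v) ⟩
             - t * Q G u v
               ∎) ⟩
      δ u v * (x - (ι n - 1# + ι n′)) - (1# - δ u v - adjacency G u v) - s * ι n′ * δ u v + - t * Q G u v
        ≈⟨ +-congʳ (+-congʳ (+-congˡ (-‿cong (+-congˡ (-‿cong A≈))))) ⟩
      δ u v * (x - (ι n - 1# + ι n′)) - (1# - δ u v - (Q G u v - δ u v * ι r)) - s * ι n′ * δ u v + - t * Q G u v
        ≈⟨ solve 6 (λ d y q r s t →
             d :* y :- (:1 :- d :- (q :- d :* r)) :- s :* d :+ (:- t) :* q
             := d :* (y :+ :1 :- r :- s) :+ (:1 :- t) :* q :- :1) refl
             (δ u v) (x - (ι n - 1# + ι n′)) (Q G u v) (ι r) (s * ι n′) t ⟩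
      δ u v * (x - (ι n - 1# + ι n′) + 1# - ι r - s * ι n′) + β * Q G u v - 1#
        ≡⟨ ≡.cong (λ n → δ u v * (x - (ι n - 1# + ι n′) + 1# - ι r - s * ι n′) + β * Q G u v - 1#) order≡ ⟩
      δ u v * α + β * Q G u v - 1#
        ≈⟨ +-congʳ (+-congʳ (*-congˡ β-point)) ⟨
      δ u v * (- β * point) + β * Q G u v - 1#
        ≈⟨ solve 4 (λ d b p q → d :* ((:- b) :* p) :+ b :* q :- :1 := (:- b) :* (d :* p :- q) :- :1) refl
             (δ u v) β point (Q G u v) ⟩
      - β * (δ u v * point - Q G u v) - 1#
        ≈⟨ +-congʳ (*-congˡ (+-congʳ (if-δ u v point))) ⟨
      - β * (scalar K point u v - Q G u v) - 1#
        ∎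
      where
      A≈ : adjacency G u v ≈ Q G u v - δ u v * ι r
      A≈ = begin
        adjacency G u v
          ≈⟨ solve 2 (λ a d → a := (d :+ a) :- d) refl (adjacency G u v) (δ u v * ι r) ⟩
        (δ u v * ι r + adjacency G u v) - δ u v * ι r
          ≡⟨ ≡.cong (λ d → (δ u v * ι d + adjacency G u v) - δ u v * ι r) (reg u) ⟨
        (δ u v * ι (degree G u) + adjacency G u v) - δ u v * ι r
          ≈⟨ +-congʳ (Q-entry G u v) ⟨
        Q G u v - δ u v * ι r
          ∎

    corona-charPoly : charPoly K (Q (G ⊙ G′)) x
                      ≈ value m (onesPoly (Q G) point) (charPoly K (Q G′) (x - 1#))
    corona-charPoly = begin
      det K X
        ≈⟨ det-X ⟩
      det K Z * det K Y ^ n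
        ≈⟨ *-cong (trans det-Z (*-congʳ (scaled-minus-ones k (Q G) S (ι r + ι r) (- β) point order≡
             (λ v → trans (charMatrix-column G point v)
                          (reflexive (≡.cong (λ d → point - (ι d + ι d)) (reg v))))
             S-entry)))
             (reflexive (≡.cong (det K Y ^_) order≡)) ⟩
      value m (onesPoly (Q G) point) (charPoly K (Q G′) (x - 1#))
        ∎

  -- Regular nonempty graphs of the same order and degree with the same
  -- characteristic polynomial, the data on which that of a corona depends.  The
  -- order is given by its predecessor, and common is the degree.
  record Alike (G H : Graph) : Set (c ⊔ ℓ₁) where
    field
      pred-order  : ℕ
      orderˡ      : order G ≡ suc pred-order
      orderʳ      : order H ≡ suc pred-order
      common      : ℕ
      degreeˡ     : ∀ v → degree G v ≡ common
      degreeʳ     : ∀ v → degree H v ≡ common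
      charPoly≈   : ∀ x → charPoly K (Q G) x ≈ charPoly K (Q H) x

  module _ {G H : Graph} (alike : Alike G H) where
    open Alike alike

    ι-size : ∀ F r → (∀ v → degree F v ≡ r) → ι (size F) * ι 2 ≈ ι (order F) * ι r
    ι-size F r reg = trans (sym (handshake F))
      (trans (sum-cong λ v → reflexive (≡.cong ι (reg v))) (sum-const (order F) (ι r)))

    -- By the handshake lemma, 2 m = n r.
    size≡ : size G ≡ size H
    size≡ = ι-injective (x-y≈0⇒x≈y (*-cancel-# (char0 1) (begin
      ι 2 * (ι (size G) - ι (size H))        ≈⟨ solve 3 (λ a b d → d :* (a :- b) := a :* d :- b :* d) refl (ι (size G)) (ι (size H)) (ι 2) ⟩
      ι (size G) * ι 2 - ι (size H) * ι 2    ≈⟨ x≈y⇒x-y≈0 (trans (ι-size G common degreeˡ)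
                                                  (trans (reflexive (≡.cong (λ n → ι n * ι common) (≡.trans orderˡ (≡.sym orderʳ))))
                                                         (sym (ι-size H common degreeʳ)))) ⟩
      0#                                     ∎)))

    -- Both sides are the characteristic polynomial divided by z − 2 r.
    onesPoly≈ : ∀ z → onesPoly (Q G) z ≈ onesPoly (Q H) z
    onesPoly≈ = cancel-shift-≈ (isPoly-onesFirst (Q G)) (isPoly-onesFirst (Q H)) (ι common + ι common) λ z →
      trans (sym (factored G degreeˡ orderˡ z)) (trans (charPoly≈ z) (factored H degreeʳ orderʳ z))
      where
      factored : ∀ F → (∀ v → degree F v ≡ common) → order F ≡ suc pred-order → ∀ z →
        charPoly K (Q F) z ≈ (z - (ι common + ι common)) * onesPoly (Q F) z
      factored F reg ord z = charMatrix-onesPoly pred-order (Q F) (ι common + ι common) z ord λ v →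
        trans (charMatrix-column F z v) (reflexive (≡.cong (λ d → z - (ι d + ι d)) (reg v)))

  corona-alike : ∀ {G₁ G₂ H₁ H₂} → Alike G₁ G₂ → Alike H₁ H₂ →
    ∀ x → charPoly K (Q (G₁ ⊙ H₁)) x ≈ charPoly K (Q (G₂ ⊙ H₂)) x
  corona-alike {G₁} {G₂} {H₁} {H₂} G~ H~ = agree-off exceptions
    (_ , _ , charPoly-monic (Q (G₁ ⊙ H₁))) (_ , _ , charPoly-monic (Q (G₂ ⊙ H₂))) generic
    where
    module G = Alike G~
    module H = Alike H~
    r r′ : ℕ
    r  = G.common
    r′ = H.common
    -- The points where s, t or i does not exist.
    exceptions : List Carrier
    exceptions = (1# + (ι r′ + ι r′)) ∷ ι 2 ∷ ι 3 ∷ []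

    generic : ∀ x → All (x #_) exceptions → charPoly K (Q (G₁ ⊙ H₁)) x ≈ charPoly K (Q (G₂ ⊙ H₂)) x
    generic x (x#₁ ∷ x#₂ ∷ x#₃ ∷ []) with inverse x#₁ | inverse x#₂ | inverse x#₃
    ... | s , s-inv | t , t-inv | i , i-inv = begin
      charPoly K (Q (G₁ ⊙ H₁)) x
        ≈⟨ corona-charPoly G₁ H₁ r r′ G.degreeˡ H.degreeˡ G.pred-order G.orderˡ x s t i s-inv t-inv i-inv ⟩
      value (order H₁) (size G₁) (onesPoly (Q G₁) (point (order H₁))) (charPoly K (Q H₁) (x - 1#))
        ≡⟨ ≡.cong₂ (λ n′ m → value n′ m (onesPoly (Q G₁) (point n′)) (charPoly K (Q H₁) (x - 1#)))
             (≡.trans H.orderˡ (≡.sym H.orderʳ)) (size≡ G~) ⟩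
      value (order H₂) (size G₂) (onesPoly (Q G₁) (point (order H₂))) (charPoly K (Q H₁) (x - 1#))
        ≈⟨ *-cong (*-congʳ (*-congˡ (*-congˡ (onesPoly≈ G~ (point (order H₂))))))
                  (^-cong (suc G.pred-order) (H.charPoly≈ (x - 1#))) ⟩
      value (order H₂) (size G₂) (onesPoly (Q G₂) (point (order H₂))) (charPoly K (Q H₂) (x - 1#))
        ≈⟨ corona-charPoly G₂ H₂ r r′ G.degreeʳ H.degreeʳ G.pred-order G.orderʳ x s t i s-inv t-inv i-inv ⟨
      charPoly K (Q (G₂ ⊙ H₂)) x
        ∎
      where
      point : ℕ → Carrier
      point n′ = Formula.point G.pred-order n′ r r′ x s t i
      value : ℕ → ℕ → Carrier → Carrier → Carrier
      value n′ = Formula.value G.pred-order n′ r r′ x s t i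

-- Isomorphisms and complete graphs

isomorphic-sym : ∀ {G H} → Isomorphic G H → Isomorphic H G
isomorphic-sym {G} {H} (π , π-adj) = flip π , λ u v →
  ≡.trans (≡.sym (≡.cong₂ (adj H) (inverseʳ π {u}) (inverseʳ π {v}))) (≡.sym (π-adj (π ⟨$⟩ˡ u) (π ⟨$⟩ˡ v)))

⟨$⟩ʳ-injective : ∀ {m n} (π : Permutation m n) {i j} → π ⟨$⟩ʳ i ≡ π ⟨$⟩ʳ j → i ≡ j
⟨$⟩ʳ-injective π eq = ≡.trans (≡.sym (inverseˡ π)) (≡.trans (≡.cong (π ⟨$⟩ˡ_) eq) (inverseˡ π))

preimage : ∀ {m n} (π : Permutation m n) {i j} → π ⟨$⟩ʳ i ≡ j → π ⟨$⟩ˡ j ≡ i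
preimage π ≡.refl = inverseˡ π

true≢false : true ≢ false
true≢false ()

-- A bijection that maps the image of one embedding into that of another, and
-- whose inverse does the converse, restricts to a bijection of the domains.
restrict : ∀ {m n a b} (π : Permutation m n) (e₁ : Fin a → Fin m) (e₂ : Fin b → Fin n) →
  (∀ {i j} → e₁ i ≡ e₁ j → i ≡ j) → (∀ {i j} → e₂ i ≡ e₂ j → i ≡ j) →
  (∀ i → ∃[ j ] π ⟨$⟩ʳ e₁ i ≡ e₂ j) → (∀ j → ∃[ i ] π ⟨$⟩ˡ e₂ j ≡ e₁ i) →
  Σ[ ρ ∈ Permutation a b ] ∀ i → π ⟨$⟩ʳ e₁ i ≡ e₂ (ρ ⟨$⟩ʳ i)
restrict π e₁ e₂ e₁-inj e₂-inj to from =
  permutation (λ i → proj₁ (to i)) (λ j → proj₁ (from j))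
    (λ j → e₂-inj (≡.trans (≡.sym (proj₂ (to (proj₁ (from j)))))
                  (≡.trans (≡.cong (π ⟨$⟩ʳ_) (≡.sym (proj₂ (from j)))) (inverseʳ π))))
    (λ i → e₁-inj (≡.trans (≡.sym (proj₂ (from (proj₁ (to i)))))
                  (≡.trans (≡.cong (π ⟨$⟩ˡ_) (≡.sym (proj₂ (to i)))) (inverseˡ π))))
  , λ i → proj₂ (to i)

count≡0⇒all-false : ∀ {n} (f : Fin n → Bool) → ∣ tabulate f ∣ ≡ 0 → ∀ i → f i ≡ false
count≡0⇒all-false {suc n} f eq i with f zero in f₀
count≡0⇒all-false {suc n} f () i       | true
count≡0⇒all-false {suc n} f eq zero    | false = f₀
count≡0⇒all-false {suc n} f eq (suc i) | false = count≡0⇒all-false (f ∘ suc) eq i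

count≢0⇒some-true : ∀ {n} (f : Fin n → Bool) → ∣ tabulate f ∣ ≢ 0 → ∃[ i ] f i ≡ true
count≢0⇒some-true {zero}  f ≢0 = ⊥-elim (≢0 ≡.refl)
count≢0⇒some-true {suc n} f ≢0 with f zero in f₀
... | true  = zero , f₀
... | false with count≢0⇒some-true (f ∘ suc) ≢0
...   | i , fi = suc i , fi

not-injective : ∀ {a b} → not a ≡ not b → a ≡ b
not-injective {true}  {true}  _ = ≡.refl
not-injective {false} {false} _ = ≡.refl

-- Bijections preserving the adjacency of the complement preserve adjacency.
complement-injective : ∀ G H (ρ : Permutation (order G) (order H)) u v →
  not (does (u ≟ v)) ∧ not (adj G u v)
    ≡ not (does (ρ ⟨$⟩ʳ u ≟ ρ ⟨$⟩ʳ v)) ∧ not (adj H (ρ ⟨$⟩ʳ u) (ρ ⟨$⟩ʳ v)) →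
  adj G u v ≡ adj H (ρ ⟨$⟩ʳ u) (ρ ⟨$⟩ʳ v)
complement-injective G H ρ u v eq with u ≟ v
... | yes ≡.refl = ≡.trans (adj-irrefl G u) (≡.sym (adj-irrefl H (ρ ⟨$⟩ʳ u)))
... | no u≢v = not-injective (≡.trans eq
  (≡.cong (λ b → not b ∧ not (adj H (ρ ⟨$⟩ʳ u) (ρ ⟨$⟩ʳ v)))
     (dec-false (ρ ⟨$⟩ʳ u ≟ ρ ⟨$⟩ʳ v) (u≢v ∘ ⟨$⟩ʳ-injective ρ))))

-- A connected graph of degree zero has a single vertex.
connected-edgeless : ∀ G → Connected G → (∀ v → degree G v ≡ 0) → order G ≡ 1
connected-edgeless G (nonempty , paths) deg≡0 = go (order G) ≡.refl nonempty
  where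
  endpoint : ∀ {u v} → Star (λ x y → T (adj G x y)) u v → u ≡ v
  endpoint ε               = ≡.refl
  endpoint {u} (_◅_ {j = y} uy _) = ⊥-elim (≡.subst T (count≡0⇒all-false (adj G u) (deg≡0 u) y) uy)

  all-equal : ∀ {n} → order G ≡ n → ∀ (u v : Fin n) → u ≡ v
  all-equal ≡.refl u v = endpoint (paths u v)

  go : ∀ n → order G ≡ n → NonZero n → n ≡ 1
  go (suc zero)    _  _ = ≡.refl
  go (suc (suc n)) eq _ with all-equal eq zero (suc zero)
  ... | ()

-- The number of vertices other than v that are not adjacent to v.
codegree : (G : Graph) → Vertex G → ℕ
codegree G v = ∣ tabulate (λ u → not (does (v ≟ u)) ∧ not (adj G v u)) ∣

complete-isomorphic : ∀ G H → order G ≡ order H →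
  (∀ v → codegree G v ≡ 0) → (∀ v → codegree H v ≡ 0) → Isomorphic G H
complete-isomorphic G H eq G-complete H-complete = π , λ u v →
  ≡.trans (adj-complete G G-complete u v)
    (≡.trans (≡.cong not (does-⇔ (mk⇔ (≡.cong (π ⟨$⟩ʳ_)) (⟨$⟩ʳ-injective π)) (u ≟ v) (π ⟨$⟩ʳ u ≟ π ⟨$⟩ʳ v)))
      (≡.sym (adj-complete H H-complete (π ⟨$⟩ʳ u) (π ⟨$⟩ʳ v))))
  where
  π : Permutation (order G) (order H)
  π = cast-id eq

  adj-complete : ∀ F → (∀ v → codegree F v ≡ 0) → ∀ u v → adj F u v ≡ not (does (u ≟ v))
  adj-complete F complete u v with u ≟ v | count≡0⇒all-false _ (complete u) v
  ... | yes ≡.refl | _ = adj-irrefl F u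
  ... | no _       | e = not-injective e

-- Recovering the factors from an isomorphism of coronas

module Isomorphisms {c ℓ₁ ℓ₂ : Level} (K : HeytingField c ℓ₁ ℓ₂) (char0 : CharacteristicZero K) where

  open Field K
  open GraphSums K
  open Polynomials K char0 using (ι-injective)

  order-degree-codegree : ∀ G v → order G ≡ suc (degree G v ℕ.+ codegree G v)
  order-degree-codegree G v = ι-injective (begin
    ι (order G)
      ≈⟨ solve 2 (λ n d → n := :1 :+ (d :+ (n :- :1 :- d))) refl (ι (order G)) (ι (degree G v)) ⟩
    1# + (ι (degree G v) + (ι (order G) - 1# - ι (degree G v)))
      ≈⟨ +-congˡ (+-congˡ (trans (ι-∣∣ (λ u → not (does (v ≟ u)) ∧ not (adj G v u))) (sum-nonadjacent G v))) ⟨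
    1# + (ι (degree G v) + ι (codegree G v))
      ≈⟨ +-congˡ (×-homo-+ 1# (degree G v) (codegree G v)) ⟨
    ι (suc (degree G v ℕ.+ codegree G v))
      ∎)

  isomorphic-degree : ∀ G H ((π , _) : Isomorphic G H) v → degree G v ≡ degree H (π ⟨$⟩ʳ v)
  isomorphic-degree G H (π , π-adj) v = ι-injective (begin
    ι (degree G v)                                       ≈⟨ ι-degree G v ⟩
    sum (adjacency G v)                                  ≈⟨ sum-cong (λ u → reflexive (≡.cong [_] (π-adj v u))) ⟩
    sum (λ u → adjacency H (π ⟨$⟩ʳ v) (π ⟨$⟩ʳ u))        ≈⟨ sum-permute (adjacency H (π ⟨$⟩ʳ v)) π ⟨
    sum (adjacency H (π ⟨$⟩ʳ v))                         ≈⟨ ι-degree H (π ⟨$⟩ʳ v) ⟨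
    ι (degree H (π ⟨$⟩ʳ v))                              ∎)

  module _ (G H : Graph) where
    open CoronaSums K G H

    degree-base : ∀ k → order G ≡ suc k → ∀ u → degree (G ⊙ H) (base u) ≡ k ℕ.+ order H
    degree-base k ord u = ι-injective (begin
      ι (degree (G ⊙ H) (base u))      ≈⟨ ι-degree-base u ⟩
      ι (order G) - 1# + ι (order H)   ≡⟨ ≡.cong (λ n → ι n - 1# + ι (order H)) ord ⟩
      ι (suc k) - 1# + ι (order H)     ≈⟨ solve 2 (λ k n → :1 :+ k :- :1 :+ n := k :+ n) refl (ι k) (ι (order H)) ⟩
      ι k + ι (order H)                ≈⟨ ×-homo-+ 1# k (order H) ⟨
      ι (k ℕ.+ order H)                ∎)

    degree-middle : ∀ e → degree (G ⊙ H) (middle e) ≡ 2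
    degree-middle e = ι-injective (ι-degree-middle e)

    degree-copy : ∀ i w → degree (G ⊙ H) (copy i w) ≡ suc (degree H w)
    degree-copy i w = ι-injective (ι-degree-copy i w)

  -- An isomorphism of coronas G₁ ⊙ H₁ and G₂ ⊙ H₂ respects the vertices of G₁
  -- and G₂ if their common degree D in the coronas differs from the degrees 2
  -- and r′ + 1 of the other vertices.
  module Transport (G₁ H₁ G₂ H₂ : Graph) (iso : Isomorphic (G₁ ⊙ H₁) (G₂ ⊙ H₂)) (D r′ : ℕ)
    (deg₁ : ∀ u → degree (G₁ ⊙ H₁) (CoronaGraph.base G₁ H₁ u) ≡ D)
    (deg₂ : ∀ u → degree (G₂ ⊙ H₂) (CoronaGraph.base G₂ H₂ u) ≡ D)
    (reg₁ : ∀ w → degree H₁ w ≡ r′) (reg₂ : ∀ w → degree H₂ w ≡ r′)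
    (D≢2 : D ≢ 2) (D≢suc-r′ : D ≢ suc r′) where

    private
      module C₁ = CoronaGraph G₁ H₁
      module C₂ = CoronaGraph G₂ H₂
      π : Permutation (order (G₁ ⊙ H₁)) (order (G₂ ⊙ H₂))
      π = proj₁ iso

      image-degree : ∀ p q → π ⟨$⟩ʳ p ≡ q → degree (G₁ ⊙ H₁) p ≡ degree (G₂ ⊙ H₂) q
      image-degree p q ≡.refl = isomorphic-degree (G₁ ⊙ H₁) (G₂ ⊙ H₂) iso p

      image-adj : ∀ {p p′ q q′} → π ⟨$⟩ʳ p ≡ q → π ⟨$⟩ʳ p′ ≡ q′ →
                  adj (G₁ ⊙ H₁) p p′ ≡ adj (G₂ ⊙ H₂) q q′
      image-adj {p} {p′} ≡.refl ≡.refl = proj₂ iso p p′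

    base→base : ∀ u → ∃[ v ] π ⟨$⟩ʳ C₁.base u ≡ C₂.base v
    base→base u with π ⟨$⟩ʳ C₁.base u in eq
    ... | q with C₂.view q
    ...   | C₂.isBase v   = v , ≡.refl
    ...   | C₂.isMiddle e = ⊥-elim (D≢2
            (≡.trans (≡.sym (deg₁ u)) (≡.trans (image-degree (C₁.base u) (C₂.middle e) eq) (degree-middle G₂ H₂ e))))
    ...   | C₂.isCopy i w = ⊥-elim (D≢suc-r′
            (≡.trans (≡.sym (deg₁ u)) (≡.trans (image-degree (C₁.base u) (C₂.copy i w) eq)
              (≡.trans (degree-copy G₂ H₂ i w) (≡.cong suc (reg₂ w))))))

    private
      copy→base-impossible : ∀ i w v → π ⟨$⟩ʳ C₁.copy i w ≢ C₂.base v
      copy→base-impossible i w v eq = D≢suc-r′ (≡.trans (≡.sym (deg₂ v))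
        (≡.trans (≡.sym (image-degree (C₁.copy i w) (C₂.base v) eq)) (≡.trans (degree-copy G₁ H₁ i w) (≡.cong suc (reg₁ w)))))

      adj-copy-neighbours : ∀ i w w′ → adj H₁ w w′ ≡ true → adj (G₁ ⊙ H₁) (C₁.copy i w) (C₁.copy i w′) ≡ true
      adj-copy-neighbours i w w′ ww′ =
        ≡.trans (C₁.adj-same-copy i w w′) ww′

      -- All neighbours of a subdividing vertex are vertices of G₂, whereas a
      -- vertex of a copy has a neighbour in the same copy.
      copy→middle-impossible : r′ ≢ 0 → ∀ i w e → π ⟨$⟩ʳ C₁.copy i w ≢ C₂.middle e
      copy→middle-impossible r′≢0 i w e eq
        with count≢0⇒some-true (adj H₁ w) (λ deg≡0 → r′≢0 (≡.trans (≡.sym (reg₁ w)) deg≡0))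
      ... | w′ , ww′ with π ⟨$⟩ʳ C₁.copy i w′ in eq′
      ...   | q with C₂.view q
      ...     | C₂.isBase v    = copy→base-impossible i w′ v eq′
      ...     | C₂.isMiddle f  = true≢false (≡.trans (≡.sym (adj-copy-neighbours i w w′ ww′))
                (≡.trans (image-adj eq eq′) (C₂.adj-middle-middle e f)))
      ...     | C₂.isCopy j z  = true≢false (≡.trans (≡.sym (adj-copy-neighbours i w w′ ww′))
                (≡.trans (image-adj eq eq′) (≡.trans (C₂.adj-central-copy (order G₂ ↑ʳ e) j z)
                  (dec-false (order G₂ ↑ʳ e ≟ j ↑ˡ size G₂) (λ p → C₂.↑ˡ≢↑ʳ j e (≡.sym p))))))

    copy→copy : r′ ≢ 0 → ∀ i j → π ⟨$⟩ʳ C₁.base i ≡ C₂.base j →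
                ∀ w → ∃[ z ] π ⟨$⟩ʳ C₁.copy i w ≡ C₂.copy j z
    copy→copy r′≢0 i j i↦j w with π ⟨$⟩ʳ C₁.copy i w in eq
    ... | q with C₂.view q
    ...   | C₂.isBase v     = ⊥-elim (copy→base-impossible i w v eq)
    ...   | C₂.isMiddle e   = ⊥-elim (copy→middle-impossible r′≢0 i w e eq)
    ...   | C₂.isCopy j′ z with j ≟ j′
    ...     | yes ≡.refl = z , ≡.refl
    ...     | no j≢j′ = ⊥-elim (true≢false (≡.trans (≡.sym attached) (≡.trans (image-adj i↦j eq) detached)))
      where
      attached : adj (G₁ ⊙ H₁) (C₁.base i) (C₁.copy i w) ≡ true
      attached = ≡.trans (C₁.adj-central-copy (i ↑ˡ size G₁) i w) (dec-true (i ↑ˡ size G₁ ≟ i ↑ˡ size G₁) ≡.refl)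
      detached : adj (G₂ ⊙ H₂) (C₂.base j) (C₂.copy j′ z) ≡ false
      detached = ≡.trans (C₂.adj-central-copy (j ↑ˡ size G₂) j′ z)
        (dec-false (j ↑ˡ size G₂ ≟ j′ ↑ˡ size G₂) (λ p → j≢j′ (↑ˡ-injective (size G₂) j j′ p)))

  -- Regular graphs with isomorphic coronas, where the parameters of G₁ and G₂
  -- agree, and those of H₁ and H₂.
  module Cancellation (G₁ G₂ H₁ H₂ : Graph) (k r r′ : ℕ)
    (order₁ : order G₁ ≡ suc k) (order₂ : order G₂ ≡ suc k) (order-H : order H₁ ≡ order H₂)
    (reg-G₁ : ∀ v → degree G₁ v ≡ r) (reg-G₂ : ∀ v → degree G₂ v ≡ r)
    (reg-H₁ : ∀ w → degree H₁ w ≡ r′) (reg-H₂ : ∀ w → degree H₂ w ≡ r′)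
    (iso : Isomorphic (G₁ ⊙ H₁) (G₂ ⊙ H₂)) where

    private
      module C₁ = CoronaGraph G₁ H₁
      module C₂ = CoronaGraph G₂ H₂
      -- The degree of the vertices of G₁ and G₂ in the coronas.
      D : ℕ
      D = k ℕ.+ order H₁
      π : Permutation (order (G₁ ⊙ H₁)) (order (G₂ ⊙ H₂))
      π = proj₁ iso
      deg₁ : ∀ u → degree (G₁ ⊙ H₁) (C₁.base u) ≡ D
      deg₁ = degree-base G₁ H₁ k order₁
      deg₂ : ∀ u → degree (G₂ ⊙ H₂) (C₂.base u) ≡ D
      deg₂ u = ≡.trans (degree-base G₂ H₂ k order₂ u) (≡.cong (k ℕ.+_) (≡.sym order-H))

    module Separated (D≢2 : D ≢ 2) (D≢suc-r′ : D ≢ suc r′) where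
      private
        module To   = Transport G₁ H₁ G₂ H₂ iso D r′ deg₁ deg₂ reg-H₁ reg-H₂ D≢2 D≢suc-r′
        module From = Transport G₂ H₂ G₁ H₁ (isomorphic-sym {G₁ ⊙ H₁} {G₂ ⊙ H₂} iso) D r′
                                deg₂ deg₁ reg-H₂ reg-H₁ D≢2 D≢suc-r′

        bases : Σ[ ρ ∈ Permutation (order G₁) (order G₂) ] ∀ u → π ⟨$⟩ʳ C₁.base u ≡ C₂.base (ρ ⟨$⟩ʳ u)
        bases = restrict π C₁.base C₂.base
          (λ {u v} → C₁.base-injective u v) (λ {u v} → C₂.base-injective u v) To.base→base From.base→base

        image-adj : ∀ p p′ {q q′} → π ⟨$⟩ʳ p ≡ q → π ⟨$⟩ʳ p′ ≡ q′ → adj (G₁ ⊙ H₁) p p′ ≡ adj (G₂ ⊙ H₂) q q′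
        image-adj p p′ ≡.refl ≡.refl = proj₂ iso p p′

      -- The corona induces the complement of G on the vertices of G.
      bases-isomorphic : Isomorphic G₁ G₂
      bases-isomorphic = ρ , λ u v → complement-injective G₁ G₂ ρ u v
        (≡.trans (≡.sym (C₁.adj-base-base u v))
          (≡.trans (image-adj (C₁.base u) (C₁.base v) (proj₂ bases u) (proj₂ bases v))
            (C₂.adj-base-base (ρ ⟨$⟩ʳ u) (ρ ⟨$⟩ʳ v))))
        where
        ρ : Permutation (order G₁) (order G₂)
        ρ = proj₁ bases

      copies-isomorphic : r′ ≢ 0 → Vertex G₁ → Isomorphic H₁ H₂
      copies-isomorphic r′≢0 i = ρ , λ w z → ≡.trans (≡.sym (C₁.adj-same-copy i w z))
          (≡.trans (image-adj (C₁.copy i w) (C₁.copy i z) (proj₂ copies w) (proj₂ copies z))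
            (C₂.adj-same-copy j (ρ ⟨$⟩ʳ w) (ρ ⟨$⟩ʳ z)))
        where
        j : Vertex G₂
        j = proj₁ (To.base→base i)
        i↦j : π ⟨$⟩ʳ C₁.base i ≡ C₂.base j
        i↦j = proj₂ (To.base→base i)
        copies : Σ[ ρ ∈ Permutation (order H₁) (order H₂) ] ∀ w → π ⟨$⟩ʳ C₁.copy i w ≡ C₂.copy j (ρ ⟨$⟩ʳ w)
        copies = restrict π (C₁.copy i) (C₂.copy j)
          (λ {w z} → C₁.copy-injective i w z) (λ {w z} → C₂.copy-injective j w z)
          (To.copy→copy r′≢0 i j i↦j) (From.copy→copy r′≢0 j i (preimage π i↦j))
        ρ : Permutation (order H₁) (order H₂)
        ρ = proj₁ copies

-- Cospectral regular graphs and their coronas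

module Corollary {c ℓ₁ ℓ₂ : Level} (K : HeytingField c ℓ₁ ℓ₂)
  (closed : AlgebraicallyClosed K) (char0 : CharacteristicZero K) where

  open Field K
  open Polynomials K char0
  open Spectrum K closed char0
  open GraphSums K
  open CoronaCharPoly K closed char0
  open Isomorphisms K char0

  nonempty-order : ∀ {n} → NonZero n → ∃[ k ] n ≡ suc k
  nonempty-order {suc k} _ = k , ≡.refl

  trace-Q : ∀ G r → (∀ v → degree G v ≡ r) → trace (Q G) ≈ ι (order G) * ι r
  trace-Q G r reg = begin
    sum (λ v → Q G v v)   ≈⟨ sum-cong (λ v → trans (Q-diagonal G v) (reflexive (≡.cong ι (reg v)))) ⟩
    sum {order G} (λ v → ι r)  ≈⟨ sum-const (order G) (ι r) ⟩
    ι (order G) * ι r     ∎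

  cospectral⇒alike : ∀ {G H} → Connected G → Regular G → Regular H → QCospectral K G H → Alike G H
  cospectral⇒alike {G} {H} (nonempty , _) (r , reg-G) (r′ , reg-H) (_ , same) with nonempty-order nonempty
  ... | k , orderˡ = record
    { pred-order = k
    ; orderˡ     = orderˡ
    ; orderʳ     = orderʳ
    ; common     = r
    ; degreeˡ    = reg-G
    ; degreeʳ    = λ v → ≡.trans (reg-H v) (≡.sym r≡r′)
    ; charPoly≈  = charPoly≈
    }
    where
    charPoly≈ : ∀ x → charPoly K (Q G) x ≈ charPoly K (Q H) x
    charPoly≈ = sameSpectrum⇒sameCharPoly (Q G) (Q H) same
    orderʳ : order H ≡ suc k
    orderʳ = ≡.trans (≡.sym (charPoly-determines-order (Q G) (Q H) charPoly≈)) orderˡ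
    r≡r′ : r ≡ r′
    r≡r′ = ι-injective (x-y≈0⇒x≈y (*-cancel-# (char0 k) (begin
      ι (suc k) * (ι r - ι r′)
        ≈⟨ solve 3 (λ n a b → n :* (a :- b) := n :* a :- n :* b) refl (ι (suc k)) (ι r) (ι r′) ⟩
      ι (suc k) * ι r - ι (suc k) * ι r′
        ≡⟨ ≡.cong₂ (λ m n → ι m * ι r - ι n * ι r′) orderˡ orderʳ ⟨
      ι (order G) * ι r - ι (order H) * ι r′
        ≈⟨ x≈y⇒x-y≈0 (trans (sym (trace-Q G r reg-G))
             (trans (charPoly-determines-trace (Q G) (Q H) charPoly≈) (trace-Q H r′ reg-H))) ⟩
      0#
        ∎)))

  alike-refl : ∀ {G} → Connected G → Regular G → Alike G G
  alike-refl {G} (nonempty , _) (r , reg) with nonempty-order nonempty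
  ... | k , order≡ = record
    { pred-order = k
    ; orderˡ     = order≡
    ; orderʳ     = order≡
    ; common     = r
    ; degreeˡ    = reg
    ; degreeʳ    = reg
    ; charPoly≈  = λ x → refl
    }

  module _ {G₁ G₂ : Graph} (alike : Alike G₁ G₂) (connected : Connected G₁) where
    open Alike alike

    vertexˡ : Vertex G₁
    vertexˡ = ≡.subst Fin (≡.sym orderˡ) zero

    codegree-sum : ∀ G → order G ≡ suc pred-order → (∀ v → degree G v ≡ common) →
                   ∀ v → pred-order ≡ common ℕ.+ codegree G v
    codegree-sum G ord reg v = ℕₚ.suc-injective (≡.trans (≡.sym ord)
      (≡.trans (order-degree-codegree G v) (≡.cong (λ d → suc (d ℕ.+ codegree G v)) (reg v))))

    common≤pred-order : common ≤ pred-order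
    common≤pred-order = ℕₚ.≤-trans (ℕₚ.m≤m+n common _) (ℕₚ.≤-reflexive (≡.sym (codegree-sum G₁ orderˡ degreeˡ vertexˡ)))

    -- Complete graphs of the same order are isomorphic, and a connected graph
    -- that is not complete has positive degree less than n − 1.
    complete-or-sparse : Isomorphic G₁ G₂ Sum.⊎ (common ≢ 0 × common ℕ.< pred-order)
    complete-or-sparse with pred-order ℕₚ.≟ common
    ... | yes full = inj₁ (complete-isomorphic G₁ G₂ (≡.trans orderˡ (≡.sym orderʳ))
                       (codegree≡0 G₁ orderˡ degreeˡ) (codegree≡0 G₂ orderʳ degreeʳ))
      where
      codegree≡0 : ∀ G → order G ≡ suc pred-order → (∀ v → degree G v ≡ common) → ∀ v → codegree G v ≡ 0
      codegree≡0 G ord reg v = ≡.sym (ℕₚ.+-cancelˡ-≡ common 0 (codegree G v)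
        (≡.trans (ℕₚ.+-identityʳ common) (≡.trans (≡.sym full) (codegree-sum G ord reg v))))
    ... | no not-full = inj₂ (common≢0 , ℕₚ.≤∧≢⇒< common≤pred-order (not-full ∘ ≡.sym))
      where
      common≢0 : common ≢ 0
      common≢0 eq = not-full (≡.trans
        (ℕₚ.suc-injective (≡.trans (≡.sym orderˡ) (connected-edgeless G₁ connected (λ v → ≡.trans (degreeˡ v) eq))))
        (≡.sym eq))

  module _ {G₁ G₂ H₁ H₂ : Graph} (G~ : Alike G₁ G₂) (H~ : Alike H₁ H₂)
           (connected-G : Connected G₁) (connected-H : Connected H₁)
           (iso : Isomorphic (G₁ ⊙ H₁) (G₂ ⊙ H₂)) where

    private
      module G = Alike G~
      module H = Alike H~

      -- The degree n − 1 + n′ of the vertices of G₁ and G₂ in the coronas.  It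
      -- exceeds 2 and r′ + 1 if one of the factors is sparse.
      D : ℕ
      D = G.pred-order ℕ.+ order H₁

      module C = Cancellation G₁ G₂ H₁ H₂ G.pred-order G.common H.common
        G.orderˡ G.orderʳ (≡.trans H.orderˡ (≡.sym H.orderʳ))
        G.degreeˡ G.degreeʳ H.degreeˡ H.degreeʳ iso

      sparse⇒2≤ : ∀ {r k} → r ≢ 0 × r ℕ.< k → 2 ≤ k
      sparse⇒2≤ (r≢0 , r<k) = ℕₚ.≤-trans (s≤s (ℕₚ.n≢0⇒n>0 r≢0)) r<k

      D≡ : D ≡ suc (G.pred-order ℕ.+ H.pred-order)
      D≡ = ≡.trans (≡.cong (G.pred-order ℕ.+_) H.orderˡ) (ℕₚ.+-suc G.pred-order H.pred-order)

      >⇒D≢ : ∀ {m} → m ≤ G.pred-order ℕ.+ H.pred-order → D ≢ m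
      >⇒D≢ m≤ eq = ℕₚ.<-irrefl (≡.sym eq) (ℕₚ.≤-trans (s≤s m≤) (ℕₚ.≤-reflexive (≡.sym D≡)))

    cancel-base : Isomorphic G₁ G₂
    cancel-base with complete-or-sparse G~ connected-G
    ... | inj₁ isomorphic = isomorphic
    ... | inj₂ sparse = C.Separated.bases-isomorphic
      (>⇒D≢ (ℕₚ.≤-trans (sparse⇒2≤ sparse) (ℕₚ.m≤m+n _ _)))
      (>⇒D≢ (ℕₚ.+-mono-≤ (ℕₚ.≤-trans (s≤s z≤n) (sparse⇒2≤ sparse)) (common≤pred-order H~ connected-H)))

    cancel-copies : Isomorphic H₁ H₂
    cancel-copies with complete-or-sparse H~ connected-H
    ... | inj₁ isomorphic = isomorphic
    ... | inj₂ sparse = C.Separated.copies-isomorphic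
      (>⇒D≢ (ℕₚ.≤-trans (sparse⇒2≤ sparse) (ℕₚ.m≤n+m _ _)))
      (>⇒D≢ (ℕₚ.≤-trans (proj₂ sparse) (ℕₚ.m≤n+m _ _)))
      (proj₁ sparse) (vertexˡ G~ connected-G)

  coronas-cospectral : ∀ {G₁ G₂ H₁ H₂} → Alike G₁ G₂ → Alike H₁ H₂ →
    ¬ Isomorphic (G₁ ⊙ H₁) (G₂ ⊙ H₂) → QCospectral K (G₁ ⊙ H₁) (G₂ ⊙ H₂)
  coronas-cospectral {G₁} {G₂} {H₁} {H₂} G~ H~ ≇ = ≇ ,
    sameCharPoly⇒sameSpectrum (Q (G₁ ⊙ H₁)) (Q (G₂ ⊙ H₂)) (corona-alike G~ H~)

corollary3p14 : ∀ {c ℓ₁ ℓ₂} (K : HeytingField c ℓ₁ ℓ₂) → AlgebraicallyClosed K → CharacteristicZero K →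
    (∀ G₁ G₂ H →
    Connected G₁ → Connected G₂ → Connected H →
    Regular G₁ → Regular G₂ → Regular H →
    QCospectral K G₁ G₂ → QCospectral K (H ⊙ G₁) (H ⊙ G₂))
    × (∀ G₁ G₂ H →
    Connected G₁ → Connected G₂ → Connected H →
    Regular G₁ → Regular G₂ → Regular H →
    QCospectral K G₁ G₂ → QCospectral K (G₁ ⊙ H) (G₂ ⊙ H))
    × (∀ G₁ G₂ H₁ H₂ →
    Connected G₁ → Connected G₂ → Connected H₁ → Connected H₂ →
    Regular G₁ → Regular G₂ → Regular H₁ → Regular H₂ →
    QCospectral K G₁ G₂ → QCospectral K H₁ H₂ →
    QCospectral K (G₁ ⊙ H₁) (G₂ ⊙ H₂))
corollary3p14 K closed char0 = part-a , part-b , part-c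
  where
  open Corollary K closed char0

  part-a : ∀ G₁ G₂ H → Connected G₁ → Connected G₂ → Connected H → Regular G₁ → Regular G₂ → Regular H →
    QCospectral K G₁ G₂ → QCospectral K (H ⊙ G₁) (H ⊙ G₂)
  part-a G₁ G₂ H conn₁ conn₂ conn reg₁ reg₂ reg cospectral =
    coronas-cospectral H~ G~ λ iso → proj₁ cospectral (cancel-copies H~ G~ conn conn₁ iso)
    where
    H~ = alike-refl conn reg
    G~ = cospectral⇒alike conn₁ reg₁ reg₂ cospectral

  part-b : ∀ G₁ G₂ H → Connected G₁ → Connected G₂ → Connected H → Regular G₁ → Regular G₂ → Regular H →
    QCospectral K G₁ G₂ → QCospectral K (G₁ ⊙ H) (G₂ ⊙ H)
  part-b G₁ G₂ H conn₁ conn₂ conn reg₁ reg₂ reg cospectral =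
    coronas-cospectral G~ H~ λ iso → proj₁ cospectral (cancel-base G~ H~ conn₁ conn iso)
    where
    H~ = alike-refl conn reg
    G~ = cospectral⇒alike conn₁ reg₁ reg₂ cospectral

  part-c : ∀ G₁ G₂ H₁ H₂ → Connected G₁ → Connected G₂ → Connected H₁ → Connected H₂ →
    Regular G₁ → Regular G₂ → Regular H₁ → Regular H₂ →
    QCospectral K G₁ G₂ → QCospectral K H₁ H₂ → QCospectral K (G₁ ⊙ H₁) (G₂ ⊙ H₂)
  part-c G₁ G₂ H₁ H₂ conn-G₁ _ conn-H₁ _ reg-G₁ reg-G₂ reg-H₁ reg-H₂ cospectral-G cospectral-H =
    coronas-cospectral G~ H~ λ iso → proj₁ cospectral-G (cancel-base G~ H~ conn-G₁ conn-H₁ iso)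
    where
    G~ = cospectral⇒alike conn-G₁ reg-G₁ reg-G₂ cospectral-G
    H~ = cospectral⇒alike conn-H₁ reg-H₁ reg-H₂ cospectral-H
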